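{- For every integer $k\ge 1$, define $P^k:[0,\infty)\to\mathbb{R}$ by $$P^k(x)=\begin{cases} e^{ -\sqrt{k}\left(x-\frac{k-1}{k}\right)}, & x>1,\\ 1, & 0\le x\le 1.\end{cases}$$ Then $P^k$ is non-increasing, $P^k$ is convex on $[1,\infty)$, and whenever $S$ is a sum of finitely many independent (not necessarily identically distributed) Bernoulli random variables and $x\ge 0$ is such that $\mathbb{E}[S]=kx$, one has $$\Pr[S\le k-1]\le P^k(x).$$ -}

module Defs where

open import Algebra.Bundles using (CommutativeRing; Semiring)
import Algebra.Definitions.RawMonoid
import Algebra.Definitions.RawSemiring
open import Algebra.Structures using (IsCommutativeRing)
open import Axiom.ExcludedMiddle using (ExcludedMiddle)
open import Data.Bool.Base using (if_then_else_)
open import Data.Fin.Base using (Fin; toℕ)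
open import Data.Nat.Base as ℕ using (ℕ; _!)
open import Data.Product.Base using (∃; _×_; _,_)
open import Level using (0ℓ)
import Relation.Binary.Construct.NonStrictToStrict as NonStrictToStrict
open import Relation.Binary.PropositionalEquality.Core using (_≡_; _≢_)
open import Relation.Binary.Structures using (IsTotalOrder)
open import Relation.Nullary.Decidable.Core using (does; yes; no)
open import Relation.Nullary.Negation.Core using (¬_)
open import Relation.Unary using (Pred; _∈_; _≐_; _⊥_; U; ∁; ⋃)

-- The real numbers, characterised up to unique isomorphism as the
-- Dedekind-complete ordered field.
record CompleteOrderedField : Set₁ where
  infix  4 _≈_ _≤_
  infixl 6 _+_
  infixl 7 _*_
  infix  8 -_
  infix  9 _⁻¹
  field
    Carrier : Set
    _≈_ _≤_ : Carrier → Carrier → Set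
    _+_ _*_ : Carrier → Carrier → Carrier
    -_ _⁻¹  : Carrier → Carrier
    0# 1#   : Carrier

    isCommutativeRing : IsCommutativeRing _≈_ _+_ _*_ -_ 0# 1#
    0≉1               : ¬ (0# ≈ 1#)
    -- As usual for a total inverse, nothing is assumed about 0# ⁻¹.
    *-inverseʳ        : ∀ x → ¬ (x ≈ 0#) → x * x ⁻¹ ≈ 1#

    isTotalOrder      : IsTotalOrder _≈_ _≤_
    +-monoˡ-≤         : ∀ z {x y} → x ≤ y → x + z ≤ y + z
    *-nonNeg          : ∀ {x y} → 0# ≤ x → 0# ≤ y → 0# ≤ x * y

  UpperBound : Pred Carrier 0ℓ → Carrier → Set
  UpperBound A u = ∀ {a} → a ∈ A → a ≤ u

  field
    supremum : (A : Pred Carrier 0ℓ) → ∃ A → ∃ (UpperBound A) →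
               ∃ λ s → UpperBound A s × (∀ {u} → UpperBound A u → s ≤ u)

  commutativeRing : CommutativeRing 0ℓ 0ℓ
  commutativeRing = record { isCommutativeRing = isCommutativeRing }

  open CommutativeRing commutativeRing public using (_-_)
  open NonStrictToStrict _≈_ _≤_ public using (_<_)
  open Algebra.Definitions.RawSemiring
    (Semiring.rawSemiring (CommutativeRing.semiring commutativeRing)) public
    using (sum; product; _^_) renaming (_×_ to _×ℕ_)

  infixl 7 _/_
  _/_ : Carrier → Carrier → Carrier
  x / y = x * y ⁻¹

  fromℕ : ℕ → Carrier
  fromℕ n = n ×ℕ 1#

  infix 4 _⟶_
  _⟶_ : (ℕ → Carrier) → Carrier → Set
  s ⟶ l = ∀ ε → 0# < ε → ∃ λ N → ∀ n → N ℕ.≤ n →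
          (- ε < s n - l) × (s n - l < ε)

  HasSum : (ℕ → Carrier) → Carrier → Set
  HasSum f l = (λ n → sum {n} (λ i → f (toℕ i))) ⟶ l

  NonIncreasingOn : Pred Carrier 0ℓ → (Carrier → Carrier) → Set
  NonIncreasingOn D f = ∀ {x y} → x ∈ D → y ∈ D → x ≤ y → f y ≤ f x

  -- Used only for convex sets D.
  ConvexOn : Pred Carrier 0ℓ → (Carrier → Carrier) → Set
  ConvexOn D f = ∀ {x y} → x ∈ D → y ∈ D → ∀ {t} → 0# ≤ t → t ≤ 1# →
    f (t * x + (1# - t) * y) ≤ t * f x + (1# - t) * f y

-- Classical real analysis: excluded middle is what makes the case
-- distinction 1 < x, and the description operator below, total.
module Analysis (em : ExcludedMiddle 0ℓ) (ℝ : CompleteOrderedField) where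
  open CompleteOrderedField ℝ

  -- The real number with property Q, for Q satisfied by exactly one real
  -- number up to _≈_; by convention 0# if no real number satisfies Q.
  the : Pred Carrier 0ℓ → Carrier
  the Q with em {∃ Q}
  ... | yes (x , _) = x
  ... | no  _       = 0#

  sqrt : Carrier → Carrier
  sqrt x = the λ s → 0# ≤ s × s * s ≈ x

  ∑∞ : (ℕ → Carrier) → Carrier
  ∑∞ f = the (HasSum f)

  exp : Carrier → Carrier
  exp x = ∑∞ λ n → x ^ n / fromℕ (n !)

  -- Only the values at x ≥ 0 are relevant.
  P : ℕ → Carrier → Carrier
  P k x = if does (em {1# < x})
            then exp (- (sqrt (fromℕ k) * (x - (fromℕ k - 1#) / fromℕ k)))
            else 1#

  record ProbabilitySpace : Set₁ where
    field
      Ω          : Set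
      Measurable : Pred Ω 0ℓ → Set

      measurable-resp-≐ : ∀ {A B} → A ≐ B → Measurable A → Measurable B
      measurable-U      : Measurable U
      measurable-∁      : ∀ {A} → Measurable A → Measurable (∁ A)
      measurable-⋃      : (A : ℕ → Pred Ω 0ℓ) → (∀ i → Measurable (A i)) →
                          Measurable (⋃ ℕ A)

      -- Values on non-measurable sets are unconstrained.
      Pr         : Pred Ω 0ℓ → Carrier
      Pr-cong    : ∀ {A B} → Measurable A → A ≐ B → Pr A ≈ Pr B
      Pr-nonNeg  : ∀ {A} → Measurable A → 0# ≤ Pr A
      Pr-U       : Pr U ≈ 1#
      σ-additive : (A : ℕ → Pred Ω 0ℓ) → (∀ i → Measurable (A i)) →
                   (∀ {i j} → i ≢ j → A i ⊥ A j) →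
                   HasSum (λ i → Pr (A i)) (Pr (⋃ ℕ A))

    𝔼 : (Ω → ℕ) → Carrier
    𝔼 T = ∑∞ λ j → fromℕ j * Pr (λ ω → T ω ≡ j)

    -- A Bernoulli variable is a random variable with values in {0 , 1};
    -- its parameter Pr[ X = 1 ] is arbitrary.
    IsBernoulli : (Ω → Fin 2) → Set₁
    IsBernoulli X = (B : Pred (Fin 2) 0ℓ) → Measurable (λ ω → X ω ∈ B)

    Independent : ∀ {n} → (Fin n → Ω → Fin 2) → Set₁
    Independent {n} X = (B : Fin n → Pred (Fin 2) 0ℓ) →
      Pr (λ ω → ∀ i → X i ω ∈ B i) ≈ product (λ i → Pr (λ ω → X i ω ∈ B i))

    sumRV : ∀ {n} → (Fin n → Ω → Fin 2) → Ω → ℕ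
    sumRV X ω = Algebra.Definitions.RawMonoid.sum ℕ.+-0-rawMonoid λ i → toℕ (X i ω)

-- A Bernoulli variable with parameter p is replaced by a Poisson variable with the same mean,
-- one summand at a time. As long as the remaining sum has mean at least k - 1, its mass function
-- increases up to k - 1 (the mode of a sum of Bernoulli and Poisson variables is at least n when
-- its mean is), so its distribution function G satisfies G (k - i) ≥ G k - i (G k - G (k - 1)),
-- and averaging over a Poisson i gives at least the value for a Bernoulli i. Hence for μ = 𝔼 S ≥ k
-- we get Pr [ S < k ] ≤ e^(-μ) Σ_{j < k} μʲ / j!. With μ = k x the sum is at most
-- x^(k - 1) Σ_{j < k} kʲ / j!, and two exponential bounds finish the proof: one for x, tight
-- near x = 1 + 1 / √k, and Σ_{j < k} kʲ / j! ≤ e^(k - 1/2 - 1/(2 √k)), which is numerical for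
-- k ≤ 8 and follows from Pr [ Poisson(k) < k ] ≤ 1/2 for larger k.

{-# OPTIONS --safe #-}
module Submission where

open import Defs
open import Axiom.ExcludedMiddle using (ExcludedMiddle)
open import Data.Fin.Base as Fin using (Fin)
open import Data.Nat.Base as ℕ using (ℕ; zero; suc; _∸_; _!; z≤n; s≤s)
open import Data.Product.Base using (_×_; _,_; proj₁; proj₂; ∃)
open import Level using (0ℓ)

open import Algebra.Bundles using (CommutativeRing)
import Algebra.Properties.AbelianGroup
import Algebra.Properties.Ring
import Algebra.Properties.Semiring.Mult
import Algebra.Solver.Ring
open import Algebra.Solver.Ring.AlmostCommutativeRing
  using (fromCommutativeRing; _-Raw-AlmostCommutative⟶_)
open import Data.Bool.Base using (if_then_else_)
open import Data.Empty using (⊥-elim)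
import Data.Fin.Properties as Fin
open import Data.Integer.Base as ℤ using (ℤ; +_; -[1+_])
import Data.Integer.Properties as ℤ
open import Data.List.Base as List using (List; []; _∷_; _++_; foldr; length)
import Data.List.Properties as List
open import Data.List.Relation.Unary.All as All using (All; []; _∷_)
import Data.List.Relation.Unary.All.Properties as All
open import Data.Maybe.Base as Maybe using (Maybe)
import Data.Nat.Properties as ℕ
open import Data.Sum.Base using (_⊎_; inj₁; inj₂; [_,_]′)
open import Function.Base using (_∘_)
open import Relation.Binary.Bundles using (Poset)
import Relation.Binary.Construct.NonStrictToStrict as Strict
open import Relation.Binary.PropositionalEquality as ≡ using (_≡_; _≢_)
import Relation.Binary.Reasoning.PartialOrder
import Relation.Binary.Reasoning.Setoid
open import Relation.Binary.Structures using (IsTotalOrder)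
open import Relation.Nullary using (¬_; Dec; does; yes; no)
open import Relation.Nullary.Decidable.Core using (dec⇒maybe)
open import Relation.Unary using (Pred; _∈_; _≐_; _⊥_; _⊆_; _∪_; _∩_; ∅; U; ∁; ⋃)

-- After multiplication by e^μ the target exponent k x - √k (x - (k - 1) / k) is linear in x with
-- slope k - √k, whereas the sum to be bounded carries x^(k - 1). Since (k - 1) / u = k - √k for u =
-- 1 + 1 / √k, the slopes match for the tangent of the logarithm at u: log x ≤ x / u - 1 + log u.
-- The constant log u is still transcendental; the larger (u - 1 / u) / 2 = sinh (log u) makes it
-- algebraic, and what is then left of the exponent is exactly k - 1/2 - 1/(2 √k), the bound
-- demanded of the sum at x = 1. The exchange of one summand leads out of the Bernoulli sums, so the
-- whole argument lives in the family `pmf r ps`, which contains them at r = 0 and the Poisson laws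
-- at empty `ps`. Its generating function is e^(r z) times the factors 1 - p + p z. Leaving out
-- e^(-r) keeps all identities between coefficients algebraic; exponentials enter only when partial
-- sums pass to the limit.

module IntegerCoefficients (ℝ : CompleteOrderedField) where
  open CompleteOrderedField ℝ
  open CommutativeRing commutativeRing
    using ( refl; sym; trans; reflexive; setoid; +-cong; +-congˡ; +-congʳ; *-cong; -‿cong
          ; +-comm; +-assoc; +-identityˡ; +-identityʳ; -‿inverseʳ; ring; semiring; +-abelianGroup)
  open Algebra.Properties.AbelianGroup +-abelianGroup using (⁻¹-∙-comm; ⁻¹-involutive)
  open Algebra.Properties.Ring ring using (-0#≈0#; -‿distribˡ-*; -‿distribʳ-*)
  open Algebra.Properties.Semiring.Mult semiring using (×-homo-+; ×1-homo-*)
  open Relation.Binary.Reasoning.Setoid setoid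

  -- Integer coefficients for the ring solver

  numeral : ℕ → Carrier
  numeral 0             = 0#
  numeral 1             = 1#
  numeral (suc (suc n)) = 1# + numeral (suc n)

  numeral≈fromℕ : ∀ n → numeral n ≈ fromℕ n
  numeral≈fromℕ 0             = refl
  numeral≈fromℕ 1             = sym (+-identityʳ 1#)
  numeral≈fromℕ (suc (suc n)) = +-congˡ (numeral≈fromℕ (suc n))

  -- Unlike fromℕ, this sends 1 to 1# on the nose, so that solver constants match the goals.
  ⟦_⟧ : ℤ → Carrier
  ⟦ + n ⟧      = numeral n
  ⟦ -[1+ n ] ⟧ = - numeral (suc n)

  numeral-suc : ∀ n → numeral (suc n) ≈ 1# + numeral n
  numeral-suc zero    = sym (+-identityʳ 1#)
  numeral-suc (suc n) = refl

  numeral-+ : ∀ m n → numeral (m ℕ.+ n) ≈ numeral m + numeral n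
  numeral-+ m n = trans (numeral≈fromℕ (m ℕ.+ n)) (trans (×-homo-+ 1# m n)
    (+-cong (sym (numeral≈fromℕ m)) (sym (numeral≈fromℕ n))))

  numeral-* : ∀ m n → numeral (m ℕ.* n) ≈ numeral m * numeral n
  numeral-* m n = trans (numeral≈fromℕ (m ℕ.* n)) (trans (×1-homo-* m n)
    (*-cong (sym (numeral≈fromℕ m)) (sym (numeral≈fromℕ n))))

  ⟦⊖⟧ : ∀ m n → ⟦ m ℤ.⊖ n ⟧ ≈ numeral m - numeral n
  ⟦⊖⟧ m       zero    = sym (trans (+-congˡ -0#≈0#) (+-identityʳ _))
  ⟦⊖⟧ zero    (suc n) = sym (+-identityˡ _)
  ⟦⊖⟧ (suc m) (suc n) = begin
    ⟦ suc m ℤ.⊖ suc n ⟧                          ≡⟨ ≡.cong ⟦_⟧ (ℤ.[1+m]⊖[1+n]≡m⊖n m n) ⟩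
    ⟦ m ℤ.⊖ n ⟧                                  ≈⟨ ⟦⊖⟧ m n ⟩
    numeral m - numeral n                        ≈⟨ +-congʳ (+-identityʳ _) ⟨
    numeral m + 0# - numeral n                   ≈⟨ +-congʳ (+-congˡ (-‿inverseʳ 1#)) ⟨
    numeral m + (1# - 1#) - numeral n            ≈⟨ +-assoc _ _ _ ⟩
    numeral m + (1# - 1# - numeral n)            ≈⟨ +-congˡ (+-assoc _ _ _) ⟩
    numeral m + (1# + (- 1# - numeral n))        ≈⟨ +-assoc _ _ _ ⟨
    numeral m + 1# + (- 1# - numeral n)          ≈⟨ +-cong (+-comm _ _) (⁻¹-∙-comm _ _) ⟩
    1# + numeral m - (1# + numeral n)            ≈⟨ +-cong (numeral-suc m) (-‿cong (numeral-suc n)) ⟨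
    numeral (suc m) - numeral (suc n)            ∎

  ⟦neg⟧ : ∀ i → ⟦ ℤ.- i ⟧ ≈ - ⟦ i ⟧
  ⟦neg⟧ (+ zero)   = sym -0#≈0#
  ⟦neg⟧ (+ suc n)  = refl
  ⟦neg⟧ -[1+ n ]   = sym (⁻¹-involutive _)

  ⟦+⟧ : ∀ i j → ⟦ i ℤ.+ j ⟧ ≈ ⟦ i ⟧ + ⟦ j ⟧
  ⟦+⟧ (+ m)      (+ n)    = numeral-+ m n
  ⟦+⟧ (+ m)      -[1+ n ] = ⟦⊖⟧ m (suc n)
  ⟦+⟧ -[1+ m ]   (+ n)    = trans (⟦⊖⟧ n (suc m)) (+-comm _ _)
  ⟦+⟧ -[1+ m ]   -[1+ n ] = begin
    - numeral (suc (suc (m ℕ.+ n)))         ≡⟨ ≡.cong (λ k → - numeral (suc k)) (ℕ.+-suc m n) ⟨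
    - numeral (suc m ℕ.+ suc n)             ≈⟨ -‿cong (numeral-+ (suc m) (suc n)) ⟩
    - (numeral (suc m) + numeral (suc n))   ≈⟨ ⁻¹-∙-comm _ _ ⟨
    - numeral (suc m) - numeral (suc n)     ∎

  ⟦*⟧⁺ : ∀ m n → ⟦ + m ℤ.* + n ⟧ ≈ numeral m * numeral n
  ⟦*⟧⁺ m n = trans (reflexive (≡.cong ⟦_⟧ (≡.sym (ℤ.pos-* m n)))) (numeral-* m n)

  ⟦*⟧ : ∀ i j → ⟦ i ℤ.* j ⟧ ≈ ⟦ i ⟧ * ⟦ j ⟧
  ⟦*⟧ (+ m)      (+ n)    = ⟦*⟧⁺ m n
  ⟦*⟧ (+ m)      -[1+ n ] = begin
    ⟦ + m ℤ.* (ℤ.- + suc n) ⟧           ≡⟨ ≡.cong ⟦_⟧ (ℤ.neg-distribʳ-* (+ m) (+ suc n)) ⟨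
    ⟦ ℤ.- (+ m ℤ.* + suc n) ⟧           ≈⟨ ⟦neg⟧ (+ m ℤ.* + suc n) ⟩
    - ⟦ + m ℤ.* + suc n ⟧               ≈⟨ -‿cong (⟦*⟧⁺ m (suc n)) ⟩
    - (numeral m * numeral (suc n))     ≈⟨ -‿distribʳ-* _ _ ⟩
    numeral m * - numeral (suc n)       ∎
  ⟦*⟧ -[1+ m ]   (+ n)    = begin
    ⟦ (ℤ.- + suc m) ℤ.* + n ⟧           ≡⟨ ≡.cong ⟦_⟧ (ℤ.neg-distribˡ-* (+ suc m) (+ n)) ⟨
    ⟦ ℤ.- (+ suc m ℤ.* + n) ⟧           ≈⟨ ⟦neg⟧ (+ suc m ℤ.* + n) ⟩
    - ⟦ + suc m ℤ.* + n ⟧               ≈⟨ -‿cong (⟦*⟧⁺ (suc m) n) ⟩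
    - (numeral (suc m) * numeral n)     ≈⟨ -‿distribˡ-* _ _ ⟩
    - numeral (suc m) * numeral n       ∎
  ⟦*⟧ -[1+ m ]   -[1+ n ] = begin
    numeral (suc m ℕ.* suc n)                   ≈⟨ numeral-* (suc m) (suc n) ⟩
    numeral (suc m) * numeral (suc n)           ≈⟨ ⁻¹-involutive _ ⟨
    - - (numeral (suc m) * numeral (suc n))     ≈⟨ -‿cong (-‿distribˡ-* _ _) ⟩
    - (- numeral (suc m) * numeral (suc n))     ≈⟨ -‿distribʳ-* _ _ ⟩
    - numeral (suc m) * - numeral (suc n)       ∎

  ℤ⟶ℝ : ℤ.+-*-rawRing -Raw-AlmostCommutative⟶ fromCommutativeRing commutativeRing
  ℤ⟶ℝ = record
    { ⟦_⟧    = ⟦_⟧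
    ; +-homo = ⟦+⟧
    ; *-homo = ⟦*⟧
    ; -‿homo = ⟦neg⟧
    ; 0-homo = refl
    ; 1-homo = refl
    }

  _≟_ : ∀ i j → Maybe (⟦ i ⟧ ≈ ⟦ j ⟧)
  i ≟ j = Maybe.map (λ i≡j → reflexive (≡.cong ⟦_⟧ i≡j)) (dec⇒maybe (i ℤ.≟ j))

  open Algebra.Solver.Ring ℤ.+-*-rawRing (fromCommutativeRing commutativeRing) ℤ⟶ℝ _≟_ public
    using (Polynomial; solve; _:=_; _:+_; _:*_; _:-_; :-_; con)

  :0 :1 : ∀ {n} → Polynomial n
  :0 = con ℤ.0ℤ
  :1 = con ℤ.1ℤ

module Development (em : ExcludedMiddle 0ℓ) (ℝ : CompleteOrderedField) where
  open CompleteOrderedField ℝ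
  open Analysis em ℝ
  open IntegerCoefficients ℝ using (solve; _:=_; _:+_; _:*_; _:-_; :-_; :0; :1)
  open CommutativeRing commutativeRing
    using ( refl; sym; trans; reflexive; +-cong; +-congˡ; +-congʳ; *-cong; *-congˡ; *-congʳ; -‿cong
          ; +-identityʳ; semiring)
  open Algebra.Properties.Semiring.Mult semiring using (×-homo-+; ×1-homo-*)
  open IsTotalOrder isTotalOrder using (total; antisym; isPartialOrder)
    renaming (refl to ≤-refl; reflexive to ≤-reflexive; trans to ≤-trans)

  private
    variable
      a b c d l x y z : Carrier
      s t f g h : ℕ → Carrier
      k m n : ℕ

  -- Arithmetic of ordered fields

  poset : Poset _ _ _
  poset = record { isPartialOrder = isPartialOrder }

  open Relation.Binary.Reasoning.PartialOrder poset

  ≰⇒> : ¬ x ≤ y → y < x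
  ≰⇒> = Strict.≰⇒> _≈_ _≤_ sym ≤-reflexive total

  <⇒≱ : x < y → ¬ y ≤ x
  <⇒≱ = Strict.<⇒≱ _≈_ _≤_ antisym

  ≮⇒≥ : ¬ x < y → y ≤ x
  ≮⇒≥ {x} {y} x≮y with em {y ≤ x}
  ... | yes y≤x = y≤x
  ... | no y≰x  = ⊥-elim (x≮y (≰⇒> y≰x))

  -- Splits an inequality into a nonnegative certificate `d`, usually built from products and
  -- squares, and a ring identity. Most estimates below take this form.
  by-diff : 0# ≤ d → d ≈ y - x → x ≤ y
  by-diff {d} {y} {x} 0≤d d≈y-x = begin
    x          ≈⟨ solve 1 (λ x → x := :0 :+ x) refl _ ⟩
    0# + x     ≤⟨ +-monoˡ-≤ x 0≤d ⟩
    d + x      ≈⟨ +-congʳ d≈y-x ⟩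
    y - x + x  ≈⟨ solve 2 (λ y x → y :- x :+ x := y) refl _ _ ⟩
    y          ∎

  diff : x ≤ y → 0# ≤ y - x
  diff {x} {y} x≤y = begin
    0#     ≈⟨ solve 1 (λ x → :0 := x :- x) refl _ ⟩
    x - x  ≤⟨ +-monoˡ-≤ (- x) x≤y ⟩
    y - x  ∎

  +-mono-≤ : a ≤ b → x ≤ y → a + x ≤ b + y
  +-mono-≤ {a} {b} {x} {y} a≤b x≤y = begin
    a + x  ≤⟨ +-monoˡ-≤ x a≤b ⟩
    b + x  ≤⟨ by-diff (diff x≤y) (solve 3 (λ y x b → y :- x := b :+ y :- (b :+ x)) refl _ _ _) ⟩
    b + y  ∎

  +-nonNeg : 0# ≤ x → 0# ≤ y → 0# ≤ x + y
  +-nonNeg {x} {y} 0≤x 0≤y = begin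
    0#       ≈⟨ solve 0 (:0 := :0 :+ :0) refl ⟩
    0# + 0#  ≤⟨ +-mono-≤ 0≤x 0≤y ⟩
    x + y    ∎

  *-monoˡ-≤ : 0# ≤ z → x ≤ y → z * x ≤ z * y
  *-monoˡ-≤ 0≤z x≤y = by-diff (*-nonNeg 0≤z (diff x≤y))
      (solve 3 (λ z y x → z :* (y :- x) := z :* y :- z :* x) refl _ _ _)

  *-monoʳ-≤ : 0# ≤ z → x ≤ y → x * z ≤ y * z
  *-monoʳ-≤ 0≤z x≤y = by-diff (*-nonNeg 0≤z (diff x≤y))
      (solve 3 (λ z y x → z :* (y :- x) := y :* z :- x :* z) refl _ _ _)

  *-mono-≤ : 0# ≤ a → 0# ≤ y → a ≤ b → x ≤ y → a * x ≤ b * y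
  *-mono-≤ 0≤a 0≤y a≤b x≤y = ≤-trans (*-monoˡ-≤ 0≤a x≤y) (*-monoʳ-≤ 0≤y a≤b)

  neg-mono-≤ : x ≤ y → - y ≤ - x
  neg-mono-≤ x≤y = by-diff (diff x≤y) (solve 2 (λ y x → y :- x := :- x :- :- y) refl _ _)

  square-nonNeg : ∀ x → 0# ≤ x * x
  square-nonNeg x with total 0# x
  ... | inj₁ 0≤x = *-nonNeg 0≤x 0≤x
  ... | inj₂ x≤0 = by-diff (*-nonNeg (diff x≤0) (diff x≤0))
      (solve 1 (λ x → (:0 :- x) :* (:0 :- x) := x :* x :- :0) refl _)

  0≤1 : 0# ≤ 1#
  0≤1 = by-diff (square-nonNeg 1#) (solve 0 (:1 :* :1 := :1 :- :0) refl)

  0<1 : 0# < 1#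
  0<1 = 0≤1 , 0≉1

  1+-positive : 0# ≤ x → 0# < 1# + x
  1+-positive {x} 0≤x = begin-strict
    0#      <⟨ 0<1 ⟩
    1#      ≤⟨ by-diff 0≤x (solve 1 (λ x → x := :1 :+ x :- :1) refl _) ⟩
    1# + x  ∎

  positive⇒≉0 : 0# < x → ¬ x ≈ 0#
  positive⇒≉0 (_ , 0≉x) x≈0 = 0≉x (sym x≈0)

  ⁻¹-inverse : 0# < x → x * x ⁻¹ ≈ 1#
  ⁻¹-inverse 0<x = *-inverseʳ _ (positive⇒≉0 0<x)

  ⁻¹-nonNeg : 0# < x → 0# ≤ x ⁻¹
  ⁻¹-nonNeg {x} 0<x with total 0# (x ⁻¹)
  ... | inj₁ 0≤x⁻¹ = 0≤x⁻¹
  ... | inj₂ x⁻¹≤0 = ⊥-elim (<⇒≱ 0<1 (begin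
    1#        ≈⟨ ⁻¹-inverse 0<x ⟨
    x * x ⁻¹  ≤⟨ *-monoˡ-≤ (proj₁ 0<x) x⁻¹≤0 ⟩
    x * 0#    ≈⟨ solve 1 (λ x → x :* :0 := :0) refl _ ⟩
    0#        ∎))

  *-cancelˡ-≤ : 0# < z → z * x ≤ z * y → x ≤ y
  *-cancelˡ-≤ {z} {x} {y} 0<z zx≤zy = begin
    x              ≈⟨ cancel x ⟨
    z ⁻¹ * (z * x) ≤⟨ *-monoˡ-≤ (⁻¹-nonNeg 0<z) zx≤zy ⟩
    z ⁻¹ * (z * y) ≈⟨ cancel y ⟩
    y              ∎
    where
    cancel : ∀ x → z ⁻¹ * (z * x) ≈ x
    cancel x = begin-equality
      z ⁻¹ * (z * x)  ≈⟨ solve 3 (λ u z x → u :* (z :* x) := z :* u :* x) refl _ _ _ ⟩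
      z * z ⁻¹ * x    ≈⟨ *-congʳ (⁻¹-inverse 0<z) ⟩
      1# * x          ≈⟨ solve 1 (λ x → :1 :* x := x) refl _ ⟩
      x               ∎

  *-cancelˡ-≈ : 0# < z → z * x ≈ z * y → x ≈ y
  *-cancelˡ-≈ 0<z zx≈zy =
    antisym (*-cancelˡ-≤ 0<z (≤-reflexive zx≈zy)) (*-cancelˡ-≤ 0<z (≤-reflexive (sym zx≈zy)))

  *-positive : 0# < x → 0# < y → 0# < x * y
  *-positive {x} {y} 0<x 0<y = ≰⇒> λ xy≤0 → <⇒≱ 0<y (*-cancelˡ-≤ 0<x (begin
    x * y   ≤⟨ xy≤0 ⟩
    0#      ≈⟨ solve 1 (λ x → :0 := x :* :0) refl _ ⟩
    x * 0#  ∎))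

  ⁻¹-positive : 0# < x → 0# < x ⁻¹
  ⁻¹-positive {x} 0<x = ≰⇒> λ x⁻¹≤0 → <⇒≱ 0<1 (begin
    1#        ≈⟨ ⁻¹-inverse 0<x ⟨
    x * x ⁻¹  ≤⟨ *-monoˡ-≤ (proj₁ 0<x) x⁻¹≤0 ⟩
    x * 0#    ≈⟨ solve 1 (λ x → x :* :0 := :0) refl _ ⟩
    0#        ∎)

  +-mono-< : a < b → x < y → a + x < b + y
  +-mono-< {a} {b} {x} {y} a<b x<y = ≰⇒> λ b+y≤a+x → <⇒≱ a<b (begin
    b          ≈⟨ solve 2 (λ b y → b := b :+ y :- y) refl _ _ ⟩
    b + y - y  ≤⟨ +-mono-≤ b+y≤a+x (neg-mono-≤ (proj₁ x<y)) ⟩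
    a + x - x  ≈⟨ solve 2 (λ a x → a :+ x :- x := a) refl _ _ ⟩
    a          ∎)

  +-positive : 0# < x → 0# < y → 0# < x + y
  +-positive {x} {y} 0<x 0<y = begin-strict
    0#       ≈⟨ solve 0 (:0 := :0 :+ :0) refl ⟩
    0# + 0#  <⟨ +-mono-< 0<x 0<y ⟩
    x + y    ∎

  diff-positive : x < y → 0# < y - x
  diff-positive {x} {y} x<y = ≰⇒> λ y-x≤0 → <⇒≱ x<y (by-diff (diff y-x≤0)
      (solve 2 (λ y x → :0 :- (y :- x) := x :- y) refl _ _))

  by-diff-< : 0# < d → d ≈ y - x → x < y
  by-diff-< {d} {y} {x} 0<d d≈y-x = ≰⇒> λ y≤x → <⇒≱ 0<d (begin
    d      ≈⟨ d≈y-x ⟩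
    y - x  ≤⟨ by-diff (diff y≤x) (solve 2 (λ x y → x :- y := :0 :- (y :- x)) refl _ _) ⟩
    0#     ∎)

  -- The factor 2 fits certificates that are symmetric sums of two positive products or of squares,
  -- where only twice the difference is a polynomial with integer coefficients.
  half-positive : 0# < d → d ≈ (1# + 1#) * (y - x) → x < y
  half-positive {d} {y} {x} 0<d d≈2[y-x] = ≰⇒> λ y≤x → <⇒≱ 0<d (begin
    d                      ≈⟨ d≈2[y-x] ⟩
    (1# + 1#) * (y - x)    ≈⟨ solve 2 (λ y x → (:1 :+ :1) :* (y :- x) := y :- x :+ (y :- x)) refl _ _ ⟩
    y - x + (y - x)        ≤⟨ by-diff (+-nonNeg (diff y≤x) (diff y≤x))
        (solve 2 (λ x y → x :- y :+ (x :- y) := :0 :- (y :- x :+ (y :- x))) refl _ _) ⟩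
    0#                     ∎)

  2# : Carrier
  2# = 1# + 1#

  ½ : Carrier
  ½ = 2# ⁻¹

  0<2 : 0# < 2#
  0<2 = 1+-positive 0≤1

  fromℕ-nonNeg : ∀ n → 0# ≤ fromℕ n
  fromℕ-nonNeg zero    = ≤-refl
  fromℕ-nonNeg (suc n) = +-nonNeg 0≤1 (fromℕ-nonNeg n)

  fromℕ-suc-positive : ∀ n → 0# < fromℕ (suc n)
  fromℕ-suc-positive n = 1+-positive (fromℕ-nonNeg n)

  fromℕ-positive : 1 ℕ.≤ n → 0# < fromℕ n
  fromℕ-positive {suc n} (s≤s z≤n) = fromℕ-suc-positive n

  fromℕ-+ : ∀ m n → fromℕ (m ℕ.+ n) ≈ fromℕ m + fromℕ n
  fromℕ-+ = ×-homo-+ 1#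

  fromℕ-* : ∀ m n → fromℕ (m ℕ.* n) ≈ fromℕ m * fromℕ n
  fromℕ-* = ×1-homo-*

  fromℕ-mono-≤ : m ℕ.≤ n → fromℕ m ≤ fromℕ n
  fromℕ-mono-≤ {n = n} z≤n = fromℕ-nonNeg n
  fromℕ-mono-≤ (s≤s m≤n)   = +-mono-≤ ≤-refl (fromℕ-mono-≤ m≤n)

  ^-positive : ∀ n → 0# < x → 0# < x ^ n
  ^-positive zero    0<x = 0<1
  ^-positive (suc n) 0<x = *-positive 0<x (^-positive n 0<x)

  ^-nonNeg : ∀ n → 0# ≤ x → 0# ≤ x ^ n
  ^-nonNeg zero    0≤x = 0≤1
  ^-nonNeg (suc n) 0≤x = *-nonNeg 0≤x (^-nonNeg n 0≤x)

  ^-mono-≤ : ∀ n → 0# ≤ x → x ≤ y → x ^ n ≤ y ^ n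
  ^-mono-≤ zero    0≤x x≤y = ≤-refl
  ^-mono-≤ (suc n) 0≤x x≤y =
    *-mono-≤ 0≤x (^-nonNeg n (≤-trans 0≤x x≤y)) x≤y (^-mono-≤ n 0≤x x≤y)

  ^-distrib-* : ∀ n → (x * y) ^ n ≈ x ^ n * y ^ n
  ^-distrib-* zero            = solve 0 (:1 := :1 :* :1) refl
  ^-distrib-* {x} {y} (suc n) = begin-equality
    x * y * (x * y) ^ n      ≈⟨ *-congˡ (^-distrib-* n) ⟩
    x * y * (x ^ n * y ^ n)  ≈⟨ solve 4 (λ x y u v → x :* y :* (u :* v)
          := x :* u :* (y :* v)) refl _ _ _ _ ⟩
    x * x ^ n * (y * y ^ n)  ∎

  fromℕ-^ : ∀ m n → fromℕ (m ℕ.^ n) ≈ fromℕ m ^ n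
  fromℕ-^ m zero    = solve 0 (:1 :+ :0 := :1) refl
  fromℕ-^ m (suc n) = trans (fromℕ-* m (m ℕ.^ n)) (*-congˡ (fromℕ-^ m n))

  -- Were all numerals at most `x`, their supremum lowered by 1 would still bound them, because the
  -- successor of a numeral is again a numeral.
  archimedean : ∀ x → ∃ λ n → x < fromℕ n
  archimedean x with em {∃ λ n → x < fromℕ n}
  ... | yes ∃n = ∃n
  ... | no ∄n  = ⊥-elim (<⇒≱ 0<1 (by-diff (diff (least λ { (n , a≈n) → below-pred n a≈n }))
      (solve 1 (λ u → u :- :1 :- u := :0 :- :1) refl _)))
    where
    A : Pred Carrier 0ℓ
    A a = ∃ λ n → a ≈ fromℕ n
    bounded : ∀ n → fromℕ n ≤ x
    bounded n = ≮⇒≥ λ x<n → ∄n (n , x<n)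
    sup = supremum A (0# , 0 , refl) (x , λ { (n , a≈n) → ≤-trans (≤-reflexive a≈n) (bounded n) })
    S : Carrier
    S = proj₁ sup
    least : ∀ {u} → UpperBound A u → S ≤ u
    least = proj₂ (proj₂ sup)
    below-pred : ∀ {a} n → a ≈ fromℕ n → a ≤ S - 1#
    below-pred {a} n a≈n = begin
      a                    ≈⟨ a≈n ⟩
      fromℕ n              ≈⟨ solve 1 (λ u → u := :1 :+ u :- :1) refl _ ⟩
      fromℕ (suc n) - 1#   ≤⟨ +-monoˡ-≤ (- 1#) (proj₁ (proj₂ sup) (suc n , refl)) ⟩
      S - 1#               ∎

  -- Limits

  -- `s ⟶ l` is definitionally `Null` of the sequence s n - l, so every limit law reduces to one
  -- about null sequences.
  Null : (ℕ → Carrier) → Set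
  Null s = ∀ ε → 0# < ε → ∃ λ N → ∀ n → N ℕ.≤ n → (- ε < s n) × (s n < ε)

  null-cong : (∀ n → s n ≈ t n) → Null s → Null t
  null-cong s≈t s→0 ε 0<ε with s→0 ε 0<ε
  ... | N , close = N , λ n N≤n →
    let -ε<s , s<ε = close n N≤n in
    (begin-strict - ε <⟨ -ε<s ⟩ _ ≈⟨ s≈t n ⟩ _ ∎) , (begin-strict _ ≈⟨ s≈t n ⟨ _ <⟨ s<ε ⟩ ε ∎)

  null-0 : Null (λ _ → 0#)
  null-0 ε 0<ε = 0 , λ _ _ → by-diff-< 0<ε (solve 1 (λ ε → ε := :0 :- :- ε) refl _) , 0<ε

  null-+ : Null s → Null t → Null (λ n → s n + t n)
  null-+ {s} {t} s→0 t→0 ε 0<ε = M ℕ.+ N , λ n M+N≤n →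
    let -½ε<s , s<½ε = s-close n (ℕ.m+n≤o⇒m≤o M M+N≤n)
        -½ε<t , t<½ε = t-close n (ℕ.m+n≤o⇒n≤o M M+N≤n) in
    (begin-strict
      - ε                  ≈⟨ -‿cong halves ⟨
      - (½ * ε + ½ * ε)    ≈⟨ solve 2 (λ u ε → :- (u :* ε :+ u :* ε) := :- (u :* ε) :- u :* ε) refl _ _ ⟩
      - (½ * ε) - ½ * ε    <⟨ +-mono-< -½ε<s -½ε<t ⟩
      s n + t n            ∎) ,
    (begin-strict
      s n + t n            <⟨ +-mono-< s<½ε t<½ε ⟩
      ½ * ε + ½ * ε        ≈⟨ halves ⟩
      ε                    ∎)
    where
    0<½ε = *-positive (⁻¹-positive 0<2) 0<ε
    M = proj₁ (s→0 (½ * ε) 0<½ε)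
    s-close = proj₂ (s→0 (½ * ε) 0<½ε)
    N = proj₁ (t→0 (½ * ε) 0<½ε)
    t-close = proj₂ (t→0 (½ * ε) 0<½ε)
    halves : ½ * ε + ½ * ε ≈ ε
    halves = begin-equality
      ½ * ε + ½ * ε     ≈⟨ solve 2 (λ u ε → u :* ε :+ u :* ε := (:1 :+ :1) :* u :* ε) refl _ _ ⟩
      2# * ½ * ε        ≈⟨ *-congʳ (⁻¹-inverse 0<2) ⟩
      1# * ε            ≈⟨ solve 1 (λ ε → :1 :* ε := ε) refl _ ⟩
      ε                 ∎

  -- Works without absolute values: for -b < s < b, -δ < t < δ and b δ = ε, the numbers 2 (ε + s t)
  -- and 2 (ε - s t) are sums of two products of the positive gaps.
  null-bounded-* : 0# < b → (∃ λ N → ∀ n → N ℕ.≤ n → (- b < s n) × (s n < b)) →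
                   Null t → Null (λ n → s n * t n)
  null-bounded-* {b} {s} {t} 0<b (M , s-bounded) t→0 ε 0<ε = M ℕ.+ N , λ n M+N≤n →
    let -b<s , s<b = s-bounded n (ℕ.m+n≤o⇒m≤o M M+N≤n)
        -δ<t , t<δ = t-close n (ℕ.m+n≤o⇒n≤o M M+N≤n) in
    half-positive (begin-strict
      0#
        <⟨ +-positive (*-positive (diff-positive -b<s) (diff-positive -δ<t))
                     (*-positive (diff-positive s<b) (diff-positive t<δ)) ⟩
      (s n - - b) * (t n - - δ) + (b - s n) * (δ - t n)
        ≈⟨ solve 5 (λ u b v w ε → (u :- :- b) :* (v :- :- (w :* ε)) :+ (b :- u) :* (w :* ε :- v)
              := (:1 :+ :1) :* (u :* v :+ b :* (w :* ε))) refl _ _ _ _ _ ⟩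
      2# * (s n * t n + b * δ)
        ≈⟨ *-congˡ (+-congˡ bδ≈ε) ⟩
      2# * (s n * t n + ε) ∎) (solve 3 (λ u v ε → (:1 :+ :1) :* (u :* v :+ ε)
            := (:1 :+ :1) :* (u :* v :- :- ε)) refl _ _ _) ,
    half-positive (begin-strict
      0#
        <⟨ +-positive (*-positive (diff-positive s<b) (diff-positive -δ<t))
                     (*-positive (diff-positive -b<s) (diff-positive t<δ)) ⟩
      (b - s n) * (t n - - δ) + (s n - - b) * (δ - t n)
        ≈⟨ solve 5 (λ b u v w ε → (b :- u) :* (v :- :- (w :* ε)) :+ (u :- :- b) :* (w :* ε :- v)
              := (:1 :+ :1) :* (b :* (w :* ε) :- u :* v)) refl _ _ _ _ _ ⟩
      2# * (b * δ - s n * t n)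
        ≈⟨ *-congˡ (+-congʳ bδ≈ε) ⟩
      2# * (ε - s n * t n) ∎) (solve 3 (λ ε u v → (:1 :+ :1) :* (ε :- u :* v)
            := (:1 :+ :1) :* (ε :- u :* v)) refl _ _ _)
    where
    δ = b ⁻¹ * ε
    0<δ = *-positive (⁻¹-positive 0<b) 0<ε
    N = proj₁ (t→0 δ 0<δ)
    t-close = proj₂ (t→0 δ 0<δ)
    bδ≈ε : b * δ ≈ ε
    bδ≈ε = begin-equality
      b * (b ⁻¹ * ε)    ≈⟨ solve 3 (λ b u ε → b :* (u :* ε) := b :* u :* ε) refl _ _ _ ⟩
      b * b ⁻¹ * ε      ≈⟨ *-congʳ (⁻¹-inverse 0<b) ⟩
      1# * ε            ≈⟨ solve 1 (λ ε → :1 :* ε := ε) refl _ ⟩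
      ε                 ∎

  lim-cong : (∀ n → s n ≈ t n) → s ⟶ l → t ⟶ l
  lim-cong s≈t = null-cong λ n → +-congʳ (s≈t n)

  lim-const : ∀ l → (λ _ → l) ⟶ l
  lim-const l = null-cong (λ _ → (solve 1 (λ l → :0 := l :- l) refl _)) null-0

  lim-+ : s ⟶ a → t ⟶ b → (λ n → s n + t n) ⟶ (a + b)
  lim-+ s→a t→b = null-cong (λ _ →
      (solve 4 (λ u a v b → u :- a :+ (v :- b) := u :+ v :- (a :+ b)) refl _ _ _ _)) (null-+ s→a t→b)

  null-scale : ∀ c → Null s → Null (λ n → c * s n)
  -- 1 + c² strictly exceeds both c and - c, without a case distinction on the sign of c.
  null-scale c = null-bounded-* (1+-positive (square-nonNeg c)) (0 , λ _ _ →
    half-positive (1+-positive (+-nonNeg (square-nonNeg c) (square-nonNeg (c + 1#))))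
        (solve 1 (λ c → :1 :+ (c :* c :+ (c :+ :1) :* (c :+ :1))
          := (:1 :+ :1) :* (c :- :- (:1 :+ c :* c))) refl _) ,
    half-positive (1+-positive (+-nonNeg (square-nonNeg c) (square-nonNeg (c - 1#))))
        (solve 1 (λ c → :1 :+ (c :* c :+ (c :- :1) :* (c :- :1))
          := (:1 :+ :1) :* (:1 :+ c :* c :- c)) refl _))

  lim-* : s ⟶ a → t ⟶ b → (λ n → s n * t n) ⟶ (a * b)
  lim-* {s} {a} {t} {b} s→a t→b = null-cong (λ _ →
      (solve 4 (λ u a v b → (u :- a) :* (v :- b) :+ (a :* (v :- b) :+ b :* (u :- a))
        := u :* v :- a :* b) refl _ _ _ _))
    -- The difference s n - a is eventually within 1 of zero by the definition of the limit, which
    -- spares a proof that convergent sequences are bounded.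
    (null-+ (null-bounded-* 0<1 (s→a 1# 0<1) t→b) (null-+ (null-scale a t→b) (null-scale b s→a)))

  lim-nonNeg : (∃ λ N → ∀ n → N ℕ.≤ n → 0# ≤ s n) → s ⟶ a → 0# ≤ a
  lim-nonNeg {s} {a} (M , 0≤s) s→a with em {0# ≤ a}
  ... | yes 0≤a = 0≤a
  ... | no 0≰a  = ⊥-elim (<⇒≱ s<0 (0≤s (M ℕ.+ N) (ℕ.m≤m+n M N)))
    where
    0<-a : 0# < - a
    0<-a = by-diff-< (diff-positive (≰⇒> 0≰a)) (solve 1 (λ a → :0 :- a := :- a :- :0) refl _)
    N = proj₁ (s→a (- a) 0<-a)
    s<0 : s (M ℕ.+ N) < 0#
    s<0 = by-diff-< (diff-positive (proj₂ (proj₂ (s→a (- a) 0<-a) (M ℕ.+ N) (ℕ.m≤n+m N M))))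
        (solve 2 (λ a u → :- a :- (u :- a) := :0 :- u) refl _ _)

  lim-mono-≤ : (∃ λ N → ∀ n → N ℕ.≤ n → s n ≤ t n) → s ⟶ a → t ⟶ b → a ≤ b
  lim-mono-≤ {s} {t} {a} {b} (N , s≤t) s→a t→b =
    by-diff (lim-nonNeg (N , λ n N≤n → diff (s≤t n N≤n))
      (lim-cong (λ _ → (solve 2 (λ u v → u :+ :- :1 :* v
            := u :- v) refl _ _)) (lim-+ t→b (lim-* (lim-const (- 1#)) s→a))))
          (solve 2 (λ b a → b :+ :- :1 :* a := b :- a) refl _ _)

  lim-unique : s ⟶ a → s ⟶ b → a ≈ b
  lim-unique s→a s→b =
    antisym (lim-mono-≤ (0 , λ _ _ → ≤-refl) s→a s→b) (lim-mono-≤ (0 , λ _ _ → ≤-refl) s→b s→a)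

  stepwise-mono : (∀ n → s n ≤ s (suc n)) → m ℕ.≤ n → s m ≤ s n
  stepwise-mono {s} {m} step m≤n = go (ℕ.≤⇒≤′ m≤n)
    where
    go : ∀ {n} → m ℕ.≤′ n → s m ≤ s n
    go ℕ.≤′-refl        = ≤-refl
    go (ℕ.≤′-step m≤′n) = ≤-trans (go m≤′n) (step _)

  monotone-convergence : (∀ n → s n ≤ s (suc n)) → (∀ n → s n ≤ b) →
                         ∃ λ l → s ⟶ l
  monotone-convergence {s} {b} step s≤b = S , converges
    where
    sup = supremum (λ a → ∃ λ n → a ≈ s n) (s 0 , 0 , refl)
      (b , λ { (n , a≈sn) → ≤-trans (≤-reflexive a≈sn) (s≤b n) })
    S = proj₁ sup
    s≤S : ∀ n → s n ≤ S
    s≤S n = proj₁ (proj₂ sup) (n , refl)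
    converges : s ⟶ S
    converges ε 0<ε with em {∃ λ N → S - ε < s N}
    ... | yes (N , S-ε<sN) = N , λ n N≤n →
      by-diff-< (diff-positive (begin-strict
        S - ε  <⟨ S-ε<sN ⟩
        s N    ≤⟨ stepwise-mono step N≤n ⟩
        s n    ∎)) (solve 3 (λ u v ε → u :- (v :- ε) := u :- v :- :- ε) refl _ _ _) ,
      (begin-strict
        s n - S  ≤⟨ by-diff (diff (s≤S n)) (solve 2 (λ u v → u :- v := :0 :- (v :- u)) refl _ _) ⟩
        0#       <⟨ 0<ε ⟩
        ε        ∎)
    ... | no ∄N = ⊥-elim (<⇒≱ 0<ε (by-diff (diff (proj₂ (proj₂ sup) below))
        (solve 2 (λ u ε → u :- ε :- u := :0 :- ε) refl _ _)))
      where
      below : UpperBound (λ a → ∃ λ n → a ≈ s n) (S - ε)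
      below {a} (n , a≈sn) = ≮⇒≥ λ S-ε<a → ∄N (n , (begin-strict S - ε <⟨ S-ε<a ⟩ a ≈⟨ a≈sn ⟩ s n ∎))

  the-spec : {Q : Pred Carrier 0ℓ} → ∃ Q → Q (the Q)
  the-spec {Q} ∃Q with em {∃ Q}
  ... | yes (_ , Qx) = Qx
  ... | no ∄Q        = ⊥-elim (∄Q ∃Q)

  -- Finite sums

  -- These are the partial sums in `HasSum` verbatim, so `HasSum f l` unfolds to `psum f ⟶ l`. The
  -- underlying recursion peels off the first term; `psum-suc` gives access to the last.
  psum : (ℕ → Carrier) → ℕ → Carrier
  psum f n = sum {n} (λ i → f (Fin.toℕ i))

  psum-suc : ∀ f n → psum f (suc n) ≈ psum f n + f n
  psum-suc f zero    = solve 1 (λ u → u :+ :0 := :0 :+ u) refl _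
  psum-suc f (suc n) = begin-equality
    f 0 + psum (f ∘ suc) (suc n)          ≈⟨ +-congˡ (psum-suc (f ∘ suc) n) ⟩
    f 0 + (psum (f ∘ suc) n + f (suc n))  ≈⟨ solve 3 (λ u v w → u :+ (v :+ w) := u :+ v :+ w) refl _ _ _ ⟩
    psum f (suc n) + f (suc n)            ∎

  psum-cong : (∀ n → f n ≈ g n) → ∀ n → psum f n ≈ psum g n
  psum-cong f≈g zero    = refl
  psum-cong f≈g (suc n) = +-cong (f≈g 0) (psum-cong (f≈g ∘ suc) n)

  psum-mono-≤ : (∀ n → f n ≤ g n) → ∀ n → psum f n ≤ psum g n
  psum-mono-≤ f≤g zero    = ≤-refl
  psum-mono-≤ f≤g (suc n) = +-mono-≤ (f≤g 0) (psum-mono-≤ (f≤g ∘ suc) n)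

  psum-+ : ∀ f g n → psum (λ i → f i + g i) n ≈ psum f n + psum g n
  psum-+ f g zero    = solve 0 (:0 := :0 :+ :0) refl
  psum-+ f g (suc n) = trans (+-congˡ (psum-+ (f ∘ suc) (g ∘ suc) n))
      (solve 4 (λ u v w p → u :+ v :+ (w :+ p) := u :+ w :+ (v :+ p)) refl _ _ _ _)

  psum-* : ∀ c f n → psum (λ i → c * f i) n ≈ c * psum f n
  psum-* c f zero    = solve 1 (λ c → :0 := c :* :0) refl _
  psum-* c f (suc n) = trans (+-congˡ (psum-* c (f ∘ suc) n))
      (solve 3 (λ c u v → c :* u :+ c :* v := c :* (u :+ v)) refl _ _ _)

  psum-0 : ∀ n → psum (λ _ → 0#) n ≈ 0#
  psum-0 zero    = refl
  psum-0 (suc n) = trans (+-congˡ (psum-0 n)) (solve 0 (:0 :+ :0 := :0) refl)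

  psum-nonNeg : (∀ n → 0# ≤ f n) → ∀ n → 0# ≤ psum f n
  psum-nonNeg 0≤f n = ≤-trans (≤-reflexive (sym (psum-0 n))) (psum-mono-≤ 0≤f n)

  psum-≤-suc : (∀ n → 0# ≤ f n) → ∀ n → psum f n ≤ psum f (suc n)
  psum-≤-suc {f} 0≤f n = begin
    psum f n         ≤⟨ by-diff (0≤f n) (solve 2 (λ u v → u := v :+ u :- v) refl _ _) ⟩
    psum f n + f n   ≈⟨ psum-suc f n ⟨
    psum f (suc n)   ∎

  psum-monoʳ-≤ : (∀ n → 0# ≤ f n) → m ℕ.≤ n → psum f m ≤ psum f n
  psum-monoʳ-≤ 0≤f = stepwise-mono (psum-≤-suc 0≤f)

  ∑∞-hasSum : ∀ {f} → HasSum f l → HasSum f (∑∞ f)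
  ∑∞-hasSum {l} {f} f→l = the-spec {HasSum f} (l , f→l)

  ∑∞-unique : ∀ {f} → HasSum f l → ∑∞ f ≈ l
  ∑∞-unique {f = f} f→l = lim-unique (∑∞-hasSum {f = f} f→l) f→l

  eventually-constant : ∀ N → (∀ n → N ℕ.≤ n → s n ≈ l) → s ⟶ l
  eventually-constant {s} {l} N s≈l ε 0<ε = N , λ n N≤n →
    by-diff-< 0<ε (ε≈ (s≈l n N≤n)) ,
    (begin-strict s n - l ≈⟨ +-congʳ (s≈l n N≤n) ⟩ l - l
      ≈⟨ solve 1 (λ l → l :- l := :0) refl _ ⟩ 0# <⟨ 0<ε ⟩ ε ∎)
    where
    ε≈ : ∀ {x} → x ≈ l → ε ≈ x - l - - ε
    ε≈ {x} x≈l = begin-equality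
      ε              ≈⟨ solve 2 (λ ε l → ε := l :- l :- :- ε) refl _ _ ⟩
      l - l - - ε    ≈⟨ +-congʳ (+-congʳ x≈l) ⟨
      x - l - - ε    ∎

  -- Cauchy products

  -- Shifting `f` at each step produces the sum of f i * g (n - i) without a subtraction of indices.
  conv : (ℕ → Carrier) → (ℕ → Carrier) → ℕ → Carrier
  conv f g zero    = f 0 * g 0
  conv f g (suc n) = f 0 * g (suc n) + conv (f ∘ suc) g n

  conv-cong : (∀ n → f n ≈ g n) → (∀ n → s n ≈ t n) → ∀ n → conv f s n ≈ conv g t n
  conv-cong f≈g s≈t zero    = *-cong (f≈g 0) (s≈t 0)
  conv-cong f≈g s≈t (suc n) =
    +-cong (*-cong (f≈g 0) (s≈t (suc n))) (conv-cong (f≈g ∘ suc) s≈t n)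

  conv-+ˡ : ∀ f g h n → conv (λ i → f i + g i) h n ≈ conv f h n + conv g h n
  conv-+ˡ f g h zero    = solve 3 (λ u v w → (u :+ v) :* w := u :* w :+ v :* w) refl _ _ _
  conv-+ˡ f g h (suc n) = trans (+-congˡ (conv-+ˡ (f ∘ suc) (g ∘ suc) h n))
      (solve 5 (λ u v w p q → (u :+ v) :* w :+ (p :+ q) := u :* w :+ p :+ (v :* w :+ q)) refl _ _ _ _ _)

  conv-*ˡ : ∀ c f h n → conv (λ i → c * f i) h n ≈ c * conv f h n
  conv-*ˡ c f h zero    = solve 3 (λ c u v → c :* u :* v := c :* (u :* v)) refl _ _ _
  conv-*ˡ c f h (suc n) = trans (+-congˡ (conv-*ˡ c (f ∘ suc) h n))
      (solve 4 (λ c u v w → c :* u :* v :+ c :* w := c :* (u :* v :+ w)) refl _ _ _ _)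

  conv-*ʳ : ∀ c f h n → conv f (λ i → c * h i) n ≈ c * conv f h n
  conv-*ʳ c f h zero    = solve 3 (λ u c v → u :* (c :* v) := c :* (u :* v)) refl _ _ _
  conv-*ʳ c f h (suc n) = trans (+-congˡ (conv-*ʳ c (f ∘ suc) h n))
      (solve 4 (λ u c v w → u :* (c :* v) :+ c :* w := c :* (u :* v :+ w)) refl _ _ _ _)

  -- Sequences are read as coefficients of formal power series. With `conv` as their product, this
  -- is the formal derivative and `derivative-conv` is the Leibniz rule.
  derivative : (ℕ → Carrier) → ℕ → Carrier
  derivative f n = fromℕ (suc n) * f (suc n)

  derivative-conv : ∀ f g n →
    derivative (conv f g) n ≈ conv (derivative f) g n + conv f (derivative g) n
  derivative-conv f g zero    = solve 4 (λ u v w p → (:1 :+ :0) :* (u :* v :+ w :* p)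
        := (:1 :+ :0) :* w :* p :+ u :* ((:1 :+ :0) :* v)) refl _ _ _ _
  derivative-conv f g (suc n) = begin-equality
    fromℕ (suc (suc n)) * (f 0 * g (suc (suc n)) + conv (f ∘ suc) g (suc n))
      ≈⟨ solve 6 (λ u v w p q r → (:1 :+ (:1 :+ u)) :* (v :* w :+ (p :* q :+ r))
            := v :* ((:1 :+ (:1 :+ u)) :* w) :+ ((:1 :+ u) :* (p :* q :+ r) :+ (p :* q :+ r)))
            refl _ _ _ _ _ _ ⟩
    f 0 * derivative g (suc n) + (derivative (conv (f ∘ suc) g) n + conv (f ∘ suc) g (suc n))
      ≈⟨ +-congˡ (+-congʳ (derivative-conv (f ∘ suc) g n)) ⟩
    f 0 * derivative g (suc n) +
      (conv (derivative (f ∘ suc)) g n + conv (f ∘ suc) (derivative g) n +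
       (f 1 * g (suc n) + conv (f ∘ suc ∘ suc) g n))
      ≈⟨ solve 8 (λ u v w p q r x y → u :* ((:1 :+ (:1 :+ v)) :* w) :+ (p :+ q :+ (r :* x :+ y))
            := (:1 :+ :0) :* r :* x :+ (p :+ y) :+ (u :* ((:1 :+ (:1 :+ v)) :* w) :+ q))
            refl _ _ _ _ _ _ _ _ ⟩
    fromℕ 1 * f 1 * g (suc n) + (conv (derivative (f ∘ suc)) g n + conv (f ∘ suc ∘ suc) g n) +
      conv f (derivative g) (suc n)
      ≈⟨ +-congʳ (+-congˡ (conv-+ˡ (derivative (f ∘ suc)) (f ∘ suc ∘ suc) g n)) ⟨
    fromℕ 1 * f 1 * g (suc n) + conv (λ i → derivative (f ∘ suc) i + f (suc (suc i))) g n +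
      conv f (derivative g) (suc n)
      ≈⟨ +-congʳ (+-congˡ (conv-cong (λ _ →
          (solve 2 (λ u v → (:1 :+ u) :* v :+ v := (:1 :+ (:1 :+ u)) :* v) refl _ _)) (λ _ → refl) n)) ⟩
    conv (derivative f) g (suc n) + conv f (derivative g) (suc n) ∎

  -- psum (conv f g) n is the sum over i < n of f i * psum g (n ∸ i).
  psum-conv-suc : ∀ f g n →
    psum (conv f g) (suc n) ≈ f 0 * psum g (suc n) + psum (conv (f ∘ suc) g) n
  psum-conv-suc f g n = begin-equality
    f 0 * g 0 + psum (λ i → f 0 * g (suc i) + conv (f ∘ suc) g i) n
      ≈⟨ +-congˡ (psum-+ (λ i → f 0 * g (suc i)) (conv (f ∘ suc) g) n) ⟩
    f 0 * g 0 + (psum (λ i → f 0 * g (suc i)) n + psum (conv (f ∘ suc) g) n)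
      ≈⟨ +-congˡ (+-congʳ (psum-* (f 0) (g ∘ suc) n)) ⟩
    f 0 * g 0 + (f 0 * psum (g ∘ suc) n + psum (conv (f ∘ suc) g) n)
      ≈⟨ solve 4 (λ u v w p → u :* v :+ (u :* w :+ p) := u :* (v :+ w) :+ p) refl _ _ _ _ ⟩
    f 0 * psum g (suc n) + psum (conv (f ∘ suc) g) n ∎

  -- The triangle of index pairs with i + j < n lies in the square i, j < n.
  psum-conv-≤ : (∀ n → 0# ≤ f n) → (∀ n → 0# ≤ g n) → ∀ n →
                psum (conv f g) n ≤ psum f n * psum g n
  psum-conv-≤ {f} {g} 0≤f 0≤g zero    = ≤-reflexive (solve 0 (:0 := :0 :* :0) refl)
  psum-conv-≤ {f} {g} 0≤f 0≤g (suc n) = begin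
    psum (conv f g) (suc n)
      ≈⟨ psum-conv-suc f g n ⟩
    f 0 * psum g (suc n) + psum (conv (f ∘ suc) g) n
      ≤⟨ +-mono-≤ ≤-refl (psum-conv-≤ (0≤f ∘ suc) 0≤g n) ⟩
    f 0 * psum g (suc n) + psum (f ∘ suc) n * psum g n
      ≤⟨ +-mono-≤ ≤-refl (*-monoˡ-≤ (psum-nonNeg (0≤f ∘ suc) n) (psum-≤-suc 0≤g n)) ⟩
    f 0 * psum g (suc n) + psum (f ∘ suc) n * psum g (suc n)
      ≈⟨ solve 4 (λ u v w p → u :* (v :+ w) :+ p :* (v :+ w) := (u :+ p) :* (v :+ w)) refl _ _ _ _ ⟩
    psum f (suc n) * psum g (suc n) ∎

  -- Conversely, the rectangle i < m, j < n lies in the triangle i + j < m + n.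
  psum-*-≤-conv : (∀ n → 0# ≤ f n) → (∀ n → 0# ≤ g n) → ∀ m n →
                  psum f m * psum g n ≤ psum (conv f g) (m ℕ.+ n)
  psum-*-≤-conv {f} {g} 0≤f 0≤g zero n = begin
    0# * psum g n         ≈⟨ solve 1 (λ u → :0 :* u := :0) refl _ ⟩
    0#                    ≤⟨ psum-nonNeg (conv-nonNeg 0≤f) n ⟩
    psum (conv f g) n     ∎
    where
    conv-nonNeg : ∀ {f} → (∀ n → 0# ≤ f n) → ∀ n → 0# ≤ conv f g n
    conv-nonNeg 0≤f zero    = *-nonNeg (0≤f 0) (0≤g 0)
    conv-nonNeg 0≤f (suc n) = +-nonNeg (*-nonNeg (0≤f 0) (0≤g (suc n))) (conv-nonNeg (0≤f ∘ suc) n)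
  psum-*-≤-conv {f} {g} 0≤f 0≤g (suc m) n = begin
    psum f (suc m) * psum g n
      ≈⟨ solve 3 (λ u v w → (u :+ v) :* w := u :* w :+ v :* w) refl _ _ _ ⟩
    f 0 * psum g n + psum (f ∘ suc) m * psum g n
      ≤⟨ +-mono-≤ (*-monoˡ-≤ (0≤f 0) (psum-monoʳ-≤ 0≤g (ℕ.m≤n+m n (suc m))))
                  (psum-*-≤-conv (0≤f ∘ suc) 0≤g m n) ⟩
    f 0 * psum g (suc m ℕ.+ n) + psum (conv (f ∘ suc) g) (m ℕ.+ n)
      ≈⟨ psum-conv-suc f g (m ℕ.+ n) ⟨
    psum (conv f g) (suc m ℕ.+ n) ∎

  Dominated : Carrier → Carrier → Set
  Dominated a x = (- a ≤ x) × (x ≤ a)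

  dominated-+ : Dominated a x → Dominated b y → Dominated (a + b) (x + y)
  dominated-+ (-a≤x , x≤a) (-b≤y , y≤b) =
    ≤-trans (≤-reflexive (solve 2 (λ a b → :- (a :+ b)
          := :- a :- b) refl _ _)) (+-mono-≤ -a≤x -b≤y) , +-mono-≤ x≤a y≤b

  dominated-resp : a ≈ b → x ≈ y → Dominated a x → Dominated b y
  dominated-resp a≈b x≈y (-a≤x , x≤a) =
    (begin _ ≈⟨ -‿cong a≈b ⟨ _ ≤⟨ -a≤x ⟩ _ ≈⟨ x≈y ⟩ _ ∎) ,
    (begin _ ≈⟨ x≈y ⟨ _ ≤⟨ x≤a ⟩ _ ≈⟨ a≈b ⟩ _ ∎)

  dominated-* : Dominated a x → Dominated b y → Dominated (a * b) (x * y)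
  dominated-* {a} {x} {b} {y} (-a≤x , x≤a) (-b≤y , y≤b) =
    *-cancelˡ-≤ 0<2 (by-diff (+-nonNeg (*-nonNeg (diff x≤a) (diff y≤b)) (*-nonNeg (diff -a≤x) (diff -b≤y)))
        (solve 4 (λ a x b y → (a :- x) :* (b :- y) :+ (x :- :- a) :* (y :- :- b)
          := (:1 :+ :1) :* (x :* y) :- (:1 :+ :1) :* :- (a :* b)) refl _ _ _ _)) ,
    *-cancelˡ-≤ 0<2 (by-diff (+-nonNeg (*-nonNeg (diff x≤a) (diff -b≤y)) (*-nonNeg (diff -a≤x) (diff y≤b)))
        (solve 4 (λ a x y b → (a :- x) :* (y :- :- b) :+ (x :- :- a) :* (b :- y)
          := (:1 :+ :1) :* (a :* b) :- (:1 :+ :1) :* (x :* y)) refl _ _ _ _))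

  dominated-psum : (∀ n → Dominated (f n) (s n)) → ∀ n → Dominated (psum f n) (psum s n)
  dominated-psum dom zero    = ≤-reflexive (solve 0 (:- :0 := :0) refl) , ≤-refl
  dominated-psum dom (suc n) = dominated-+ (dom 0) (dominated-psum (dom ∘ suc) n)

  -- The remainder consists of the products with i, j < n and n ≤ i + j. `expand` writes it as a sum
  -- of such products, and domination passes through products and sums.
  psum-conv-remainder : (∀ n → Dominated (f n) (s n)) → (∀ n → Dominated (g n) (t n)) → ∀ n →
    Dominated (psum f n * psum g n - psum (conv f g) n) (psum s n * psum t n - psum (conv s t) n)
  psum-conv-remainder {f} {s} {g} {t} f≽s g≽t zero =
    dominated-resp (solve 0 (:0
          := :0 :* :0 :- :0) refl)
        (solve 0 (:0
              := :0 :* :0 :- :0) refl) (≤-reflexive {x = - 0#} {y = 0#}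
            (solve 0 (:- :0 := :0) refl) , ≤-refl)
  psum-conv-remainder {f} {s} {g} {t} f≽s g≽t (suc n) = dominated-resp (sym (expand f g)) (sym (expand s t))
    (dominated-+ (psum-conv-remainder (f≽s ∘ suc) g≽t n)
                 (dominated-* (dominated-psum (f≽s ∘ suc) n) (g≽t n)))
    where
    expand : ∀ f g → psum f (suc n) * psum g (suc n) - psum (conv f g) (suc n) ≈
             psum (f ∘ suc) n * psum g n - psum (conv (f ∘ suc) g) n + psum (f ∘ suc) n * g n
    expand f g = begin-equality
      (f 0 + F) * psum g (suc n) - psum (conv f g) (suc n)  ≈⟨ +-congˡ (-‿cong (psum-conv-suc f g n)) ⟩
      (f 0 + F) * psum g (suc n) - (f 0 * psum g (suc n) + T) ≈⟨ rearrange (psum g (suc n)) ⟩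
      F * psum g (suc n) - T           ≈⟨ +-congʳ (*-congˡ (psum-suc g n)) ⟩
      F * (psum g n + g n) - T
        ≈⟨ solve 4 (λ u v w p → u :* (v :+ w) :- p := u :* v :- p :+ u :* w) refl _ _ _ _ ⟩
      F * psum g n - T + F * g n       ∎
      where
      F = psum (f ∘ suc) n
      T = psum (conv (f ∘ suc) g) n
      rearrange : ∀ G → (f 0 + F) * G - (f 0 * G + T) ≈ F * G - T
      rearrange G = solve 4 (λ u v G w → (u :+ v) :* G :- (u :* G :+ w) := v :* G :- w) refl _ _ _ _

  -- The exponential function

  expTerm : Carrier → ℕ → Carrier
  expTerm x n = x ^ n / fromℕ (n !)

  fromℕ-!-positive : ∀ n → 0# < fromℕ (n !)
  fromℕ-!-positive n = fromℕ-positive (ℕ.1≤n! n)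

  expTerm-0 : ∀ x → expTerm x 0 ≈ 1#
  expTerm-0 x = trans (solve 1 (λ u → :1 :* u
        := (:1 :+ :0) :* u) refl _) (⁻¹-inverse (fromℕ-!-positive 0))

  !-*-expTerm : ∀ x n → fromℕ (n !) * expTerm x n ≈ x ^ n
  !-*-expTerm x n = begin-equality
    fromℕ (n !) * (x ^ n * fromℕ (n !) ⁻¹)
      ≈⟨ solve 3 (λ a b c → a :* (b :* c) := a :* c :* b) refl (fromℕ (n !)) (x ^ n) (fromℕ (n !) ⁻¹) ⟩
    fromℕ (n !) * fromℕ (n !) ⁻¹ * x ^ n    ≈⟨ *-congʳ (⁻¹-inverse (fromℕ-!-positive n)) ⟩
    1# * x ^ n                              ≈⟨ solve 1 (λ u → :1 :* u := u) refl _ ⟩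
    x ^ n                                   ∎

  derivative-expTerm : ∀ x n → derivative (expTerm x) n ≈ x * expTerm x n
  derivative-expTerm x n = *-cancelˡ-≈ (fromℕ-!-positive n) (begin-equality
    fromℕ (n !) * (fromℕ (suc n) * expTerm x (suc n))
      ≈⟨ solve 3 (λ a b c → a :* (b :* c)
          := b :* a :* c) refl (fromℕ (n !)) (fromℕ (suc n)) (expTerm x (suc n)) ⟩
    fromℕ (suc n) * fromℕ (n !) * expTerm x (suc n)    ≈⟨ *-congʳ (fromℕ-* (suc n) (n !)) ⟨
    fromℕ (suc n !) * expTerm x (suc n)                ≈⟨ !-*-expTerm x (suc n) ⟩
    x * x ^ n                                          ≈⟨ *-congˡ (!-*-expTerm x n) ⟨
    x * (fromℕ (n !) * expTerm x n)
      ≈⟨ solve 3 (λ a b c → a :* (b :* c) := b :* (a :* c)) refl x (fromℕ (n !)) (expTerm x n) ⟩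
    fromℕ (n !) * (x * expTerm x n)                    ∎)

  -- The formal initial value problem f′ = x f, f(0) = 1 determines each coefficient from the one
  -- before. Its uniqueness takes the place of the binomial theorem in `expTerm-+`.
  expTerm-characterisation : f 0 ≈ 1# → (∀ n → derivative f n ≈ x * f n) → ∀ n → f n ≈ expTerm x n
  expTerm-characterisation {f} {x} f0≈1 f′≈xf zero    = trans f0≈1 (sym (expTerm-0 x))
  expTerm-characterisation {f} {x} f0≈1 f′≈xf (suc n) = *-cancelˡ-≈ (fromℕ-suc-positive n) (begin-equality
    derivative f n              ≈⟨ f′≈xf n ⟩
    x * f n                     ≈⟨ *-congˡ (expTerm-characterisation f0≈1 f′≈xf n) ⟩
    x * expTerm x n             ≈⟨ derivative-expTerm x n ⟨
    derivative (expTerm x) n    ∎)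

  expTerm-cong : x ≈ y → ∀ n → expTerm x n ≈ expTerm y n
  expTerm-cong {x} {y} x≈y = expTerm-characterisation (expTerm-0 x)
    λ n → trans (derivative-expTerm x n) (*-congʳ x≈y)

  expTerm-+ : ∀ x y n → conv (expTerm x) (expTerm y) n ≈ expTerm (x + y) n
  expTerm-+ x y = expTerm-characterisation
    (trans (*-cong (expTerm-0 x) (expTerm-0 y)) (solve 0 (:1 :* :1 := :1) refl))
    λ n → begin-equality
      derivative (conv (expTerm x) (expTerm y)) n
        ≈⟨ derivative-conv (expTerm x) (expTerm y) n ⟩
      conv (derivative (expTerm x)) (expTerm y) n + conv (expTerm x) (derivative (expTerm y)) n
        ≈⟨ +-cong (conv-cong (derivative-expTerm x) (λ _ → refl) n) (conv-cong (λ _ → refl) (derivative-expTerm y) n) ⟩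
      conv (λ i → x * expTerm x i) (expTerm y) n + conv (expTerm x) (λ i → y * expTerm y i) n
        ≈⟨ +-cong (conv-*ˡ x (expTerm x) (expTerm y) n) (conv-*ʳ y (expTerm x) (expTerm y) n) ⟩
      x * conv (expTerm x) (expTerm y) n + y * conv (expTerm x) (expTerm y) n
        ≈⟨ solve 3 (λ c x y → x :* c :+ y :* c
              := (x :+ y) :* c) refl (conv (expTerm x) (expTerm y) n) x y ⟩
      (x + y) * conv (expTerm x) (expTerm y) n ∎

  expTerm-nonNeg : 0# ≤ x → ∀ n → 0# ≤ expTerm x n
  expTerm-nonNeg 0≤x n = *-nonNeg (^-nonNeg n 0≤x) (⁻¹-nonNeg (fromℕ-!-positive n))

  expTerm-dominated : Dominated a x → ∀ n → Dominated (expTerm a n) (expTerm x n)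
  expTerm-dominated {a} {x} a≽x n =
    dominated-* (power n) (≤-trans (by-diff (+-nonNeg 0≤i 0≤i)
        (solve 1 (λ u → u :+ u := u :- :- u) refl _)) ≤-refl , ≤-refl)
    where
    0≤i : 0# ≤ fromℕ (n !) ⁻¹
    0≤i = ⁻¹-nonNeg (fromℕ-!-positive n)
    power : ∀ n → Dominated (a ^ n) (x ^ n)
    power zero    = by-diff (+-nonNeg 0≤1 0≤1) (solve 0 (:1 :+ :1 := :1 :- :- :1) refl) , ≤-refl
    power (suc n) = dominated-* a≽x (power n)

  expSum : Carrier → ℕ → Carrier
  expSum x = psum (expTerm x)

  expSum-+ : ∀ x y n → psum (conv (expTerm x) (expTerm y)) n ≈ expSum (x + y) n
  expSum-+ x y = psum-cong (expTerm-+ x y)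

  expSum-+-≤ : 0# ≤ x → 0# ≤ y → ∀ n → expSum (x + y) n ≤ expSum x n * expSum y n
  expSum-+-≤ {x} {y} 0≤x 0≤y n = ≤-trans (≤-reflexive (sym (expSum-+ x y n)))
    (psum-conv-≤ (expTerm-nonNeg 0≤x) (expTerm-nonNeg 0≤y) n)

  -- As x e_i = (i + 1) e_(i+1) ≥ e_(i+1), the product telescopes; the subtracted last term in
  -- `telescope` is what lets the induction close. At x = ½ this bounds the series, and in the limit
  -- it gives `1+x≤exp` for negative arguments.
  1-x*expSum≤1 : 0# ≤ x → ∀ n → (1# - x) * expSum x n ≤ 1#
  1-x*expSum≤1 {x} 0≤x zero    = by-diff 0≤1 (solve 1 (λ x → :1 := :1 :- (:1 :- x) :* :0) refl _)
  1-x*expSum≤1 {x} 0≤x (suc n) = begin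
    (1# - x) * expSum x (suc n)   ≤⟨ telescope n ⟩
    1# - derivative (expTerm x) n ≤⟨ by-diff (*-nonNeg (fromℕ-nonNeg (suc n)) (expTerm-nonNeg 0≤x (suc n)))
        (solve 1 (λ d → d := :1 :- (:1 :- d)) refl (derivative (expTerm x) n)) ⟩
    1#                            ∎
    where
    e : ℕ → Carrier
    e = expTerm x
    telescope : ∀ n → (1# - x) * expSum x (suc n) ≤ 1# - derivative (expTerm x) n
    telescope zero = ≤-reflexive (begin-equality
      (1# - x) * (e 0 + 0#)
        ≈⟨ solve 2 (λ c x → (:1 :- x) :* (c :+ :0) := c :- x :* c) refl (e 0) x ⟩
      e 0 - x * e 0                  ≈⟨ +-cong (expTerm-0 x) (-‿cong (sym (derivative-expTerm x 0))) ⟩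
      1# - derivative e 0            ∎)
    telescope (suc n) = begin
      (1# - x) * expSum x (suc (suc n))
        ≈⟨ *-congˡ (psum-suc e (suc n)) ⟩
      (1# - x) * (expSum x (suc n) + e (suc n))
        ≈⟨ solve 3 (λ s c x → (:1 :- x) :* (s :+ c)
              := (:1 :- x) :* s :+ (c :- x :* c)) refl (expSum x (suc n)) (e (suc n)) x ⟩
      (1# - x) * expSum x (suc n) + (e (suc n) - x * e (suc n))
        ≤⟨ +-mono-≤ (telescope n) ≤-refl ⟩
      1# - derivative e n + (e (suc n) - x * e (suc n))
        ≤⟨ by-diff (*-nonNeg (fromℕ-nonNeg n) (expTerm-nonNeg 0≤x (suc n)))
            (solve 3 (λ m c x → m :* c
              := :1 :- x :* c :- (:1 :- (:1 :+ m) :* c :+ (c :- x :* c))) refl (fromℕ n) (e (suc n)) x) ⟩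
      1# - x * e (suc n)
        ≈⟨ +-congˡ (-‿cong (derivative-expTerm x (suc n))) ⟨
      1# - derivative e (suc n) ∎

  expSum-mono-≤ : 0# ≤ x → x ≤ y → ∀ n → expSum x n ≤ expSum y n
  expSum-mono-≤ 0≤x x≤y = psum-mono-≤ λ n →
    *-monoʳ-≤ (⁻¹-nonNeg (fromℕ-!-positive n)) (^-mono-≤ n 0≤x x≤y)

  ½-double : 2# * ½ ≈ 1#
  ½-double = ⁻¹-inverse 0<2

  0≤½ : 0# ≤ ½
  0≤½ = ⁻¹-nonNeg 0<2

  expSum-½-bounded : ∀ n → expSum ½ n ≤ 2#
  expSum-½-bounded n = begin
    expSum ½ n                        ≈⟨ solve 1 (λ u → u := :1 :* u) refl _ ⟩
    1# * expSum ½ n                   ≈⟨ *-congʳ halve ⟩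
    2# * (1# - ½) * expSum ½ n
      ≈⟨ solve 2 (λ u v → (:1 :+ :1) :* (:1 :- u) :* v := (:1 :+ :1) :* ((:1 :- u) :* v)) refl _ _ ⟩
    2# * ((1# - ½) * expSum ½ n)      ≤⟨ *-monoˡ-≤ (proj₁ 0<2) (1-x*expSum≤1 0≤½ n) ⟩
    2# * 1#                           ≈⟨ solve 0 ((:1 :+ :1) :* :1 := :1 :+ :1) refl ⟩
    2#                                ∎
    where
    halve : 1# ≈ 2# * (1# - ½)
    halve = begin-equality
      1#              ≈⟨ solve 0 (:1 := :1 :+ :1 :- :1) refl ⟩
      2# - 1#         ≈⟨ +-congˡ (-‿cong ½-double) ⟨
      2# - 2# * ½     ≈⟨ solve 1 (λ u → :1 :+ :1 :- (:1 :+ :1) :* u := (:1 :+ :1) :* (:1 :- u)) refl _ ⟩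
      2# * (1# - ½)   ∎

  -- Some number M of halves exceeds `x`, and the bound 2 at ½ multiplies up to 2 ^ M because
  -- partial sums are submultiplicative.
  expSum-bounded : 0# ≤ x → ∃ λ b → ∀ n → expSum x n ≤ b
  expSum-bounded {x} 0≤x = 2# ^ M , λ n → begin
    expSum x n               ≤⟨ expSum-mono-≤ 0≤x x≤m½ n ⟩
    expSum (fromℕ M * ½) n   ≤⟨ multiples M n ⟩
    2# ^ M                   ∎
    where
    M = proj₁ (archimedean (2# * x))
    x≤m½ : x ≤ fromℕ M * ½
    x≤m½ = begin
      x              ≈⟨ solve 1 (λ x → x := :1 :* x) refl _ ⟩
      1# * x         ≈⟨ *-congʳ ½-double ⟨
      2# * ½ * x     ≈⟨ solve 2 (λ u x → (:1 :+ :1) :* u :* x := (:1 :+ :1) :* x :* u) refl _ _ ⟩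
      2# * x * ½     ≤⟨ *-monoʳ-≤ 0≤½ (proj₁ (proj₂ (archimedean (2# * x)))) ⟩
      fromℕ M * ½    ∎
    multiples : ∀ m n → expSum (fromℕ m * ½) n ≤ 2# ^ m
    multiples zero n = begin
      expSum (0# * ½) n                ≈⟨ psum-cong (expTerm-cong
          (solve 1 (λ u → :0 :* u := :0) refl _)) n ⟩
      expSum 0# n                      ≈⟨ solve 1 (λ u → u := (:1 :- :0) :* u) refl _ ⟩
      (1# - 0#) * expSum 0# n          ≤⟨ 1-x*expSum≤1 ≤-refl n ⟩
      1#                               ∎
    multiples (suc m) n = begin
      expSum (fromℕ (suc m) * ½) n            ≈⟨ psum-cong (expTerm-cong
          (solve 2 (λ u v → (:1 :+ u) :* v := v :+ u :* v) refl _ _)) n ⟩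
      expSum (½ + fromℕ m * ½) n              ≤⟨ expSum-+-≤ 0≤½ (*-nonNeg (fromℕ-nonNeg m) 0≤½) n ⟩
      expSum ½ n * expSum (fromℕ m * ½) n     ≤⟨ *-mono-≤ (psum-nonNeg (expTerm-nonNeg 0≤½) n) (^-nonNeg m (proj₁ 0<2))
                                                          (expSum-½-bounded n) (multiples m n) ⟩
      2# * 2# ^ m                             ∎

  ∃-dominating : ∀ x → ∃ λ a → (0# ≤ a) × Dominated a x
  ∃-dominating x with total 0# x
  ... | inj₁ 0≤x = x , 0≤x , by-diff (+-nonNeg 0≤x 0≤x)
      (solve 1 (λ x → x :+ x := x :- :- x) refl _) , ≤-refl
  ... | inj₂ x≤0 = - x , by-diff (diff x≤0)
      (solve 1 (λ x → :0 :- x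
        := :- x :- :0) refl _) , ≤-reflexive (solve 1 (λ x → :- (:- x) := x) refl _) ,
                   by-diff (+-nonNeg (diff x≤0) (diff x≤0))
                       (solve 1 (λ x → :0 :- x :+ (:0 :- x) := :- x :- x) refl _)

  -- A dominated series converges since adding the dominating series makes its terms nonnegative.
  exp-hasSum : ∀ x → HasSum (expTerm x) (exp x)
  exp-hasSum x = ∑∞-hasSum {f = expTerm x} (lim-cong (λ n → split n) (lim-+ x+a→L (lim-* (lim-const (- 1#)) a→L)))
    where
    α = proj₁ (∃-dominating x)
    0≤α = proj₁ (proj₂ (∃-dominating x))
    dominates = expTerm-dominated (proj₂ (proj₂ (∃-dominating x)))
    β = proj₁ (expSum-bounded 0≤α)
    a≤b = proj₂ (expSum-bounded 0≤α)
    both : ℕ → Carrier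
    both n = expTerm x n + expTerm α n
    a→L = proj₂ (monotone-convergence (psum-≤-suc (expTerm-nonNeg 0≤α)) a≤b)
    x+a→L = proj₂ (monotone-convergence
      (psum-≤-suc {f = both} (λ n → by-diff (diff (proj₁ (dominates n)))
          (solve 2 (λ y c → y :- :- c := y :+ c :- :0) refl (expTerm x n) (expTerm α n))))
      (λ n → begin
        psum both n                ≈⟨ psum-+ (expTerm x) (expTerm α) n ⟩
        expSum x n + expSum α n    ≤⟨ +-mono-≤ (≤-trans (proj₂ (dominated-psum dominates n)) (a≤b n)) (a≤b n) ⟩
        β + β                      ∎))
    split : ∀ n → psum both n + - 1# * expSum α n ≈ expSum x n
    split n = begin-equality
      psum both n + - 1# * expSum α n                ≈⟨ +-congʳ (psum-+ (expTerm x) (expTerm α) n) ⟩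
      expSum x n + expSum α n + - 1# * expSum α n
        ≈⟨ solve 2 (λ y c → y :+ c :+ :- :1 :* c := y) refl (expSum x n) (expSum α n) ⟩
      expSum x n                                     ∎

  exp-cong : x ≈ y → exp x ≈ exp y
  exp-cong {x} {y} x≈y = lim-unique (lim-cong (psum-cong (expTerm-cong x≈y)) (exp-hasSum x)) (exp-hasSum y)

  expSum≤exp : 0# ≤ x → ∀ n → expSum x n ≤ exp x
  expSum≤exp {x} 0≤x n =
    lim-mono-≤ (n , λ _ → psum-monoʳ-≤ (expTerm-nonNeg 0≤x)) (lim-const (expSum x n)) (exp-hasSum x)

  expSum-0 : ∀ n → expSum 0# (suc n) ≈ 1#
  expSum-0 n = begin-equality
    expTerm 0# 0 + psum (expTerm 0# ∘ suc) n   ≈⟨ +-cong (expTerm-0 0#) (psum-cong zero-power n) ⟩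
    1# + psum (λ _ → 0#) n                     ≈⟨ +-congˡ (psum-0 n) ⟩
    1# + 0#                                    ≈⟨ +-identityʳ 1# ⟩
    1#                                         ∎
    where
    zero-power : ∀ i → expTerm 0# (suc i) ≈ 0#
    zero-power i = solve 2 (λ p q → :0 :* p :* q := :0) refl (0# ^ i) (fromℕ (suc i !) ⁻¹)

  exp-0 : exp 0# ≈ 1#
  exp-0 = lim-unique (exp-hasSum 0#) (eventually-constant 1 λ { (suc n) _ → expSum-0 n })

  exp-+-nonNeg : 0# ≤ x → 0# ≤ y → exp (x + y) ≈ exp x * exp y
  exp-+-nonNeg {x} {y} 0≤x 0≤y = antisym
    (lim-mono-≤ (0 , λ n _ → expSum-+-≤ 0≤x 0≤y n) (exp-hasSum (x + y)) (lim-* (exp-hasSum x) (exp-hasSum y)))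
    (lim-mono-≤ (0 , λ n _ → begin
      expSum x n * expSum y n                            ≤⟨ psum-*-≤-conv (expTerm-nonNeg 0≤x) (expTerm-nonNeg 0≤y) n n ⟩
      psum (conv (expTerm x) (expTerm y)) (n ℕ.+ n)      ≈⟨ expSum-+ x y (n ℕ.+ n) ⟩
      expSum (x + y) (n ℕ.+ n)                           ≤⟨ expSum≤exp (+-nonNeg 0≤x 0≤y) (n ℕ.+ n) ⟩
      exp (x + y)                                        ∎)
      (lim-* (exp-hasSum x) (exp-hasSum y)) (lim-const (exp (x + y))))

  exp-remainder : ∀ x y →
    (λ n → expSum x n * expSum y n - psum (conv (expTerm x) (expTerm y)) n) ⟶ (exp x * exp y - exp (x + y))
  exp-remainder x y = lim-cong (λ n → negate (expSum x n * expSum y n) (psum (conv (expTerm x) (expTerm y)) n))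
    (null-cong (λ n → +-congˡ (-‿cong (negate (exp x * exp y) (exp (x + y)))))
      (lim-+ (lim-* (exp-hasSum x) (exp-hasSum y))
        (lim-* (lim-const (- 1#)) (lim-cong (λ n → sym (expSum-+ x y n)) (exp-hasSum (x + y))))))
    where
    negate : ∀ a b → a + - 1# * b ≈ a - b
    negate = solve 2 (λ a b → a :+ :- :1 :* b := a :- b) refl

  -- The remainder of the Cauchy product for x and y is dominated by the remainder for nonnegative α
  -- and β dominating them, whose limit is 0 by `exp-+-nonNeg`.
  exp-+ : ∀ x y → exp (x + y) ≈ exp x * exp y
  exp-+ x y = antisym
    (by-diff (lim-nonNeg (0 , λ n _ → by-diff (diff (proj₁ (remainder n)))
        (solve 2 (λ r s → s :- :- r := s :+ r :- :0) refl _ _))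
      (lim-+ (exp-remainder x y) (exp-remainder α β)))
      (trans (+-congˡ vanishes) (+-identityʳ _)))
    (by-diff (lim-nonNeg (0 , λ n _ → by-diff (diff (proj₂ (remainder n)))
        (solve 2 (λ r s → r :- s := r :+ :- :1 :* s :- :0) refl _ _))
      (lim-+ (exp-remainder α β) (lim-* (lim-const (- 1#)) (exp-remainder x y))))
      (trans (+-congʳ vanishes) (solve 2 (λ p q → :0 :+ :- :1 :* (p :- q)
            := q :- p) refl (exp x * exp y) (exp (x + y)))))
    where
    α = proj₁ (∃-dominating x)
    0≤a = proj₁ (proj₂ (∃-dominating x))
    β = proj₁ (∃-dominating y)
    0≤b = proj₁ (proj₂ (∃-dominating y))
    remainder = psum-conv-remainder (expTerm-dominated (proj₂ (proj₂ (∃-dominating x))))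
                                    (expTerm-dominated (proj₂ (proj₂ (∃-dominating y))))
    vanishes : exp α * exp β - exp (α + β) ≈ 0#
    vanishes = trans (+-congˡ (-‿cong (exp-+-nonNeg 0≤a 0≤b)))
        (solve 1 (λ c → c :- c := :0) refl (exp α * exp β))

  exp-inverse : ∀ x → exp x * exp (- x) ≈ 1#
  exp-inverse x = begin-equality
    exp x * exp (- x)    ≈⟨ exp-+ x (- x) ⟨
    exp (x - x)          ≈⟨ exp-cong (solve 1 (λ x → x :- x := :0) refl _) ⟩
    exp 0#               ≈⟨ exp-0 ⟩
    1#                   ∎

  1≤exp : 0# ≤ x → 1# ≤ exp x
  1≤exp {x} 0≤x = begin
    1#            ≈⟨ expTerm-0 x ⟨
    expTerm x 0   ≈⟨ +-identityʳ _ ⟨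
    expSum x 1    ≤⟨ expSum≤exp 0≤x 1 ⟩
    exp x         ∎

  exp-positive : ∀ x → 0# < exp x
  exp-positive x with total 0# x
  ... | inj₁ 0≤x = begin-strict 0# <⟨ 0<1 ⟩ 1# ≤⟨ 1≤exp 0≤x ⟩ exp x ∎
  ... | inj₂ x≤0 = ≰⇒> λ exp≤0 → <⇒≱ 0<1 (begin
    1#                  ≈⟨ exp-inverse x ⟨
    exp x * exp (- x)   ≤⟨ *-monoʳ-≤ (≤-trans 0≤1 (1≤exp 0≤-x)) exp≤0 ⟩
    0# * exp (- x)      ≈⟨ solve 1 (λ c → :0 :* c := :0) refl (exp (- x)) ⟩
    0#                  ∎)
    where
    0≤-x : 0# ≤ - x
    0≤-x = by-diff (diff x≤0) (solve 1 (λ x → :0 :- x := :- x :- :0) refl _)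

  exp-nonNeg : ∀ x → 0# ≤ exp x
  exp-nonNeg x = proj₁ (exp-positive x)

  expTerm-1 : ∀ x → expTerm x 1 ≈ x
  expTerm-1 x = begin-equality
    expTerm x 1                 ≈⟨ solve 1 (λ c → c := (:1 :+ :0) :* c) refl (expTerm x 1) ⟩
    derivative (expTerm x) 0    ≈⟨ derivative-expTerm x 0 ⟩
    x * expTerm x 0             ≈⟨ *-congˡ (expTerm-0 x) ⟩
    x * 1#                      ≈⟨ solve 1 (λ x → x :* :1 := x) refl _ ⟩
    x                           ∎

  1+x+½x²≤exp : 0# ≤ x → 1# + x + ½ * (x * x) ≤ exp x
  1+x+½x²≤exp {x} 0≤x = begin
    1# + x + ½ * (x * x)
      ≈⟨ +-cong (+-cong (expTerm-0 x) (expTerm-1 x)) second ⟨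
    expTerm x 0 + expTerm x 1 + expTerm x 2
      ≈⟨ solve 3 (λ a b c → a :+ b :+ c
            := a :+ (b :+ (c :+ :0))) refl (expTerm x 0) (expTerm x 1) (expTerm x 2) ⟩
    expSum x 3
      ≤⟨ expSum≤exp 0≤x 3 ⟩
    exp x ∎
    where
    second : expTerm x 2 ≈ ½ * (x * x)
    second = *-cancelˡ-≈ 0<2 (begin-equality
      2# * expTerm x 2            ≈⟨ solve 1 (λ c → (:1 :+ :1) :* c
            := (:1 :+ (:1 :+ :0)) :* c) refl (expTerm x 2) ⟩
      derivative (expTerm x) 1    ≈⟨ derivative-expTerm x 1 ⟩
      x * expTerm x 1             ≈⟨ *-congˡ (expTerm-1 x) ⟩
      x * x                       ≈⟨ solve 1 (λ x → x :* x := :1 :* (x :* x)) refl _ ⟩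
      1# * (x * x)                ≈⟨ *-congʳ ½-double ⟨
      2# * ½ * (x * x)            ≈⟨ solve 2 (λ u x → (:1 :+ :1) :* u :* (x :* x)
            := (:1 :+ :1) :* (u :* (x :* x))) refl _ _ ⟩
      2# * (½ * (x * x))          ∎)

  1+x≤exp : ∀ x → 1# + x ≤ exp x
  1+x≤exp x with total 0# x
  ... | inj₁ 0≤x = begin
    1# + x                   ≤⟨ by-diff (*-nonNeg 0≤½ (square-nonNeg x))
        (solve 2 (λ u x → u :* (x :* x) := :1 :+ x :+ u :* (x :* x) :- (:1 :+ x)) refl _ _) ⟩
    1# + x + ½ * (x * x)     ≤⟨ 1+x+½x²≤exp 0≤x ⟩
    exp x                    ∎
  ... | inj₂ x≤0 = begin
    1# + x                                  ≈⟨ solve 1 (λ x → :1 :+ x := (:1 :+ x) :* :1) refl _ ⟩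
    (1# + x) * 1#                           ≈⟨ *-congˡ (exp-inverse x) ⟨
    (1# + x) * (exp x * exp (- x))
      ≈⟨ solve 3 (λ p q x → (:1 :+ x) :* (p :* q)
          := p :* ((:1 :- :- x) :* q)) refl (exp x) (exp (- x)) x ⟩
    exp x * ((1# - - x) * exp (- x))        ≤⟨ *-monoˡ-≤ (exp-nonNeg x) bound ⟩
    exp x * 1#                              ≈⟨ solve 1 (λ p → p :* :1 := p) refl (exp x) ⟩
    exp x                                   ∎
    where
    0≤-x : 0# ≤ - x
    0≤-x = by-diff (diff x≤0) (solve 1 (λ x → :0 :- x := :- x :- :0) refl _)
    bound : (1# - - x) * exp (- x) ≤ 1#
    bound = lim-mono-≤ (0 , λ n _ → 1-x*expSum≤1 0≤-x n)
      (lim-* (lim-const (1# - - x)) (exp-hasSum (- x))) (lim-const 1#)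

  exp-mono-≤ : x ≤ y → exp x ≤ exp y
  exp-mono-≤ {x} {y} x≤y = begin
    exp x                     ≈⟨ solve 1 (λ p → p := p :* :1) refl (exp x) ⟩
    exp x * 1#                ≤⟨ *-monoˡ-≤ (exp-nonNeg x) (1≤exp (diff x≤y)) ⟩
    exp x * exp (y - x)       ≈⟨ exp-+ x (y - x) ⟨
    exp (x + (y - x))         ≈⟨ exp-cong (solve 2 (λ x y → x :+ (y :- x) := y) refl _ _) ⟩
    exp y                     ∎

  exp-^ : ∀ n x → exp x ^ n ≈ exp (fromℕ n * x)
  exp-^ zero    x = trans (sym exp-0) (exp-cong (solve 1 (λ x → :0 := :0 :* x) refl _))
  exp-^ (suc n) x = begin-equality
    exp x * exp x ^ n            ≈⟨ *-congˡ (exp-^ n x) ⟩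
    exp x * exp (fromℕ n * x)    ≈⟨ exp-+ x (fromℕ n * x) ⟨
    exp (x + fromℕ n * x)        ≈⟨ exp-cong (solve 2 (λ x u → x :+ u :* x := (:1 :+ u) :* x) refl _ _) ⟩
    exp (fromℕ (suc n) * x)      ∎

  exp-tangent : ∀ x y → exp x * (1# + (y - x)) ≤ exp y
  exp-tangent x y = begin
    exp x * (1# + (y - x))    ≤⟨ *-monoˡ-≤ (exp-nonNeg x) (1+x≤exp (y - x)) ⟩
    exp x * exp (y - x)       ≈⟨ exp-+ x (y - x) ⟨
    exp (x + (y - x))         ≈⟨ exp-cong (solve 2 (λ x y → x :+ (y :- x) := y) refl _ _) ⟩
    exp y                     ∎

  -- The tangent at the weighted mean `w` lies below exp, and averaging its values at x and y
  -- returns exp w.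
  exp-convex : 0# ≤ a → a ≤ 1# → exp (a * x + (1# - a) * y) ≤ a * exp x + (1# - a) * exp y
  exp-convex {a} {x} {y} 0≤a a≤1 = begin
    exp w
      ≈⟨ solve 4 (λ c a x y → c
            := a :* (c :* (:1 :+ (x :- (a :* x :+ (:1 :- a) :* y))))
               :+ (:1 :- a) :* (c :* (:1 :+ (y :- (a :* x :+ (:1 :- a) :* y)))))
            refl (exp w) a x y ⟩
    a * (exp w * (1# + (x - w))) + (1# - a) * (exp w * (1# + (y - w)))
      ≤⟨ +-mono-≤ (*-monoˡ-≤ 0≤a (exp-tangent w x)) (*-monoˡ-≤ (diff a≤1) (exp-tangent w y)) ⟩
    a * exp x + (1# - a) * exp y ∎
    where
    w = a * x + (1# - a) * y

  -- Poisson domination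

  shift : (ℕ → Carrier) → ℕ → Carrier
  shift f zero    = 0#
  shift f (suc n) = f n

  -- Multiplication of the generating function by 1 - p + p z: an independent Bernoulli variable is
  -- added.
  bernoulli : Carrier → (ℕ → Carrier) → ℕ → Carrier
  bernoulli p f n = (1# - p) * f n + p * shift f n

  -- The distribution of the sum of independent Bernoulli variables with
  -- parameters ps and a Poisson variable with parameter r, multiplied by exp r.
  pmf : Carrier → List Carrier → ℕ → Carrier
  pmf r = foldr bernoulli (expTerm r)

  mean : Carrier → List Carrier → Carrier
  mean r = foldr _+_ r

  -- As a partial sum this is the mass strictly below its argument, so the event of being at most j
  -- is measured at `suc j`.
  cdf : Carrier → List Carrier → ℕ → Carrier
  cdf r ps = psum (pmf r ps)

  IsProbability : Carrier → Set
  IsProbability p = (0# ≤ p) × (p ≤ 1#)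

  private
    variable
      p r : Carrier
      ps : List Carrier

  shift-cong : (∀ n → f n ≈ g n) → ∀ n → shift f n ≈ shift g n
  shift-cong f≈g zero    = refl
  shift-cong f≈g (suc n) = f≈g n

  bernoulli-cong : (∀ n → f n ≈ g n) → ∀ n → bernoulli p f n ≈ bernoulli p g n
  bernoulli-cong f≈g n = +-cong (*-congˡ (f≈g n)) (*-congˡ (shift-cong f≈g n))

  bernoulli-nonNeg : IsProbability p → (∀ n → 0# ≤ f n) → ∀ n → 0# ≤ bernoulli p f n
  bernoulli-nonNeg {p} {f} (0≤p , p≤1) 0≤f n =
    +-nonNeg (*-nonNeg (diff p≤1) (0≤f n)) (*-nonNeg 0≤p (shift-nonNeg n))
    where
    shift-nonNeg : ∀ n → 0# ≤ shift f n
    shift-nonNeg zero    = ≤-refl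
    shift-nonNeg (suc n) = 0≤f n

  pmf-nonNeg : 0# ≤ r → All IsProbability ps → ∀ n → 0# ≤ pmf r ps n
  pmf-nonNeg 0≤r []         = expTerm-nonNeg 0≤r
  pmf-nonNeg 0≤r (0≤p≤1 ∷ a) = bernoulli-nonNeg 0≤p≤1 (pmf-nonNeg 0≤r a)

  bernoulli-linear : ∀ p c f g n →
    bernoulli p (λ i → c * f i + g i) n ≈ c * bernoulli p f n + bernoulli p g n
  bernoulli-linear p c f g n = begin-equality
    (1# - p) * (c * f n + g n) + p * shift (λ i → c * f i + g i) n
      ≈⟨ +-congˡ (*-congˡ (shift-linear n)) ⟩
    (1# - p) * (c * f n + g n) + p * (c * shift f n + shift g n)
      ≈⟨ solve 6 (λ p c u v w q → (:1 :- p) :* (c :* u :+ v) :+ p :* (c :* w :+ q)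
            := c :* ((:1 :- p) :* u :+ p :* w) :+ ((:1 :- p) :* v :+ p :* q)) refl _ _ _ _ _ _ ⟩
    c * bernoulli p f n + bernoulli p g n ∎
    where
    shift-linear : ∀ n → shift (λ i → c * f i + g i) n ≈ c * shift f n + shift g n
    shift-linear zero    = solve 1 (λ c → :0 := c :* :0 :+ :0) refl _
    shift-linear (suc n) = refl

  -- Multiplication of the generating function by 1 - z, which explains why it commutes with
  -- `bernoulli`.
  increment : (ℕ → Carrier) → ℕ → Carrier
  increment f n = f n - shift f n

  bernoulli-increment : ∀ p f n → bernoulli p (increment f) n ≈ increment (bernoulli p f) n
  bernoulli-increment p f zero    =
      solve 2 (λ p u → (:1 :- p) :* (u :- :0) :+ p :* :0 := (:1 :- p) :* u :+ p :* :0 :- :0) refl _ _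
  bernoulli-increment p f (suc n) =
      solve 4 (λ p u v w → (:1 :- p) :* (u :- v) :+ p :* (v :- w)
        := (:1 :- p) :* u :+ p :* v :- ((:1 :- p) :* v :+ p :* w)) refl _ _ _ _

  foldr-bernoulli-linear : ∀ qs c f g n →
    foldr bernoulli (λ i → c * f i + g i) qs n ≈ c * foldr bernoulli f qs n + foldr bernoulli g qs n
  foldr-bernoulli-linear []       c f g n = refl
  foldr-bernoulli-linear (q ∷ qs) c f g n = trans
    (bernoulli-cong (foldr-bernoulli-linear qs c f g) n)
    (bernoulli-linear q c (foldr bernoulli f qs) (foldr bernoulli g qs) n)

  foldr-bernoulli-increment : ∀ qs f n →
    foldr bernoulli (increment f) qs n ≈ increment (foldr bernoulli f qs) n
  foldr-bernoulli-increment []       f n = refl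
  foldr-bernoulli-increment (q ∷ qs) f n = trans
    (bernoulli-cong (foldr-bernoulli-increment qs f) n)
    (bernoulli-increment q (foldr bernoulli f qs) n)

  -- The sum over i of pᵢ² times the increment of the distribution that omits pᵢ.
  correction : Carrier → List Carrier → ℕ → Carrier
  correction r []       n = 0#
  correction r (p ∷ ps) n = p * p * increment (pmf r ps) n + bernoulli p (correction r ps) n

  -- The derivative of the factor 1 - p + p z is p = p (1 - p + p z) + p² (1 - z). In the product
  -- rule the first part restores the whole law and, together with r from e^(r z), adds up to the
  -- mean; the second part contributes p² times the increment of the law without that factor.
  derivative-pmf : ∀ r ps n →
    derivative (pmf r ps) n ≈ mean r ps * pmf r ps n + correction r ps n
  derivative-pmf r []       n = trans (derivative-expTerm r n) (sym (+-identityʳ _))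
  derivative-pmf r (p ∷ ps) n = begin-equality
    derivative (bernoulli p tail) n
      ≈⟨ commute n ⟩
    bernoulli p (derivative tail) n + p * tail n
      ≈⟨ +-congʳ (bernoulli-cong (derivative-pmf r ps) n) ⟩
    bernoulli p (λ i → μ * tail i + correction r ps i) n + p * tail n
      ≈⟨ +-congʳ (bernoulli-linear p μ tail (correction r ps) n) ⟩
    μ * bernoulli p tail n + bernoulli p (correction r ps) n + p * tail n
      ≈⟨ rearrange (tail n) (shift tail n) (bernoulli p (correction r ps) n) ⟩
    (p + μ) * bernoulli p tail n + (p * p * increment tail n + bernoulli p (correction r ps) n) ∎
    where
    tail = pmf r ps
    μ = mean r ps
    commute : ∀ n → derivative (bernoulli p tail) n ≈ bernoulli p (derivative tail) n + p * tail n
    commute zero    = solve 3 (λ p u v → (:1 :+ :0) :* ((:1 :- p) :* u :+ p :* v)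
          := (:1 :- p) :* ((:1 :+ :0) :* u) :+ p :* :0 :+ p :* v) refl _ _ _
    commute (suc n) = solve 4 (λ u p v w → (:1 :+ (:1 :+ u)) :* ((:1 :- p) :* v :+ p :* w)
          := (:1 :- p) :* ((:1 :+ (:1 :+ u)) :* v) :+ p :* ((:1 :+ u) :* w) :+ p :* w) refl _ _ _ _
    rearrange : ∀ u v w → μ * ((1# - p) * u + p * v) + w + p * u ≈
                (p + μ) * ((1# - p) * u + p * v) + (p * p * (u - v) + w)
    rearrange u v w = solve 5 (λ q p u v w → q :* ((:1 :- p) :* u :+ p :* v) :+ w :+ p :* u
          := (p :+ q) :* ((:1 :- p) :* u :+ p :* v) :+ (p :* p :* (u :- v) :+ w)) refl _ _ _ _ _

  mean-insert : ∀ r qs p ps → mean r (qs ++ p ∷ ps) ≈ p + mean r (qs ++ ps)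
  mean-insert r []       p ps = refl
  mean-insert r (q ∷ qs) p ps = trans (+-congˡ (mean-insert r qs p ps))
      (solve 3 (λ q p u → q :+ (p :+ u) := p :+ (q :+ u)) refl _ _ _)

  -- In the recursion a summand sits under the `bernoulli` operators of all earlier parameters. `go`
  -- collects these in `before` and commutes them past the increment, so that each summand becomes
  -- an increment of the law with a single parameter omitted.
  correction-nonNeg : ∀ r m ps →
    (∀ qs p rs → qs ++ p ∷ rs ≡ ps → 0# ≤ increment (pmf r (qs ++ rs)) m) →
    0# ≤ correction r ps m
  correction-nonNeg r m ps increments = go [] ps λ qs p rs → increments qs p rs
    where
    go : ∀ before ps → (∀ qs p rs → qs ++ p ∷ rs ≡ before ++ ps → 0# ≤ increment (pmf r (qs ++ rs)) m) →
         0# ≤ foldr bernoulli (correction r ps) before m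
    go before []       incs = ≤-reflexive (sym (foldr-bernoulli-0 before m))
      where
      foldr-bernoulli-0 : ∀ qs n → foldr bernoulli (λ _ → 0#) qs n ≈ 0#
      foldr-bernoulli-0 []       n = refl
      foldr-bernoulli-0 (q ∷ qs) n = trans (bernoulli-cong (foldr-bernoulli-0 qs) n) (bernoulli-0 n)
        where
        bernoulli-0 : ∀ n → bernoulli q (λ _ → 0#) n ≈ 0#
        bernoulli-0 zero    = solve 1 (λ q → (:1 :- q) :* :0 :+ q :* :0 := :0) refl _
        bernoulli-0 (suc n) = solve 1 (λ q → (:1 :- q) :* :0 :+ q :* :0 := :0) refl _
    go before (p ∷ ps) incs = begin
      0#
        ≤⟨ +-nonNeg (*-nonNeg (square-nonNeg p) (incs before p ps ≡.refl)) (go (before ++ p ∷ []) ps λ qs q rs eq →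
             incs qs q rs (≡.trans eq (List.++-assoc before (p ∷ []) ps))) ⟩
      p * p * increment (pmf r (before ++ ps)) m + foldr bernoulli (correction r ps) (before ++ p ∷ []) m
        ≡⟨ ≡.cong₂ (λ u v → p * p * increment u m + v m) (List.foldr-++ bernoulli (expTerm r) before ps)
             (List.foldr-++ bernoulli (correction r ps) before (p ∷ [])) ⟩
      p * p * increment (foldr bernoulli (pmf r ps) before) m + foldr bernoulli (bernoulli p (correction r ps)) before m
        ≈⟨ +-congʳ (*-congˡ (foldr-bernoulli-increment before (pmf r ps) m)) ⟨
      p * p * foldr bernoulli (increment (pmf r ps)) before m + foldr bernoulli (bernoulli p (correction r ps)) before m
        ≈⟨ foldr-bernoulli-linear before (p * p) (increment (pmf r ps)) (bernoulli p (correction r ps)) m ⟨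
      foldr bernoulli (correction r (p ∷ ps)) before m ∎

  -- The corrections in derivative-pmf involve sums with one summand less, which makes induction work.
  increment-nonNeg : 0# ≤ r → ∀ N ps → length ps ≡ N → All IsProbability ps →
                     ∀ n → fromℕ n ≤ mean r ps → 0# ≤ increment (pmf r ps) n
  increment-nonNeg {r} 0≤r N ps |ps|≡N 0≤ps≤1 zero n≤μ =
    by-diff (pmf-nonNeg 0≤r 0≤ps≤1 0) (solve 1 (λ u → u := u :- :0 :- :0) refl (pmf r ps 0))
  increment-nonNeg {r} 0≤r N ps |ps|≡N 0≤ps≤1 (suc n) n<μ =
    diff (*-cancelˡ-≤ (fromℕ-suc-positive n) (begin
      fromℕ (suc n) * F n                      ≤⟨ *-monoʳ-≤ (pmf-nonNeg 0≤r 0≤ps≤1 n) n<μ ⟩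
      mean r ps * F n                          ≈⟨ +-identityʳ _ ⟨
      mean r ps * F n + 0#                     ≤⟨ +-mono-≤ ≤-refl (correction-nonNeg r n ps (smaller N |ps|≡N)) ⟩
      mean r ps * F n + correction r ps n      ≈⟨ derivative-pmf r ps n ⟨
      fromℕ (suc n) * F (suc n)                ∎))
    where
    F : ℕ → Carrier
    F = pmf r ps
    smaller : ∀ N → length ps ≡ N →
              ∀ qs p rs → qs ++ p ∷ rs ≡ ps → 0# ≤ increment (pmf r (qs ++ rs)) n
    smaller zero    |ps|≡0 qs p rs ≡.refl =
      ⊥-elim (ℕ.1+n≢0 (≡.trans (≡.sym (List.length-++-sucʳ qs p rs)) |ps|≡0))
    smaller (suc N) |ps|≡N+1 qs p rs ≡.refl =
      increment-nonNeg 0≤r N (qs ++ rs)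
        (ℕ.suc-injective (≡.trans (≡.sym (List.length-++-sucʳ qs p rs)) |ps|≡N+1))
        (All.++⁺ (All.++⁻ˡ qs 0≤ps≤1) (All.tail (All.++⁻ʳ qs 0≤ps≤1)))
        -- Omitting a parameter p ≤ 1 lowers the mean by at most 1, just as the bound drops from
        -- `suc n` to `n`.
        n (by-diff (+-nonNeg (diff (≤-trans n<μ (≤-reflexive (mean-insert r qs p rs))))
                             (diff (proj₂ (All.head (All.++⁻ʳ qs 0≤ps≤1)))))
                   (solve 3 (λ c μ p → p :+ μ :- (:1 :+ c) :+ (:1 :- p)
                         := μ :- c) refl (fromℕ n) (mean r (qs ++ rs)) p))

  psum-bernoulli : ∀ p f k →
    psum (bernoulli p f) k ≈ (1# - p) * psum f k + p * psum f (k ∸ 1)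
  psum-bernoulli p f k = begin-equality
    psum (bernoulli p f) k
      ≈⟨ psum-+ (λ i → (1# - p) * f i) (λ i → p * shift f i) k ⟩
    psum (λ i → (1# - p) * f i) k + psum (λ i → p * shift f i) k
      ≈⟨ +-cong (psum-* (1# - p) f k) (psum-* p (shift f) k) ⟩
    (1# - p) * psum f k + p * psum (shift f) k
      ≈⟨ +-congˡ (*-congˡ (psum-shift k)) ⟩
    (1# - p) * psum f k + p * psum f (k ∸ 1) ∎
    where
    psum-shift : ∀ k → psum (shift f) k ≈ psum f (k ∸ 1)
    psum-shift zero    = refl
    psum-shift (suc k) = CommutativeRing.+-identityˡ commutativeRing _

  -- The sum over i < k of f i * G (k ∸ i).
  mix : (ℕ → Carrier) → (ℕ → Carrier) → ℕ → Carrier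
  mix f G zero    = 0#
  mix f G (suc k) = f 0 * G (suc k) + mix (f ∘ suc) G k

  mix-cong : ∀ {G H} → (∀ n → G n ≈ H n) → ∀ f k → mix f G k ≈ mix f H k
  mix-cong G≈H f zero    = refl
  mix-cong G≈H f (suc k) = +-cong (*-congˡ (G≈H (suc k))) (mix-cong G≈H (f ∘ suc) k)

  psum-conv : ∀ f g k → psum (conv f g) k ≈ mix f (psum g) k
  psum-conv f g zero    = refl
  psum-conv f g (suc k) = trans (psum-conv-suc f g k) (+-congˡ (psum-conv (f ∘ suc) g k))

  -- Adding a Bernoulli variable commutes with averaging. At k = 1 a term with G 0 appears on the
  -- left that the empty `mix f G 0` lacks, hence the hypothesis on G 0.
  mix-bernoulli : ∀ p f {G} → G 0 ≈ 0# → ∀ k →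
    mix f (λ i → (1# - p) * G i + p * G (i ∸ 1)) k ≈ (1# - p) * mix f G k + p * mix f G (k ∸ 1)
  mix-bernoulli p f G0≈0 zero = solve 1 (λ p → :0 := (:1 :- p) :* :0 :+ p :* :0) refl _
  mix-bernoulli p f {G} G0≈0 (suc zero) = begin-equality
    f 0 * ((1# - p) * G 1 + p * G 0) + 0#      ≈⟨ +-congʳ (*-congˡ (+-congˡ (*-congˡ G0≈0))) ⟩
    f 0 * ((1# - p) * G 1 + p * 0#) + 0#
      ≈⟨ solve 3 (λ u p v → u :* ((:1 :- p) :* v :+ p :* :0) :+ :0
          := (:1 :- p) :* (u :* v :+ :0) :+ p :* :0) refl _ _ _ ⟩
    (1# - p) * (f 0 * G 1 + 0#) + p * 0#       ∎
  mix-bernoulli p f {G} G0≈0 (suc (suc k)) =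
    trans (+-congˡ (mix-bernoulli p (f ∘ suc) {G} G0≈0 (suc k)))
          (solve 6 (λ u v w y z p → u :* ((:1 :- p) :* v :+ p :* w) :+ ((:1 :- p) :* y :+ p :* z)
                := (:1 :- p) :* (u :* v :+ y) :+ p :* (u :* w :+ z))
                refl (f 0) (G (suc (suc k))) (G (suc k)) (mix (f ∘ suc) G (suc k)) (mix (f ∘ suc) G k) p)

  -- A Poisson variable with parameter p + r is the sum of independent ones with parameters p and r;
  -- the right side conditions on the first. The weights `expTerm p` are unnormalised, in accordance
  -- with the factor exp (p + r) inside `pmf`.
  cdf-Poisson-+ : ∀ p r ps k → cdf (p + r) ps k ≈ mix (expTerm p) (cdf r ps) k
  cdf-Poisson-+ p r []       k = trans (sym (expSum-+ p r k)) (psum-conv (expTerm p) (expTerm r) k)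
  cdf-Poisson-+ p r (q ∷ ps) k = begin-equality
    cdf (p + r) (q ∷ ps) k
      ≈⟨ psum-bernoulli q (pmf (p + r) ps) k ⟩
    (1# - q) * cdf (p + r) ps k + q * cdf (p + r) ps (k ∸ 1)
      ≈⟨ +-cong (*-congˡ (cdf-Poisson-+ p r ps k)) (*-congˡ (cdf-Poisson-+ p r ps (k ∸ 1))) ⟩
    (1# - q) * mix (expTerm p) (cdf r ps) k + q * mix (expTerm p) (cdf r ps) (k ∸ 1)
      ≈⟨ mix-bernoulli q (expTerm p) {cdf r ps} refl k ⟨
    mix (expTerm p) (λ i → (1# - q) * cdf r ps i + q * cdf r ps (i ∸ 1)) k
      ≈⟨ mix-cong (λ i → psum-bernoulli q (pmf r ps) i) (expTerm p) k ⟨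
    mix (expTerm p) (cdf r (q ∷ ps)) k ∎

  -- Beyond i = k the line is at most G 0 ≈ 0, so further terms only lower the left side. It may
  -- therefore run over arbitrarily many Poisson weights, which prepares the limit.
  mix-lower-bound : ∀ {f G} → (∀ n → 0# ≤ f n) → G 0 ≈ 0# → ∀ k c d →
    (∀ i → c - fromℕ i * d ≤ G (k ∸ i)) → ∀ m →
    psum (λ i → f i * (c - fromℕ i * d)) (k ℕ.+ m) ≤ mix f G k
  mix-lower-bound {f} {G} 0≤f G0≈0 zero c d line≤G m = begin
    psum (λ i → f i * (c - fromℕ i * d)) m   ≤⟨ psum-mono-≤ (λ i → *-monoˡ-≤ (0≤f i) (line≤0 i)) m ⟩
    psum (λ i → f i * 0#) m                  ≈⟨ psum-cong (λ i → CommutativeRing.zeroʳ commutativeRing (f i)) m ⟩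
    psum (λ _ → 0#) m                        ≈⟨ psum-0 m ⟩
    0#                                       ∎
    where
    line≤0 : ∀ i → c - fromℕ i * d ≤ 0#
    line≤0 i = begin
      c - fromℕ i * d   ≤⟨ line≤G i ⟩
      G (0 ∸ i)         ≡⟨ ≡.cong G (ℕ.0∸n≡0 i) ⟩
      G 0               ≈⟨ G0≈0 ⟩
      0#                ∎
  mix-lower-bound {f} {G} 0≤f G0≈0 (suc k) c d line≤G m = +-mono-≤
    (*-monoˡ-≤ (0≤f 0) (line≤G 0))
    (begin
      psum (λ i → f (suc i) * (c - fromℕ (suc i) * d)) (k ℕ.+ m)
        ≈⟨ psum-cong (λ i → *-congˡ {f (suc i)} (peel (fromℕ i))) (k ℕ.+ m) ⟩
      psum (λ i → f (suc i) * (c - d - fromℕ i * d)) (k ℕ.+ m)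
        ≤⟨ mix-lower-bound (0≤f ∘ suc) G0≈0 k (c - d) d
             (λ i → ≤-trans (≤-reflexive (sym (peel (fromℕ i)))) (line≤G (suc i))) m ⟩
      mix (f ∘ suc) G k ∎)
    where
    peel : ∀ i → c - (1# + i) * d ≈ c - d - i * d
    peel i = solve 3 (λ c i d → c :- (:1 :+ i) :* d := c :- d :- i :* d) refl _ _ _

  -- A truncated form of the Poisson mean: i e_i = p e_(i-1), whence the second partial sum is one
  -- term shorter.
  psum-expTerm-line : ∀ p c d m →
    psum (λ i → expTerm p i * (c - fromℕ i * d)) (suc m) ≈ c * expSum p (suc m) - p * d * expSum p m
  psum-expTerm-line p c d m = begin-equality
    psum (λ i → e i * (c - fromℕ i * d)) (suc m)
      ≈⟨ psum-cong (λ i → solve 4 (λ u i c d → u :* (c :- i :* d)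
            := c :* u :+ :- d :* (i :* u)) refl (e i) (fromℕ i) c d) (suc m) ⟩
    psum (λ i → c * e i + - d * (fromℕ i * e i)) (suc m)
      ≈⟨ psum-+ (λ i → c * e i) (λ i → - d * (fromℕ i * e i)) (suc m) ⟩
    psum (λ i → c * e i) (suc m) + psum (λ i → - d * (fromℕ i * e i)) (suc m)
      ≈⟨ +-cong (psum-* c e (suc m)) (psum-* (- d) (λ i → fromℕ i * e i) (suc m)) ⟩
    c * expSum p (suc m) + - d * (0# * e 0 + psum (derivative e) m)
      ≈⟨ +-congˡ (*-congˡ (+-congˡ (trans (psum-cong (derivative-expTerm p) m) (psum-* p e m)))) ⟩
    c * expSum p (suc m) + - d * (0# * e 0 + p * expSum p m)
      ≈⟨ solve 6 (λ u v w c d p → c :* u :+ :- d :* (:0 :* w :+ p :* v)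
            := c :* u :- p :* d :* v) refl (expSum p (suc m)) (expSum p m) (e 0) c d p ⟩
    c * expSum p (suc m) - p * d * expSum p m ∎
    where
    e = expTerm p

  pmf-monotone : 0# ≤ r → All IsProbability ps → ∀ m n → m ℕ.≤′ n → fromℕ n ≤ mean r ps →
                 pmf r ps m ≤ pmf r ps n
  pmf-monotone 0≤r 0≤ps≤1 m n       ℕ.≤′-refl        n≤μ = ≤-refl
  pmf-monotone {ps = ps} 0≤r 0≤ps≤1 m (suc n) (ℕ.≤′-step m≤′n) n<μ = ≤-trans
    (pmf-monotone 0≤r 0≤ps≤1 m n m≤′n (≤-trans (fromℕ-mono-≤ (ℕ.n≤1+n n)) n<μ))
    (by-diff (increment-nonNeg 0≤r _ ps ≡.refl 0≤ps≤1 (suc n) n<μ) refl)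

  -- Below the mode the distribution function is convex.
  cdf-above-line : 0# ≤ r → All IsProbability ps → fromℕ k ≤ mean r ps →
    ∀ i → cdf r ps (suc k) - fromℕ i * pmf r ps k ≤ cdf r ps (suc k ∸ i)
  cdf-above-line {r} {ps} {k} 0≤r 0≤ps≤1 k≤μ zero    = ≤-reflexive
      (solve 2 (λ u v → u :- :0 :* v := u) refl (cdf r ps (suc k)) (pmf r ps k))
  cdf-above-line {r} {ps} {k} 0≤r 0≤ps≤1 k≤μ (suc i) = begin
    C - fromℕ (suc i) * δ
      ≈⟨ solve 3 (λ c i d → c :- (:1 :+ i) :* d := c :- i :* d :- d) refl C (fromℕ i) δ ⟩
    C - fromℕ i * δ - δ                ≤⟨ +-monoˡ-≤ (- δ) (cdf-above-line {k = k} 0≤r 0≤ps≤1 k≤μ i) ⟩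
    cdf r ps (suc k ∸ i) - δ           ≤⟨ below (suc k ∸ i) (ℕ.m∸n≤m (suc k) i) ⟩
    cdf r ps (ℕ.pred (suc k ∸ i))      ≡⟨ ≡.cong (cdf r ps) (ℕ.pred[m∸n]≡m∸[1+n] (suc k) i) ⟩
    cdf r ps (k ∸ i)                   ∎
    where
    C = cdf r ps (suc k)
    δ = pmf r ps k
    below : ∀ n → n ℕ.≤ suc k → cdf r ps n - δ ≤ cdf r ps (ℕ.pred n)
    -- Once the truncated argument has reached 0 it stays there, while the line keeps falling.
    below zero    _           = by-diff (pmf-nonNeg 0≤r 0≤ps≤1 k)
        (solve 1 (λ δ → δ := :0 :- (:0 :- δ)) refl δ)
    below (suc n) (s≤s n≤k) = begin
      cdf r ps (suc n) - δ           ≈⟨ +-congʳ (psum-suc (pmf r ps) n) ⟩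
      cdf r ps n + pmf r ps n - δ    ≤⟨ by-diff (diff (pmf-monotone 0≤r 0≤ps≤1 n k (ℕ.≤⇒≤′ n≤k) k≤μ))
          (solve 3 (λ u v w → w :- v := u :- (u :+ v :- w)) refl (cdf r ps n) (pmf r ps n) δ) ⟩
      cdf r ps n                     ∎

  -- Both sides average the distribution function of the rest at `suc k ∸ i`. The line C - i δ
  -- agrees with it at i = 0 and i = 1, so the Bernoulli average is exactly the value C - p δ of the
  -- line at the mean p; under Poisson weights of the same mean the line is a lower bound.
  Bernoulli≤Poisson : 0# ≤ r → 0# ≤ p → All IsProbability ps → fromℕ k ≤ mean r ps →
    exp p * cdf r (p ∷ ps) (suc k) ≤ cdf (p + r) ps (suc k)
  Bernoulli≤Poisson {r} {p} {ps} {k} 0≤r 0≤p 0≤ps≤1 k≤μ = begin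
    exp p * cdf r (p ∷ ps) (suc k)
      ≈⟨ *-congˡ (trans (psum-bernoulli p (pmf r ps) (suc k)) last-term) ⟩
    exp p * (C - p * δ)
      ≤⟨ lim-mono-≤ (suc k , partial) (lim-* (exp-hasSum p) (lim-const (C - p * δ))) (lim-const _) ⟩
    mix (expTerm p) (cdf r ps) (suc k)
      ≈⟨ cdf-Poisson-+ p r ps (suc k) ⟨
    cdf (p + r) ps (suc k) ∎
    where
    C = cdf r ps (suc k)
    δ = pmf r ps k
    last-term : (1# - p) * cdf r ps (suc k) + p * cdf r ps k ≈ C - p * δ
    last-term = begin-equality
      (1# - p) * cdf r ps (suc k) + p * cdf r ps k
        ≈⟨ solve 3 (λ u v p → (:1 :- p) :* u :+ p :* v
            := u :- p :* (u :- v)) refl (cdf r ps (suc k)) (cdf r ps k) p ⟩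
      cdf r ps (suc k) - p * (cdf r ps (suc k) - cdf r ps k)  ≈⟨ +-congˡ (-‿cong (*-congˡ (trans (+-congʳ (psum-suc (pmf r ps) k))
          (solve 2 (λ u v → u :+ v :- u := v) refl (cdf r ps k) δ)))) ⟩
      C - p * δ                                          ∎
    partial′ : ∀ m → expSum p (suc k ℕ.+ m) * (C - p * δ) ≤ mix (expTerm p) (cdf r ps) (suc k)
    partial′ m = begin
      E′ * (C - p * δ)
        -- The two partial sums differ by one term; exchanging E for the larger E′ under the minus
        -- sign only lowers the value.
        ≤⟨ by-diff (*-nonNeg (*-nonNeg 0≤p (pmf-nonNeg 0≤r 0≤ps≤1 k))
                             (diff (psum-≤-suc (expTerm-nonNeg 0≤p) (k ℕ.+ m))))
                                 (solve 5 (λ C δ E E′ p → p :* δ :* (E′ :- E)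
                                   := C :* E′ :- p :* δ :* E :- E′ :* (C :- p :* δ)) refl C δ E E′ p) ⟩
      C * E′ - p * δ * E
        ≈⟨ psum-expTerm-line p C δ (k ℕ.+ m) ⟨
      psum (λ i → expTerm p i * (C - fromℕ i * δ)) (suc k ℕ.+ m)
        ≤⟨ mix-lower-bound (expTerm-nonNeg 0≤p) refl (suc k) C δ (cdf-above-line {k = k} 0≤r 0≤ps≤1 k≤μ) m ⟩
      mix (expTerm p) (cdf r ps) (suc k) ∎
      where
      E E′ : Carrier
      E  = expSum p (k ℕ.+ m)
      E′ = expSum p (suc k ℕ.+ m)
    partial : ∀ n → suc k ℕ.≤ n → expSum p n * (C - p * δ) ≤ mix (expTerm p) (cdf r ps) (suc k)
    partial n k<n = ≡.subst (λ n → expSum p n * (C - p * δ) ≤ _) (ℕ.m+[n∸m]≡n k<n) (partial′ (n ∸ suc k))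

  mean-+ : ∀ p r ps → mean (p + r) ps ≈ p + mean r ps
  mean-+ p r []       = refl
  mean-+ p r (q ∷ ps) = trans (+-congˡ (mean-+ p r ps))
      (solve 3 (λ q p u → q :+ (p :+ u) := p :+ (q :+ u)) refl _ _ _)

  -- Each step moves one parameter from the list into `r` and preserves the total mean. The rest has
  -- mean at least k since the removed parameter is at most 1. The factor exp (mean of `ps`)
  -- balances the normalisations: the left law carries exp r, the Poisson law on the right exp (mean
  -- r ps).
  Poisson-domination : 0# ≤ r → All IsProbability ps → fromℕ (suc k) ≤ mean r ps →
    exp (mean 0# ps) * cdf r ps (suc k) ≤ expSum (mean r ps) (suc k)
  Poisson-domination {r} {[]} {k} 0≤r [] k<μ = ≤-reflexive (begin-equality
    exp 0# * expSum r (suc k)    ≈⟨ *-congʳ exp-0 ⟩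
    1# * expSum r (suc k)        ≈⟨ CommutativeRing.*-identityˡ commutativeRing _ ⟩
    expSum r (suc k)             ∎)
  Poisson-domination {r} {p ∷ ps} {k} 0≤r ((0≤p , p≤1) ∷ 0≤ps≤1) k<μ = begin
    exp (p + mean 0# ps) * cdf r (p ∷ ps) (suc k)
      ≈⟨ *-congʳ (exp-+ p (mean 0# ps)) ⟩
    exp p * exp (mean 0# ps) * cdf r (p ∷ ps) (suc k)
      ≈⟨ solve 3 (λ u v w → u :* v :* w
            := v :* (u :* w)) refl (exp p) (exp (mean 0# ps)) (cdf r (p ∷ ps) (suc k)) ⟩
    exp (mean 0# ps) * (exp p * cdf r (p ∷ ps) (suc k))
      ≤⟨ *-monoˡ-≤ (exp-nonNeg (mean 0# ps)) (Bernoulli≤Poisson {k = k} 0≤r 0≤p 0≤ps≤1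
           (by-diff (+-nonNeg (diff k<μ) (diff p≤1))
               (solve 3 (λ c μ p → p :+ μ :- (:1 :+ c) :+ (:1 :- p)
                 := μ :- c) refl (fromℕ k) (mean r ps) p))) ⟩
    exp (mean 0# ps) * cdf (p + r) ps (suc k)
      ≤⟨ Poisson-domination {k = k} (+-nonNeg 0≤p 0≤r) 0≤ps≤1 (≤-trans k<μ (≤-reflexive (sym (mean-+ p r ps)))) ⟩
    expSum (mean (p + r) ps) (suc k)
      ≈⟨ psum-cong (expTerm-cong (mean-+ p r ps)) (suc k) ⟩
    expSum (p + mean r ps) (suc k) ∎

  -- Poisson tails

  square-cancel-≤ : 0# ≤ y → x * x ≤ y * y → x ≤ y
  square-cancel-≤ {y} {x} 0≤y x²≤y² with em {x ≤ y}
  ... | yes x≤y = x≤y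
  ... | no x≰y  = ⊥-elim (<⇒≱ (*-positive 0<x-y 0<x+y) (by-diff (diff x²≤y²)
      (solve 2 (λ y x → y :* y :- x :* x := :0 :- (x :- y) :* (x :+ y)) refl _ _)))
    where
    0<x-y : 0# < x - y
    0<x-y = diff-positive (≰⇒> x≰y)
    0<x+y : 0# < x + y
    0<x+y = begin-strict
      0#               <⟨ 0<x-y ⟩
      x - y            ≤⟨ by-diff (+-nonNeg 0≤y 0≤y)
          (solve 2 (λ y x → y :+ y := x :+ y :- (x :- y)) refl _ _) ⟩
      x + y            ∎

  -- Termwise x ^ i ≤ x ^ j for i ≤ j. The number of terms is separate from j so that the induction
  -- can keep the power fixed.
  expSum-*-≤ : 0# ≤ a → 1# ≤ x → ∀ j n → n ℕ.≤ suc j → expSum (a * x) n ≤ x ^ j * expSum a n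
  expSum-*-≤ {a} {x} 0≤a 1≤x j zero    _         = ≤-reflexive
      (solve 1 (λ u → :0 := u :* :0) refl (x ^ j))
  expSum-*-≤ {a} {x} 0≤a 1≤x j (suc n) (s≤s n≤j) = begin
    expSum (a * x) (suc n)
      ≈⟨ psum-suc (expTerm (a * x)) n ⟩
    expSum (a * x) n + expTerm (a * x) n
      ≤⟨ +-mono-≤ (expSum-*-≤ 0≤a 1≤x j n (ℕ.m≤n⇒m≤1+n n≤j)) term ⟩
    x ^ j * expSum a n + x ^ j * expTerm a n
      ≈⟨ solve 3 (λ u v w → u :* v :+ u :* w := u :* (v :+ w)) refl (x ^ j) (expSum a n) (expTerm a n) ⟩
    x ^ j * (expSum a n + expTerm a n)
      ≈⟨ *-congˡ (psum-suc (expTerm a) n) ⟨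
    x ^ j * expSum a (suc n) ∎
    where
    0≤x^ : ∀ i → 0# ≤ x ^ i
    0≤x^ i = ^-nonNeg i (≤-trans 0≤1 1≤x)
    grow : ∀ i → x ^ i ≤ x ^ suc i
    grow i = by-diff (*-nonNeg (diff 1≤x) (0≤x^ i))
        (solve 2 (λ u x → (x :- :1) :* u := x :* u :- u) refl (x ^ i) x)
    term : expTerm (a * x) n ≤ x ^ j * expTerm a n
    term = begin
      (a * x) ^ n / fromℕ (n !)            ≈⟨ *-congʳ (^-distrib-* n) ⟩
      a ^ n * x ^ n / fromℕ (n !)
        ≈⟨ solve 3 (λ u v w → u :* v :* w := v :* (u :* w)) refl (a ^ n) (x ^ n) (fromℕ (n !) ⁻¹) ⟩
      x ^ n * expTerm a n                  ≤⟨ *-monoʳ-≤ (expTerm-nonNeg 0≤a n) (stepwise-mono grow n≤j) ⟩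
      x ^ j * expTerm a n                  ∎

  -- With w = (y + y⁻¹) / 2 and z = (y - y⁻¹) / 2 one has z² = w² - 1, so that
  -- 1 + z + z² / 2 - y = (w - 1)² / 2.
  ≤exp-sinh : 1# ≤ y → y ≤ exp (½ * (y - y ⁻¹))
  ≤exp-sinh {y} 1≤y = begin
    y
      ≤⟨ by-diff (*-nonNeg 0≤½ (square-nonNeg (1# - ½ * (y + y ⁻¹)))) (begin-equality
           ½ * ((1# - ½ * (y + y ⁻¹)) * (1# - ½ * (y + y ⁻¹)))
             -- The identity holds modulo 2 * ½ ≈ 1 and y * y ⁻¹ ≈ 1. Two explicit multiples of
             -- these relations, the first with cofactor `A`, turn it into a polynomial identity and
             -- vanish in the next step.
             ≈⟨ solve 3 (λ h u i → h :* ((:1 :- h :* (u :+ i)) :* (:1 :- h :* (u :+ i)))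
                   := :1 :+ h :* (u :- i) :+ h :* (h :* (u :- i) :* (h :* (u :- i))) :- u
                      :+ ((:1 :+ :1) :* (h :* h) :+ h :+ :1 :- (h :+ :1) :* u :- h :* i) :* ((:1 :+ :1) :* h :- :1)
                      :+ (:1 :+ :1) :* (:1 :+ :1) :* (h :* h :* h) :* (u :* i :- :1))
                   refl ½ y (y ⁻¹) ⟩
           1# + sinh + ½ * (sinh * sinh) - y + A ½ y (y ⁻¹) * (2# * ½ - 1#) +
             (2# * 2#) * (½ * ½ * ½) * (y * y ⁻¹ - 1#)
             ≈⟨ +-cong (+-congˡ (*-congˡ (+-congʳ ½-double))) (*-congˡ (+-congʳ (⁻¹-inverse 0<y))) ⟩
           1# + sinh + ½ * (sinh * sinh) - y + A ½ y (y ⁻¹) * (1# - 1#) +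
             (2# * 2#) * (½ * ½ * ½) * (1# - 1#)
             ≈⟨ solve 3 (λ u v w → u :+ v :* (:1 :- :1) :+ w :* (:1 :- :1)
                   := u)
                   refl (1# + sinh + ½ * (sinh * sinh) - y) (A ½ y (y ⁻¹)) ((2# * 2#) * (½ * ½ * ½)) ⟩
           1# + sinh + ½ * (sinh * sinh) - y ∎) ⟩
    1# + sinh + ½ * (sinh * sinh)
      ≤⟨ 1+x+½x²≤exp (*-nonNeg 0≤½ (diff y⁻¹≤y)) ⟩
    exp sinh ∎
    where
    0<y : 0# < y
    0<y = begin-strict 0# <⟨ 0<1 ⟩ 1# ≤⟨ 1≤y ⟩ y ∎
    sinh : Carrier
    sinh = ½ * (y - y ⁻¹)
    y⁻¹≤y : y ⁻¹ ≤ y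
    y⁻¹≤y = begin
      y ⁻¹          ≈⟨ solve 1 (λ u → u := :1 :* u) refl _ ⟩
      1# * y ⁻¹     ≤⟨ *-monoʳ-≤ (⁻¹-nonNeg 0<y) 1≤y ⟩
      y * y ⁻¹      ≈⟨ ⁻¹-inverse 0<y ⟩
      1#            ≤⟨ 1≤y ⟩
      y             ∎
    A : Carrier → Carrier → Carrier → Carrier
    A h u i = 2# * (h * h) + h + 1# - (h + 1#) * u - h * i

  -- The integer m! times the sum of kⁱ / i! over i ≤ m. With denominators cleared, the numerical
  -- cases become closed inequalities between natural numbers.
  horner : ℕ → ℕ → ℕ
  horner k zero    = 1
  horner k (suc m) = suc m ℕ.* horner k m ℕ.+ k ℕ.^ suc m

  fromℕ-horner : ∀ k m → fromℕ (m !) * expSum (fromℕ k) (suc m) ≈ fromℕ (horner k m)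
  fromℕ-horner k zero = begin-equality
    fromℕ 1 * (expTerm (fromℕ k) 0 + 0#)    ≈⟨ *-congˡ (+-congʳ (expTerm-0 (fromℕ k))) ⟩
    fromℕ 1 * (1# + 0#)                     ≈⟨ solve 0 ((:1 :+ :0) :* (:1 :+ :0) := :1 :+ :0) refl ⟩
    fromℕ 1                                 ∎
  fromℕ-horner k (suc m) = begin-equality
    fromℕ (suc m !) * expSum K (suc (suc m))
      ≈⟨ *-congˡ (psum-suc (expTerm K) (suc m)) ⟩
    fromℕ (suc m !) * (expSum K (suc m) + expTerm K (suc m))
      ≈⟨ solve 3 (λ u v w → u :* (v :+ w)
            := u :* v :+ u :* w) refl (fromℕ (suc m !)) (expSum K (suc m)) (expTerm K (suc m)) ⟩
    fromℕ (suc m !) * expSum K (suc m) + fromℕ (suc m !) * expTerm K (suc m)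
      ≈⟨ +-cong (*-congʳ (fromℕ-* (suc m) (m !))) (!-*-expTerm K (suc m)) ⟩
    fromℕ (suc m) * fromℕ (m !) * expSum K (suc m) + K ^ suc m
      ≈⟨ +-cong (solve 3 (λ u v w → u :* v :* w
            := u :* (v :* w))
            refl (fromℕ (suc m)) (fromℕ (m !)) (expSum K (suc m))) (sym (fromℕ-^ k (suc m))) ⟩
    fromℕ (suc m) * (fromℕ (m !) * expSum K (suc m)) + fromℕ (k ℕ.^ suc m)
      ≈⟨ +-congʳ (*-congˡ (fromℕ-horner k m)) ⟩
    fromℕ (suc m) * fromℕ (horner k m) + fromℕ (k ℕ.^ suc m)
      ≈⟨ +-congʳ (fromℕ-* (suc m) (horner k m)) ⟨
    fromℕ (suc m ℕ.* horner k m) + fromℕ (k ℕ.^ suc m)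
      ≈⟨ fromℕ-+ (suc m ℕ.* horner k m) (k ℕ.^ suc m) ⟨
    fromℕ (horner k (suc m)) ∎
    where
    K = fromℕ k
  -- expSum ≤ (1 + N / D) ^ M ≤ exp (M * N / D) for the integers N, D, M.
  expSum≤exp-numeric : ∀ k j D M N {y} → 1 ℕ.≤ D →
    horner k j ℕ.* D ℕ.^ M ℕ.≤ j ! ℕ.* (D ℕ.+ N) ℕ.^ M →
    fromℕ M * fromℕ N ≤ fromℕ D * y →
    expSum (fromℕ k) (suc j) ≤ exp y
  expSum≤exp-numeric k j D M N {y} 1≤D numeric MN≤Dy =
    *-cancelˡ-≤ (*-positive (fromℕ-!-positive j) (^-positive M 0<D)) (begin
      J * δ ^ M * expSum (fromℕ k) (suc j)
        ≈⟨ solve 3 (λ u v w → u :* v :* w := u :* w :* v) refl J (δ ^ M) (expSum (fromℕ k) (suc j)) ⟩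
      J * expSum (fromℕ k) (suc j) * δ ^ M
        ≈⟨ *-cong (fromℕ-horner k j) (sym (fromℕ-^ D M)) ⟩
      fromℕ (horner k j) * fromℕ (D ℕ.^ M)
        ≈⟨ fromℕ-* (horner k j) (D ℕ.^ M) ⟨
      fromℕ (horner k j ℕ.* D ℕ.^ M)
        ≤⟨ fromℕ-mono-≤ numeric ⟩
      fromℕ (j ! ℕ.* (D ℕ.+ N) ℕ.^ M)
        ≈⟨ trans (fromℕ-* (j !) ((D ℕ.+ N) ℕ.^ M)) (*-congˡ (fromℕ-^ (D ℕ.+ N) M)) ⟩
      J * fromℕ (D ℕ.+ N) ^ M
        ≤⟨ *-monoˡ-≤ (proj₁ (fromℕ-!-positive j)) (^-mono-≤ M (fromℕ-nonNeg (D ℕ.+ N)) base) ⟩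
      J * (δ * exp (ν * δ ⁻¹)) ^ M
        ≈⟨ *-congˡ (^-distrib-* M) ⟩
      J * (δ ^ M * exp (ν * δ ⁻¹) ^ M)
        ≈⟨ solve 3 (λ u v w → u :* (v :* w) := u :* v :* w) refl J (δ ^ M) (exp (ν * δ ⁻¹) ^ M) ⟩
      J * δ ^ M * exp (ν * δ ⁻¹) ^ M
        ≈⟨ *-congˡ (exp-^ M (ν * δ ⁻¹)) ⟩
      J * δ ^ M * exp (fromℕ M * (ν * δ ⁻¹))
        ≤⟨ *-monoˡ-≤ (*-nonNeg (proj₁ (fromℕ-!-positive j)) (^-nonNeg M (proj₁ 0<D))) (exp-mono-≤ exponent) ⟩
      J * δ ^ M * exp y ∎)
    where
    J = fromℕ (j !)
    δ = fromℕ D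
    ν = fromℕ N
    0<D : 0# < fromℕ D
    0<D = fromℕ-positive 1≤D
    base : fromℕ (D ℕ.+ N) ≤ δ * exp (ν * δ ⁻¹)
    base = begin
      fromℕ (D ℕ.+ N)           ≈⟨ fromℕ-+ D N ⟩
      δ + ν                     ≈⟨ solve 2 (λ u v → u :+ v := u :+ :1 :* v) refl δ ν ⟩
      δ + 1# * ν                ≈⟨ +-congˡ (*-congʳ (⁻¹-inverse 0<D)) ⟨
      δ + δ * δ ⁻¹ * ν          ≈⟨ solve 3 (λ u i v → u :+ u :* i :* v
            := u :* (:1 :+ v :* i)) refl δ (δ ⁻¹) ν ⟩
      δ * (1# + ν * δ ⁻¹)       ≤⟨ *-monoˡ-≤ (proj₁ 0<D) (1+x≤exp (ν * δ ⁻¹)) ⟩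
      δ * exp (ν * δ ⁻¹)        ∎
    exponent : fromℕ M * (ν * δ ⁻¹) ≤ y
    exponent = *-cancelˡ-≤ 0<D (begin
      δ * (fromℕ M * (ν * δ ⁻¹))
        ≈⟨ solve 4 (λ u m v i → u :* (m :* (v :* i)) := u :* i :* (m :* v)) refl δ (fromℕ M) ν (δ ⁻¹) ⟩
      δ * δ ⁻¹ * (fromℕ M * ν)       ≈⟨ *-congʳ (⁻¹-inverse 0<D) ⟩
      1# * (fromℕ M * ν)             ≈⟨ solve 1 (λ u → :1 :* u := u) refl (fromℕ M * ν) ⟩
      fromℕ M * ν                    ≤⟨ MN≤Dy ⟩
      δ * y                          ∎)
  module _ (j : ℕ) where
    private
      K : Carrier
      K = fromℕ (suc j)
      e : ℕ → Carrier
      e = expTerm K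

    -- The terms e_j and e_(j+1) agree because K = j + 1. One step further outwards multiplies the
    -- lower term by A / K and the upper one by K / B, where A = K - C and B = K + C, and A B ≤ K².
    expTerm-reflect : ∀ i m → m ℕ.+ i ≡ j → e m ≤ e (suc (j ℕ.+ i))
    expTerm-reflect zero m m+0≡j with ≡.trans (≡.sym (ℕ.+-identityʳ m)) m+0≡j
    ... | ≡.refl = ≤-reflexive (trans
      (*-cancelˡ-≈ (fromℕ-suc-positive j) (sym (derivative-expTerm K j)))
      (reflexive (≡.cong (e ∘ suc) (≡.sym (ℕ.+-identityʳ j)))))
    expTerm-reflect (suc i) m m+1+i≡j = *-cancelˡ-≤ (*-positive (fromℕ-suc-positive j) 0<B) (begin
      K * B * e m                     ≈⟨ solve 3 (λ u v w → u :* v :* w := v :* (u :* w)) refl K B (e m) ⟩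
      B * (K * e m)                   ≈⟨ *-congˡ (derivative-expTerm K m) ⟨
      B * (A * e (suc m))             ≤⟨ *-monoˡ-≤ (proj₁ 0<B) (*-monoˡ-≤ (fromℕ-nonNeg (suc m)) ih) ⟩
      B * (A * E)                     ≤⟨ by-diff (*-nonNeg (square-nonNeg C) (expTerm-nonNeg (fromℕ-nonNeg (suc j)) (suc (j ℕ.+ i)))) squares ⟩
      K * (K * E)                     ≈⟨ *-congˡ (derivative-expTerm K (suc (j ℕ.+ i))) ⟨
      K * (B * e (suc (suc (j ℕ.+ i))))       ≡⟨ ≡.cong (λ n → K * (B * e (suc n))) (ℕ.+-suc j i) ⟨
      K * (B * e (suc (j ℕ.+ suc i)))
        ≈⟨ solve 3 (λ u v w → u :* (v :* w) := u :* v :* w) refl K B (e (suc (j ℕ.+ suc i))) ⟩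
      K * B * e (suc (j ℕ.+ suc i))   ∎)
      where
      A = fromℕ (suc m)
      B = fromℕ (suc (suc (j ℕ.+ i)))
      C = fromℕ (suc i)
      E = e (suc (j ℕ.+ i))
      0<B : 0# < B
      0<B = fromℕ-suc-positive (suc (j ℕ.+ i))
      ih : e (suc m) ≤ E
      ih = expTerm-reflect i (suc m) (≡.trans (≡.sym (ℕ.+-suc m i)) m+1+i≡j)
      K≈A+C : K ≈ A + C
      K≈A+C = trans (reflexive (≡.cong (fromℕ ∘ suc) (≡.sym m+1+i≡j))) (fromℕ-+ (suc m) (suc i))
      B≈K+C : B ≈ K + C
      B≈K+C = trans (reflexive (≡.cong (fromℕ ∘ suc) (≡.sym (ℕ.+-suc j i)))) (fromℕ-+ (suc j) (suc i))
      squares : C * C * E ≈ K * (K * E) - B * (A * E)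
      squares = begin-equality
        C * C * E
          ≈⟨ solve 3 (λ u v w → v :* v :* w
              := (u :+ v) :* ((u :+ v) :* w) :- (u :+ v :+ v) :* (u :* w)) refl A C E ⟩
        (A + C) * ((A + C) * E) - (A + C + C) * (A * E)
          ≈⟨ +-cong (*-cong K≈A+C (*-congʳ K≈A+C)) (-‿cong (*-congʳ (trans B≈K+C (+-congʳ K≈A+C)))) ⟨
        K * (K * E) - B * (A * E)                     ∎
    -- Of two copies of the first `suc j` terms, one gives up its last i terms in exchange for their
    -- mirror images, which extend the other copy. At m = 0 a single sum of twice the length
    -- remains.
    expSum-reflect : ∀ i m → m ℕ.+ i ≡ suc j →
      expSum K (suc j) + expSum K (suc j) ≤ expSum K m + expSum K (suc j ℕ.+ i)
    expSum-reflect zero m m+0≡1+j with ≡.trans (≡.sym (ℕ.+-identityʳ m)) m+0≡1+j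
    ... | ≡.refl = ≤-reflexive (+-congˡ (reflexive (≡.cong (expSum K) (≡.sym (ℕ.+-identityʳ (suc j))))))
    expSum-reflect (suc i) m m+1+i≡1+j = begin
      expSum K (suc j) + expSum K (suc j)
        ≤⟨ expSum-reflect i (suc m) 1+m+i≡1+j ⟩
      expSum K (suc m) + expSum K (suc j ℕ.+ i)
        ≈⟨ +-congʳ (psum-suc e m) ⟩
      expSum K m + e m + expSum K (suc j ℕ.+ i)
        ≤⟨ +-mono-≤ (+-mono-≤ ≤-refl (expTerm-reflect i m (ℕ.suc-injective 1+m+i≡1+j))) ≤-refl ⟩
      expSum K m + e (suc j ℕ.+ i) + expSum K (suc j ℕ.+ i)
        ≈⟨ solve 3 (λ u v w → u :+ v :+ w
              := u :+ (w :+ v)) refl (expSum K m) (e (suc j ℕ.+ i)) (expSum K (suc j ℕ.+ i)) ⟩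
      expSum K m + (expSum K (suc j ℕ.+ i) + e (suc j ℕ.+ i))
        ≈⟨ +-congˡ (psum-suc e (suc j ℕ.+ i)) ⟨
      expSum K m + expSum K (suc (suc j ℕ.+ i))
        ≡⟨ ≡.cong (λ n → expSum K m + expSum K n) (ℕ.+-suc (suc j) i) ⟨
      expSum K m + expSum K (suc j ℕ.+ suc i) ∎
      where
      1+m+i≡1+j : suc m ℕ.+ i ≡ suc j
      1+m+i≡1+j = ≡.trans (≡.sym (ℕ.+-suc m i)) m+1+i≡1+j
    expSum≤half-exp : 2# * expSum K (suc j) ≤ exp K
    expSum≤half-exp = begin
      2# * expSum K (suc j)
        ≈⟨ solve 1 (λ u → (:1 :+ :1) :* u := u :+ u) refl (expSum K (suc j)) ⟩
      expSum K (suc j) + expSum K (suc j)         ≤⟨ expSum-reflect (suc j) 0 ≡.refl ⟩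
      0# + expSum K (suc j ℕ.+ suc j)
        ≈⟨ solve 1 (λ u → :0 :+ u := u) refl (expSum K (suc j ℕ.+ suc j)) ⟩
      expSum K (suc j ℕ.+ suc j)                  ≤⟨ expSum≤exp (fromℕ-nonNeg (suc j)) (suc j ℕ.+ suc j) ⟩
      exp K                                       ∎

  -- In other words 2/3 ≤ log 2. Writing 2/3 as 16/24 and using exp (-1/24) ≥ 23/24 reduces this to
  -- 24^16 ≤ 2 * 23^16.
  exp[-2/3]≥½ : fromℕ 3 * y ≈ - fromℕ 2 → 1# ≤ 2# * exp y
  exp[-2/3]≥½ {y} 3y≈-2 = *-cancelˡ-≤ (^-positive 16 0<24) (begin
    fromℕ 24 ^ 16 * 1#
      ≈⟨ trans (unit (fromℕ 24 ^ 16)) (sym (fromℕ-^ 24 16)) ⟩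
    fromℕ (24 ℕ.^ 16)
      ≤⟨ fromℕ-mono-≤ (ℕ.≤ᵇ⇒≤ (24 ℕ.^ 16) (2 ℕ.* 23 ℕ.^ 16) _) ⟩
    fromℕ (2 ℕ.* 23 ℕ.^ 16)
      ≈⟨ trans (fromℕ-* 2 (23 ℕ.^ 16)) (*-congˡ (fromℕ-^ 23 16)) ⟩
    fromℕ 2 * fromℕ 23 ^ 16
      ≤⟨ *-monoˡ-≤ (fromℕ-nonNeg 2) (^-mono-≤ 16 (fromℕ-nonNeg 23) base) ⟩
    fromℕ 2 * (fromℕ 24 * exp w) ^ 16
      ≈⟨ *-congˡ (trans (^-distrib-* 16) (*-congˡ (exp-^ 16 w))) ⟩
    fromℕ 2 * (fromℕ 24 ^ 16 * exp (fromℕ 16 * w))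
      ≈⟨ *-congˡ (*-congˡ (exp-cong 16w≈y)) ⟩
    fromℕ 2 * (fromℕ 24 ^ 16 * exp y)
      ≈⟨ solve 2 (λ u v → (:1 :+ (:1 :+ :0)) :* (u :* v)
            := u :* ((:1 :+ :1) :* v)) refl (fromℕ 24 ^ 16) (exp y) ⟩
    fromℕ 24 ^ 16 * (2# * exp y) ∎)
    where
    w : Carrier
    w = - (fromℕ 24 ⁻¹)
    0<24 : 0# < fromℕ 24
    0<24 = fromℕ-suc-positive 23
    unit : ∀ u → u * 1# ≈ u
    unit = solve 1 (λ u → u :* :1 := u) refl
    base : fromℕ 23 ≤ fromℕ 24 * exp w
    base = begin
      fromℕ 23                                  ≈⟨ solve 1 (λ u → u := :1 :+ u :- :1) refl (fromℕ 23) ⟩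
      fromℕ 24 - 1#                             ≈⟨ +-congˡ (-‿cong (⁻¹-inverse 0<24)) ⟨
      fromℕ 24 - fromℕ 24 * fromℕ 24 ⁻¹
        ≈⟨ solve 2 (λ u i → u :- u :* i := u :* (:1 :- i)) refl (fromℕ 24) (fromℕ 24 ⁻¹) ⟩
      fromℕ 24 * (1# + w)                       ≤⟨ *-monoˡ-≤ (proj₁ 0<24) (1+x≤exp w) ⟩
      fromℕ 24 * exp w                          ∎
    16w≈y : fromℕ 16 * w ≈ y
    16w≈y = *-cancelˡ-≈ 0<24 (begin-equality
      fromℕ 24 * (fromℕ 16 * w)
        ≈⟨ solve 3 (λ u v i → u :* (v :* :- i)
            := :- (v :* (u :* i))) refl (fromℕ 24) (fromℕ 16) (fromℕ 24 ⁻¹) ⟩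
      - (fromℕ 16 * (fromℕ 24 * fromℕ 24 ⁻¹))        ≈⟨ -‿cong (*-congˡ (⁻¹-inverse 0<24)) ⟩
      - (fromℕ 16 * 1#)                              ≈⟨ -‿cong (trans (unit (fromℕ 16)) (fromℕ-* 8 2)) ⟩
      - (fromℕ 8 * fromℕ 2)
        ≈⟨ solve 2 (λ u v → :- (u :* v) := u :* :- v) refl (fromℕ 8) (fromℕ 2) ⟩
      fromℕ 8 * - fromℕ 2                            ≈⟨ *-congˡ 3y≈-2 ⟨
      fromℕ 8 * (fromℕ 3 * y)
        ≈⟨ solve 3 (λ u v w → u :* (v :* w) := u :* v :* w) refl (fromℕ 8) (fromℕ 3) y ⟩
      fromℕ 8 * fromℕ 3 * y                          ≈⟨ *-congʳ (fromℕ-* 8 3) ⟨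
      fromℕ 24 * y                                   ∎)

  module _ (j : ℕ) {r : Carrier} (0≤r : 0# ≤ r) (r²k≈1 : r * r * fromℕ (suc j) ≈ 1#) where
    private
      K : Carrier
      K = fromℕ (suc j)

    -- `r` is 1 / √k, known only through its square; a rational upper bound a / b is certified by
    -- comparing integer squares.
    root-bound : ∀ a b → b ℕ.* b ℕ.≤ a ℕ.* a ℕ.* suc j → fromℕ b * r ≤ fromℕ a
    root-bound a b b²≤a²k = square-cancel-≤ (fromℕ-nonNeg a) (begin
      fromℕ b * r * (fromℕ b * r)
        ≈⟨ solve 2 (λ u v → u :* v :* (u :* v) := u :* u :* (v :* v)) refl (fromℕ b) r ⟩
      fromℕ b * fromℕ b * (r * r)                ≈⟨ *-congʳ (fromℕ-* b b) ⟨
      fromℕ (b ℕ.* b) * (r * r)                  ≤⟨ *-monoʳ-≤ (square-nonNeg r) (fromℕ-mono-≤ b²≤a²k) ⟩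
      fromℕ (a ℕ.* a ℕ.* suc j) * (r * r)        ≈⟨ *-congʳ (trans (fromℕ-* (a ℕ.* a) (suc j)) (*-congʳ (fromℕ-* a a))) ⟩
      fromℕ a * fromℕ a * K * (r * r)
        ≈⟨ solve 3 (λ u v w → u :* u :* v :* (w :* w) := u :* u :* (w :* w :* v)) refl (fromℕ a) K r ⟩
      fromℕ a * fromℕ a * (r * r * K)            ≈⟨ *-congˡ r²k≈1 ⟩
      fromℕ a * fromℕ a * 1#
        ≈⟨ solve 1 (λ u → u :* u :* :1 := u :* u) refl (fromℕ a) ⟩
      fromℕ a * fromℕ a                          ∎)
    -- Here r ≤ a / b and N / (2 * b) = k - 1 / 2 - a / (2 * b).
    expSum-numeric : ∀ a b M N → 1 ℕ.≤ 2 ℕ.* b ℕ.* M → b ℕ.* b ℕ.≤ a ℕ.* a ℕ.* suc j →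
      N ℕ.+ b ℕ.+ a ≡ 2 ℕ.* b ℕ.* suc j →
      horner (suc j) j ℕ.* (2 ℕ.* b ℕ.* M) ℕ.^ M ℕ.≤ j ! ℕ.* (2 ℕ.* b ℕ.* M ℕ.+ N) ℕ.^ M →
      expSum K (suc j) ≤ exp (K - ½ - ½ * r)
    expSum-numeric a b M N 1≤D b²≤a²k N+b+a≡2bk numeric =
      expSum≤exp-numeric (suc j) j (2 ℕ.* b ℕ.* M) M N 1≤D numeric (begin
        M′ * fromℕ N
          ≈⟨ *-congˡ (solve 3 (λ u v w → u := u :+ v :+ w :- v :- w) refl (fromℕ N) B A) ⟩
        M′ * (fromℕ N + B + A - B - A)
          ≈⟨ *-congˡ (+-congʳ (+-congʳ N+b+a)) ⟩
        M′ * (fromℕ 2 * B * K - B - A)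
          ≤⟨ by-diff (*-nonNeg (fromℕ-nonNeg M) (diff (root-bound a b b²≤a²k)))
              (solve 5 (λ m a b k r → m :* (a :- b :* r)
                := m :* b :* ((:1 :+ :1) :* k :- :1 :- :1 :* r) :- m :* ((:1 :+ (:1 :+ :0)) :* b :* k :- b :- a))
                refl M′ A B K r) ⟩
        M′ * B * (2# * K - 1# - 1# * r)
          ≈⟨ *-congˡ (+-cong (+-congˡ (-‿cong ½-double)) (-‿cong (*-congʳ ½-double))) ⟨
        M′ * B * (2# * K - 2# * ½ - 2# * ½ * r)
          ≈⟨ solve 5 (λ m b k h r → m :* b :* ((:1 :+ :1) :* k :- (:1 :+ :1) :* h :- (:1 :+ :1) :* h :* r)
                := (:1 :+ (:1 :+ :0)) :* b :* m :* (k :- h :- h :* r)) refl M′ B K ½ r ⟩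
        fromℕ 2 * B * M′ * (K - ½ - ½ * r)
          ≈⟨ *-congʳ (trans (fromℕ-* (2 ℕ.* b) M) (*-congʳ (fromℕ-* 2 b))) ⟨
        fromℕ (2 ℕ.* b ℕ.* M) * (K - ½ - ½ * r) ∎)
      where
      M′ A B : Carrier
      M′ = fromℕ M
      A = fromℕ a
      B = fromℕ b
      N+b+a : fromℕ N + B + A ≈ fromℕ 2 * B * K
      N+b+a = begin-equality
        fromℕ N + B + A                ≈⟨ trans (fromℕ-+ (N ℕ.+ b) a) (+-congʳ (fromℕ-+ N b)) ⟨
        fromℕ (N ℕ.+ b ℕ.+ a)          ≡⟨ ≡.cong fromℕ N+b+a≡2bk ⟩
        fromℕ (2 ℕ.* b ℕ.* suc j)      ≈⟨ trans (fromℕ-* (2 ℕ.* b) (suc j)) (*-congʳ (fromℕ-* 2 b)) ⟩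
        fromℕ 2 * B * K                ∎
    -- For k ≥ 9 one has r ≤ 1/3, so ½ + ½ r ≤ 2/3 ≤ log 2, and the factor ½ from `expSum≤half-exp`
    -- suffices.
    expSum-large : 9 ℕ.≤ suc j → expSum K (suc j) ≤ exp (K - ½ - ½ * r)
    expSum-large 9≤k = begin
      expSum K (suc j)
        ≈⟨ solve 1 (λ u → u := :1 :* u) refl (expSum K (suc j)) ⟩
      1# * expSum K (suc j)
        ≤⟨ *-monoʳ-≤ (psum-nonNeg (expTerm-nonNeg (fromℕ-nonNeg (suc j))) (suc j)) (exp[-2/3]≥½ {w} 3w≈-2) ⟩
      2# * exp w * expSum K (suc j)
        ≈⟨ solve 2 (λ u v → (:1 :+ :1) :* u :* v
              := u :* ((:1 :+ :1) :* v)) refl (exp w) (expSum K (suc j)) ⟩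
      exp w * (2# * expSum K (suc j))
        ≤⟨ *-monoˡ-≤ (exp-nonNeg w) (expSum≤half-exp j) ⟩
      exp w * exp K
        ≈⟨ exp-+ w K ⟨
      exp (w + K)
        ≤⟨ exp-mono-≤ (*-cancelˡ-≤ (fromℕ-suc-positive 5) exponent) ⟩
      exp (K - ½ - ½ * r) ∎
      where
      w : Carrier
      w = - (fromℕ 2 * fromℕ 3 ⁻¹)
      3w≈-2 : fromℕ 3 * w ≈ - fromℕ 2
      3w≈-2 = begin-equality
        fromℕ 3 * w
          ≈⟨ solve 3 (λ u v i → u :* :- (v :* i)
              := :- (v :* (u :* i))) refl (fromℕ 3) (fromℕ 2) (fromℕ 3 ⁻¹) ⟩
        - (fromℕ 2 * (fromℕ 3 * fromℕ 3 ⁻¹)) ≈⟨ -‿cong (*-congˡ (⁻¹-inverse (fromℕ-suc-positive 2))) ⟩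
        - (fromℕ 2 * 1#)                     ≈⟨ solve 1 (λ u → :- (u :* :1) := :- u) refl (fromℕ 2) ⟩
        - fromℕ 2                            ∎
      exponent : fromℕ 6 * (w + K) ≤ fromℕ 6 * (K - ½ - ½ * r)
      exponent = begin
        fromℕ 6 * (w + K)
          ≈⟨ trans (*-congʳ (fromℕ-* 2 3))
              (solve 4 (λ u v w k → u :* v :* (w :+ k)
                := u :* (v :* w) :+ u :* v :* k) refl (fromℕ 2) (fromℕ 3) w K) ⟩
        fromℕ 2 * (fromℕ 3 * w) + fromℕ 2 * fromℕ 3 * K
          ≈⟨ +-congʳ (*-congˡ 3w≈-2) ⟩
        fromℕ 2 * - fromℕ 2 + fromℕ 2 * fromℕ 3 * K
          ≤⟨ by-diff (diff (root-bound 1 3 (≡.subst (9 ℕ.≤_) (≡.sym (ℕ.*-identityˡ (suc j))) 9≤k)))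
              (solve 2 (λ r k → :1 :+ :0 :- (:1 :+ (:1 :+ (:1 :+ :0))) :* r
                := (:1 :+ (:1 :+ (:1 :+ :0))) :* ((:1 :+ :1) :* k :- :1 :- :1 :* r)
                   :- ((:1 :+ (:1 :+ :0)) :* :- (:1 :+ (:1 :+ :0)) :+ (:1 :+ (:1 :+ :0)) :* (:1 :+ (:1 :+ (:1 :+ :0))) :* k))
                refl r K) ⟩
        fromℕ 3 * (2# * K - 1# - 1# * r)
          ≈⟨ *-congˡ (+-cong (+-congˡ (-‿cong ½-double)) (-‿cong (*-congʳ ½-double))) ⟨
        fromℕ 3 * (2# * K - 2# * ½ - 2# * ½ * r)
          ≈⟨ solve 3 (λ k h r → (:1 :+ (:1 :+ (:1 :+ :0))) :* ((:1 :+ :1) :* k :- (:1 :+ :1) :* h :- (:1 :+ :1) :* h :* r)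
                := (:1 :+ (:1 :+ (:1 :+ (:1 :+ (:1 :+ (:1 :+ :0)))))) :* (k :- h :- h :* r)) refl K ½ r ⟩
        fromℕ 6 * (K - ½ - ½ * r) ∎

  -- The numbers in each case are a, b, M, N: a / b bounds 1 / √k from above, N / (2 b) is the
  -- resulting exponent, and M is the number of factors in (1 + N / (2 b M)) ^ M ≤ exp (N / (2 b)).
  -- At k = 1 both sides equal 1, so the exponent has to be 0.
  expSum-at-mean : ∀ j {r} → 0# ≤ r → r * r * fromℕ (suc j) ≈ 1# →
                   expSum (fromℕ (suc j)) (suc j) ≤ exp (fromℕ (suc j) - ½ - ½ * r)
  expSum-at-mean 0 0≤r r²k≈1 = expSum-numeric 0 0≤r r²k≈1 1 1 1 0
    (ℕ.≤ᵇ⇒≤ _ _ _) (ℕ.≤ᵇ⇒≤ _ _ _) ≡.refl (ℕ.≤ᵇ⇒≤ _ _ _)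
  expSum-at-mean 1 0≤r r²k≈1 = expSum-numeric 1 0≤r r²k≈1 5 7 20 16
    (ℕ.≤ᵇ⇒≤ _ _ _) (ℕ.≤ᵇ⇒≤ _ _ _) ≡.refl (ℕ.≤ᵇ⇒≤ _ _ _)
  expSum-at-mean 2 0≤r r²k≈1 = expSum-numeric 2 0≤r r²k≈1 3 5 50 22
    (ℕ.≤ᵇ⇒≤ _ _ _) (ℕ.≤ᵇ⇒≤ _ _ _) ≡.refl (ℕ.≤ᵇ⇒≤ _ _ _)
  expSum-at-mean 3 0≤r r²k≈1 = expSum-numeric 3 0≤r r²k≈1 1 2 80 13
    (ℕ.≤ᵇ⇒≤ _ _ _) (ℕ.≤ᵇ⇒≤ _ _ _) ≡.refl (ℕ.≤ᵇ⇒≤ _ _ _)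
  expSum-at-mean 4 0≤r r²k≈1 = expSum-numeric 4 0≤r r²k≈1 1 2 160 17
    (ℕ.≤ᵇ⇒≤ _ _ _) (ℕ.≤ᵇ⇒≤ _ _ _) ≡.refl (ℕ.≤ᵇ⇒≤ _ _ _)
  expSum-at-mean 5 0≤r r²k≈1 = expSum-numeric 5 0≤r r²k≈1 1 2 300 21
    (ℕ.≤ᵇ⇒≤ _ _ _) (ℕ.≤ᵇ⇒≤ _ _ _) ≡.refl (ℕ.≤ᵇ⇒≤ _ _ _)
  expSum-at-mean 6 0≤r r²k≈1 = expSum-numeric 6 0≤r r²k≈1 2 5 250 63
    (ℕ.≤ᵇ⇒≤ _ _ _) (ℕ.≤ᵇ⇒≤ _ _ _) ≡.refl (ℕ.≤ᵇ⇒≤ _ _ _)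
  expSum-at-mean 7 0≤r r²k≈1 = expSum-numeric 7 0≤r r²k≈1 3 8 320 117
    (ℕ.≤ᵇ⇒≤ _ _ _) (ℕ.≤ᵇ⇒≤ _ _ _) ≡.refl (ℕ.≤ᵇ⇒≤ _ _ _)
  expSum-at-mean (suc (suc (suc (suc (suc (suc (suc (suc j)))))))) 0≤r r²k≈1 =
    expSum-large (8 ℕ.+ j) 0≤r r²k≈1 (ℕ.m≤m+n 9 j)

  -- The bound x ≤ exp (v - 1) * exp z, where v = x / (1 + ρ) and z is as in ≤exp-sinh, is best
  -- at v = 1, where the two sides of the claim are closest.
  Poisson-tail : ∀ j s x → 0# ≤ s → s * s ≈ fromℕ (suc j) → 1# ≤ x →
    expSum (fromℕ (suc j) * x) (suc j) ≤
    exp (fromℕ (suc j) * x - s * (x - (fromℕ (suc j) - 1#) / fromℕ (suc j)))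
  Poisson-tail j s x 0≤s s²≈K 1≤x = begin
    expSum (K * x) (suc j)
      ≤⟨ expSum-*-≤ (fromℕ-nonNeg (suc j)) 1≤x j (suc j) ℕ.≤-refl ⟩
    x ^ j * expSum K (suc j)
      ≤⟨ *-mono-≤ (^-nonNeg j 0≤x) (exp-nonNeg _) (^-mono-≤ j 0≤x x≤expY) (expSum-at-mean j 0≤ρ r²K≈1) ⟩
    exp Y ^ j * exp (K - ½ - ½ * ρ)
      ≈⟨ *-congʳ (exp-^ j Y) ⟩
    exp (J * Y) * exp (K - ½ - ½ * ρ)
      ≈⟨ exp-+ (J * Y) (K - ½ - ½ * ρ) ⟨
    exp (J * Y + (K - ½ - ½ * ρ))
      ≈⟨ exp-cong exponent ⟩
    exp (K * x - s * (x - (K - 1#) / K)) ∎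
    where
    K J ρ u i Y : Carrier
    K = fromℕ (suc j)
    J = fromℕ j
    ρ = s * K ⁻¹
    u = 1# + ρ
    i = u ⁻¹
    -- An upper bound for log x, split as log (x / u) + log u: the first part by 1 + t ≤ exp t, the
    -- second by `≤exp-sinh`.
    Y = x * i - 1# + ½ * (u - i)
    0<K : 0# < K
    0<K = fromℕ-suc-positive j
    0≤x : 0# ≤ x
    0≤x = ≤-trans 0≤1 1≤x
    0≤ρ : 0# ≤ ρ
    0≤ρ = *-nonNeg 0≤s (⁻¹-nonNeg 0<K)
    0<u : 0# < u
    0<u = 1+-positive 0≤ρ
    sr≈1 : s * ρ ≈ 1#
    sr≈1 = begin-equality
      s * (s * K ⁻¹)    ≈⟨ solve 2 (λ u v → u :* (u :* v) := u :* u :* v) refl s (K ⁻¹) ⟩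
      s * s * K ⁻¹      ≈⟨ *-congʳ s²≈K ⟩
      K * K ⁻¹          ≈⟨ ⁻¹-inverse 0<K ⟩
      1#                ∎
    r²K≈1 : ρ * ρ * K ≈ 1#
    r²K≈1 = begin-equality
      ρ * ρ * K          ≈⟨ *-congˡ s²≈K ⟨
      ρ * ρ * (s * s)    ≈⟨ solve 2 (λ u v → u :* u :* (v :* v) := v :* u :* (v :* u)) refl ρ s ⟩
      s * ρ * (s * ρ)    ≈⟨ *-cong sr≈1 sr≈1 ⟩
      1# * 1#            ≈⟨ solve 0 (:1 :* :1 := :1) refl ⟩
      1#                 ∎
    x≤expY : x ≤ exp Y
    x≤expY = begin
      x                                           ≈⟨ solve 1 (λ u → u := :1 :* u) refl x ⟩
      1# * x                                      ≈⟨ *-congʳ (⁻¹-inverse 0<u) ⟨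
      u * i * x
        ≈⟨ solve 3 (λ u i x → u :* i :* x := x :* i :* u) refl u i x ⟩
      x * i * u                                   ≤⟨ *-mono-≤ (*-nonNeg 0≤x (⁻¹-nonNeg 0<u)) (exp-nonNeg _)
                                                       (≤-trans (≤-reflexive (solve 1 (λ u → u
                                                             := :1 :+ (u :- :1))
                                                             refl (x * i))) (1+x≤exp (x * i - 1#)))
                                                       (≤exp-sinh (by-diff 0≤ρ (solve 1 (λ ρ → ρ
                                                             := :1 :+ ρ :- :1) refl ρ))) ⟩
      exp (x * i - 1#) * exp (½ * (u - i))        ≈⟨ exp-+ (x * i - 1#) (½ * (u - i)) ⟨
      exp Y                                       ∎
    J≈ : J ≈ s * s - 1#
    J≈ = trans (solve 1 (λ u → u := :1 :+ u :- :1) refl J) (+-congʳ (sym s²≈K))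
    Jr≈ : J * ρ ≈ s - ρ
    Jr≈ = begin-equality
      J * ρ                      ≈⟨ *-congʳ J≈ ⟩
      (s * s - 1#) * ρ           ≈⟨ solve 2 (λ s ρ → (s :* s :- :1) :* ρ := s :* (s :* ρ) :- ρ) refl s ρ ⟩
      s * (s * ρ) - ρ            ≈⟨ +-congʳ (*-congˡ sr≈1) ⟩
      s * 1# - ρ                 ≈⟨ solve 2 (λ s ρ → s :* :1 :- ρ := s :- ρ) refl s ρ ⟩
      s - ρ                      ∎
    -- The matching of slopes: s + 1 = s u because s ρ = 1, so the factor s + 1 of s² - 1 cancels
    -- against `i`.
    Ji≈ : J * i ≈ s * s - s
    Ji≈ = begin-equality
      J * i                                ≈⟨ *-congʳ J≈ ⟩
      (s * s - 1#) * i
        ≈⟨ solve 2 (λ s i → (s :* s :- :1) :* i := (s :- :1) :* (s :+ :1) :* i) refl s i ⟩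
      (s - 1#) * (s + 1#) * i              ≈⟨ *-congʳ (*-congˡ (+-congˡ sr≈1)) ⟨
      (s - 1#) * (s + s * ρ) * i
        ≈⟨ solve 3 (λ s ρ i → (s :- :1) :* (s :+ s :* ρ) :* i
            := (s :- :1) :* s :* ((:1 :+ ρ) :* i)) refl s ρ i ⟩
      (s - 1#) * s * ((1# + ρ) * i)        ≈⟨ *-congˡ (⁻¹-inverse 0<u) ⟩
      (s - 1#) * s * 1#                    ≈⟨ solve 1 (λ s → (s :- :1) :* s :* :1 := s :* s :- s) refl s ⟩
      s * s - s                            ∎
    -- No slack remains at this point: in terms of s and ρ the two exponents coincide, up to a
    -- multiple of 2 * ½ - 1 and the relations for K.
    exponent : J * Y + (K - ½ - ½ * ρ) ≈ K * x - s * (x - (K - 1#) / K)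
    exponent = begin-equality
      J * Y + (K - ½ - ½ * ρ)
        ≈⟨ solve 6 (λ J x i h ρ K → J :* (x :* i :- :1 :+ h :* (:1 :+ ρ :- i)) :+ (K :- h :- h :* ρ)
              := J :* i :* x :- J :+ h :* (J :+ J :* ρ :- J :* i) :+ (K :- h :- h :* ρ))
              refl J x i ½ ρ K ⟩
      J * i * x - J + ½ * (J + J * ρ - J * i) + (K - ½ - ½ * ρ)
        ≈⟨ +-cong (+-cong (+-cong (*-congʳ Ji≈) (-‿cong J≈)) (*-congˡ (+-cong (+-cong J≈ Jr≈) (-‿cong Ji≈))))
                  (+-congʳ (+-congʳ (sym s²≈K))) ⟩
      (s * s - s) * x - (s * s - 1#) + ½ * (s * s - 1# + (s - ρ) - (s * s - s)) + (s * s - ½ - ½ * ρ)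
        ≈⟨ solve 4 (λ s x ρ h → (s :* s :- s) :* x :- (s :* s :- :1)
           :+ h :* (s :* s :- :1 :+ (s :- ρ) :- (s :* s :- s)) :+ (s :* s :- h :- h :* ρ)
              := s :* s :* x :- s :* x :+ s :* :1 :- ρ :+ (s :- :1 :- ρ) :* ((:1 :+ :1) :* h :- :1))
              refl s x ρ ½ ⟩
      s * s * x - s * x + s * 1# - ρ + (s - 1# - ρ) * (2# * ½ - 1#)
        ≈⟨ +-cong (+-congʳ (+-cong (+-congʳ (*-congʳ s²≈K)) (*-congˡ (sym (⁻¹-inverse 0<K)))))
                  (*-congˡ (+-congʳ ½-double)) ⟩
      K * x - s * x + s * (K * K ⁻¹) - s * K ⁻¹ + (s - 1# - ρ) * (1# - 1#)
        ≈⟨ solve 5 (λ K x s i e → K :* x :- s :* x :+ s :* (K :* i) :- s :* i :+ e :* (:1 :- :1)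
              := K :* x :- s :* (x :- (K :- :1) :* i)) refl K x s (K ⁻¹) (s - 1# - ρ) ⟩
      K * x - s * (x - (K - 1#) / K) ∎

  -- Square roots and the function P

  module _ {x S : Carrier} (0≤x : 0# ≤ x) (0≤S : 0# ≤ S)
    (upper : ∀ {a} → 0# ≤ a → a * a ≤ x → a ≤ S)
    (least : ∀ {u} → 0# ≤ u → x ≤ u * u → S ≤ u) where

    -- With D = x - S² the increment δ = D / (1 + D + 2 S) is at most 1, so δ² ≤ δ and (S + δ)² ≤ S²
    -- + (1 + D + 2 S) δ = x, contradicting that S is an upper bound.
    S²≮x : ¬ S * S < x
    S²≮x S²<x = <⇒≱ 0<δ (by-diff (diff (upper (+-nonNeg 0≤S (proj₁ 0<δ)) [S+δ]²≤x))
        (solve 2 (λ u v → u :- (u :+ v) := :0 :- v) refl S δ))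
      where
      D E δ : Carrier
      D = x - S * S
      E = 1# + (D + (S + S))
      δ = D * E ⁻¹
      0<D : 0# < D
      0<D = diff-positive S²<x
      0<E : 0# < E
      0<E = 1+-positive (+-nonNeg (proj₁ 0<D) (+-nonNeg 0≤S 0≤S))
      0<δ : 0# < δ
      0<δ = *-positive 0<D (⁻¹-positive 0<E)
      Eδ≈D : E * δ ≈ D
      Eδ≈D = begin-equality
        E * (D * E ⁻¹)    ≈⟨ solve 3 (λ u v w → u :* (v :* w) := v :* (u :* w)) refl E D (E ⁻¹) ⟩
        D * (E * E ⁻¹)    ≈⟨ *-congˡ (⁻¹-inverse 0<E) ⟩
        D * 1#            ≈⟨ solve 1 (λ u → u :* :1 := u) refl D ⟩
        D                 ∎
      δ≤1 : δ ≤ 1#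
      δ≤1 = *-cancelˡ-≤ 0<E (begin
        E * δ    ≈⟨ Eδ≈D ⟩
        D        ≤⟨ by-diff (+-nonNeg 0≤1 (+-nonNeg 0≤S 0≤S))
            (solve 2 (λ d u → :1 :+ (u :+ u) := (:1 :+ (d :+ (u :+ u))) :* :1 :- d) refl D S) ⟩
        E * 1#   ∎)
      [S+δ]²≤x : (S + δ) * (S + δ) ≤ x
      [S+δ]²≤x = begin
        (S + δ) * (S + δ)
          ≤⟨ by-diff (*-nonNeg (proj₁ 0<δ) (+-nonNeg (diff δ≤1) (proj₁ 0<D)))
              (solve 3 (λ u e d → e :* (:1 :- e :+ d)
                := u :* u :+ (:1 :+ (d :+ (u :+ u))) :* e :- (u :+ e) :* (u :+ e)) refl S δ D) ⟩
        S * S + E * δ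
          ≈⟨ +-congˡ Eδ≈D ⟩
        S * S + (x - S * S)
          ≈⟨ solve 2 (λ u v → u :+ (v :- u) := v) refl (S * S) x ⟩
        x ∎
    -- Otherwise a step of Heron's iteration would give a smaller upper bound.
    x≮S² : ¬ x < S * S
    x≮S² x<S² = <⇒≱ x<S² (begin
      S * S                                ≈⟨ solve 1 (λ u → u := :1 :* u :+ :1 :* u :- u) refl (S * S) ⟩
      1# * (S * S) + 1# * (S * S) - S * S  ≈⟨ +-congʳ (+-cong (*-congʳ ½-double) (*-congʳ ½-double)) ⟨
      2# * ½ * (S * S) + 2# * ½ * (S * S) - S * S
                                           ≈⟨ solve 2 (λ h u → (:1 :+ :1) :* h :* (u :* u) :+ (:1 :+ :1) :* h :* (u :* u) :- u :* u
                                                 := (:1 :+ :1) :* u :* ((h :+ h) :* u) :- u :* u)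
                                                 refl ½ S ⟩
      2# * S * ((½ + ½) * S) - S * S       ≤⟨ +-monoˡ-≤ (- (S * S)) (*-monoˡ-≤ (*-nonNeg (proj₁ 0<2) 0≤S) bound) ⟩
      2# * S * heron - S * S
        ≈⟨ solve 4 (λ h u x i → (:1 :+ :1) :* u :* (h :* (u :+ x :* i)) :- u :* u
            := (:1 :+ :1) :* h :* (u :* u :+ u :* i :* x) :- u :* u) refl ½ S x (S ⁻¹) ⟩
      2# * ½ * (S * S + S * S ⁻¹ * x) - S * S  ≈⟨ +-congʳ (*-cong ½-double (+-congˡ (*-congʳ SS⁻¹≈1))) ⟩
      1# * (S * S + 1# * x) - S * S
        ≈⟨ solve 2 (λ u x → :1 :* (u :+ :1 :* x) :- u := x) refl (S * S) x ⟩
      x                                    ∎)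
      where
      0<S : 0# < S
      0<S = ≰⇒> λ S≤0 → <⇒≱ x<S² (begin
        S * S     ≤⟨ *-monoˡ-≤ 0≤S S≤0 ⟩
        S * 0#    ≈⟨ solve 1 (λ u → u :* :0 := :0) refl S ⟩
        0#        ≤⟨ 0≤x ⟩
        x         ∎)
      SS⁻¹≈1 : S * S ⁻¹ ≈ 1#
      SS⁻¹≈1 = ⁻¹-inverse 0<S
      heron : Carrier
      heron = ½ * (S + x * S ⁻¹)
      half : Carrier
      half = ½ * (S - x * S ⁻¹)
      bound : (½ + ½) * S ≤ heron
      bound = begin
        (½ + ½) * S      ≈⟨ solve 2 (λ h u → (h :+ h) :* u := (:1 :+ :1) :* h :* u) refl ½ S ⟩
        2# * ½ * S       ≈⟨ *-congʳ ½-double ⟩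
        1# * S           ≈⟨ solve 1 (λ u → :1 :* u := u) refl S ⟩
        S                ≤⟨ least (*-nonNeg 0≤½ (+-nonNeg 0≤S (*-nonNeg 0≤x (⁻¹-nonNeg 0<S))))
                           (by-diff (square-nonNeg half) heron²-x) ⟩
        heron            ∎
        where
        heron²-x : half * half ≈ heron * heron - x
        heron²-x = begin-equality
          half * half
            ≈⟨ solve 4 (λ h u x i → h :* (u :- x :* i) :* (h :* (u :- x :* i))
                := h :* (u :+ x :* i) :* (h :* (u :+ x :* i)) :- (:1 :+ :1) :* h :* ((:1 :+ :1) :* h) :* (u :* i) :* x)
                refl ½ S x (S ⁻¹) ⟩
          heron * heron - 2# * ½ * (2# * ½) * (S * S ⁻¹) * x           ≈⟨ +-congˡ (-‿cong (*-congʳ (*-cong (*-cong ½-double ½-double) SS⁻¹≈1))) ⟩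
          heron * heron - 1# * 1# * 1# * x
            ≈⟨ solve 2 (λ u x → u :- :1 :* :1 :* :1 :* x := u :- x) refl (heron * heron) x ⟩
          heron * heron - x                                            ∎

  sqrt-exists : 0# ≤ x → ∃ λ s → (0# ≤ s) × (s * s ≈ x)
  sqrt-exists {x} 0≤x with supremum (λ a → (0# ≤ a) × (a * a ≤ x)) (0# , 0∈A)
    (1# + x , root≤ (+-nonNeg 0≤1 0≤x) (by-diff (+-nonNeg (+-nonNeg 0≤1 0≤x) (square-nonNeg x))
        (solve 1 (λ x → :1 :+ x :+ x :* x := (:1 :+ x) :* (:1 :+ x) :- x) refl _)))
    where
    0∈A : (0# ≤ 0#) × (0# * 0# ≤ x)
    0∈A = ≤-refl , ≤-trans (≤-reflexive (solve 0 (:0 :* :0 := :0) refl)) 0≤x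
    root≤ : ∀ {y} → 0# ≤ y → x ≤ y * y → UpperBound (λ a → (0# ≤ a) × (a * a ≤ x)) y
    root≤ 0≤y x≤y² (_ , a²≤x) = square-cancel-≤ 0≤y (≤-trans a²≤x x≤y²)
  ... | S , isUpper , isLeast = S , 0≤S , antisym
    (≮⇒≥ (x≮S² 0≤x 0≤S upper least)) (≮⇒≥ (S²≮x 0≤x 0≤S upper least))
    where
    upper : ∀ {a} → 0# ≤ a → a * a ≤ x → a ≤ S
    upper 0≤a a²≤x = isUpper (0≤a , a²≤x)
    0≤S : 0# ≤ S
    0≤S = upper ≤-refl (≤-trans (≤-reflexive (solve 0 (:0 :* :0 := :0) refl)) 0≤x)
    least : ∀ {u} → 0# ≤ u → x ≤ u * u → S ≤ u
    least 0≤u x≤u² = isLeast λ (_ , a²≤x) → square-cancel-≤ 0≤u (≤-trans a²≤x x≤u²)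

  sqrt-spec : 0# ≤ x → (0# ≤ sqrt x) × (sqrt x * sqrt x ≈ x)
  sqrt-spec {x} 0≤x = the-spec {λ s → (0# ≤ s) × (s * s ≈ x)} (sqrt-exists 0≤x)

  -- `em` does not compute, so the decision inside `P` is generalised to an arbitrary `Q?` before it
  -- is analysed.
  P-large : ∀ k {x} → 1# < x →
            P k x ≡ exp (- (sqrt (fromℕ k) * (x - (fromℕ k - 1#) / fromℕ k)))
  P-large k 1<x = if-yes em 1<x
    where
    if-yes : ∀ {Q : Set} (Q? : Dec Q) {a b : Carrier} → Q → (if does Q? then a else b) ≡ a
    if-yes (yes _) _ = ≡.refl
    if-yes (no ¬q) q = ⊥-elim (¬q q)

  P-small : ∀ k {x} → ¬ 1# < x → P k x ≡ 1#
  P-small k 1≮x = if-no em 1≮x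
    where
    if-no : ∀ {Q : Set} (Q? : Dec Q) {a b : Carrier} → ¬ Q → (if does Q? then a else b) ≡ b
    if-no (yes q) ¬q = ⊥-elim (¬q q)
    if-no (no _)  _  = ≡.refl

  module _ (k : ℕ) (1≤k : 1 ℕ.≤ k) where
    private
      √k w : Carrier
      √k = sqrt (fromℕ k)
      w = (fromℕ k - 1#) / fromℕ k

      0≤√k : 0# ≤ √k
      0≤√k = proj₁ (sqrt-spec (fromℕ-nonNeg k))

      -- Makes the exponent nonpositive on [1, ∞), so that the jump of `P` at 1 goes downwards.
      w≤1 : w ≤ 1#
      w≤1 = begin
        (fromℕ k - 1#) * fromℕ k ⁻¹
          ≈⟨ solve 2 (λ u i → (u :- :1) :* i := u :* i :- i) refl (fromℕ k) (fromℕ k ⁻¹) ⟩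
        fromℕ k * fromℕ k ⁻¹ - fromℕ k ⁻¹        ≈⟨ +-congʳ (⁻¹-inverse (fromℕ-positive 1≤k)) ⟩
        1# - fromℕ k ⁻¹                          ≤⟨ by-diff (⁻¹-nonNeg (fromℕ-positive 1≤k))
            (solve 1 (λ i → i := :1 :- (:1 :- i)) refl (fromℕ k ⁻¹)) ⟩
        1#                                       ∎
      E : Carrier → Carrier
      E x = exp (- (√k * (x - w)))

      E-antitone : x ≤ y → E y ≤ E x
      E-antitone x≤y = exp-mono-≤ (neg-mono-≤ (*-monoˡ-≤ 0≤√k (+-monoˡ-≤ (- w) x≤y)))

      E≤1 : 1# ≤ x → E x ≤ 1#
      E≤1 {x} 1≤x = begin
        E x       ≤⟨ exp-mono-≤ (by-diff (*-nonNeg 0≤√k (diff (≤-trans w≤1 1≤x)))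
            (solve 1 (λ u → u := :0 :- :- u) refl (√k * (x - w)))) ⟩
        exp 0#    ≈⟨ exp-0 ⟩
        1#        ∎
      P≈E : 1# < x → P k x ≈ E x
      P≈E 1<x = reflexive (P-large k 1<x)

      P≈1 : ¬ 1# < x → P k x ≈ 1#
      P≈1 1≮x = reflexive (P-small k 1≮x)

      P≤1 : ∀ x → P k x ≤ 1#
      P≤1 x = cases em
        where
        cases : Dec (1# < x) → P k x ≤ 1#
        cases (yes 1<x) = ≤-trans (≤-reflexive (P≈E 1<x)) (E≤1 (proj₁ 1<x))
        cases (no 1≮x)  = ≤-reflexive (P≈1 1≮x)

      E≤P : 1# ≤ x → E x ≤ P k x
      E≤P {x} 1≤x = cases em
        where
        cases : Dec (1# < x) → E x ≤ P k x
        cases (yes 1<x) = ≤-reflexive (sym (P≈E 1<x))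
        cases (no 1≮x)  = ≤-trans (E≤1 1≤x) (≤-reflexive (sym (P≈1 1≮x)))

    P-nonIncreasing : NonIncreasingOn (λ x → 0# ≤ x) (P k)
    P-nonIncreasing {x} {y} _ _ x≤y = cases em
      where
      cases : Dec (1# < x) → P k y ≤ P k x
      cases (no 1≮x)  = ≤-trans (P≤1 y) (≤-reflexive (sym (P≈1 1≮x)))
      cases (yes 1<x) = begin
        P k y    ≈⟨ P≈E (begin-strict 1# <⟨ 1<x ⟩ x ≤⟨ x≤y ⟩ y ∎) ⟩
        E y      ≤⟨ E-antitone x≤y ⟩
        E x      ≈⟨ P≈E 1<x ⟨
        P k x    ∎

    -- On [1, ∞) `P` differs from the convex function `E` only by a raised value at the endpoint 1.
    -- If the mean point exceeds 1, convexity of exp and `E≤P` suffice; otherwise every point with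
    -- nonzero weight is 1 itself.
    P-convex : ConvexOn (λ x → 1# ≤ x) (P k)
    P-convex {x} {y} 1≤x 1≤y {t} 0≤t t≤1 = cases em
      where
      v : Carrier
      v = t * x + (1# - t) * y
      1≈ : 1# ≈ t * 1# + (1# - t) * 1#
      1≈ = solve 1 (λ t → :1 := t :* :1 :+ (:1 :- t) :* :1) refl _
      -- Where P jumps, a point beyond 1 has weight 0.
      weight≤ : ∀ {u x} → 0# ≤ u → 1# + u * (x - 1#) ≤ 1# → 1# ≤ x → u * 1# ≤ u * P k x
      weight≤ {u} {x} 0≤u near 1≤x = jump em
        where
        jump : Dec (1# < x) → u * 1# ≤ u * P k x
        jump (no 1≮x)  = ≤-reflexive (*-congˡ (sym (P≈1 1≮x)))
        jump (yes 1<x) = begin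
          u * 1#        ≈⟨ *-congʳ u≈0 ⟩
          0# * 1#       ≈⟨ solve 1 (λ e → :0 :* :1 := :0 :* e) refl (P k x) ⟩
          0# * P k x    ≈⟨ *-congʳ u≈0 ⟨
          u * P k x     ∎
          where
          u≈0 : u ≈ 0#
          u≈0 = antisym (*-cancelˡ-≤ (diff-positive 1<x) (by-diff (diff near)
              (solve 2 (λ u x → :1 :- (:1 :+ u :* (x :- :1))
                := (x :- :1) :* :0 :- (x :- :1) :* u) refl u x))) 0≤u
      cases : Dec (1# < v) → P k v ≤ t * P k x + (1# - t) * P k y
      cases (yes 1<v) = begin
        P k v
          ≈⟨ P≈E 1<v ⟩
        exp (- (√k * (v - w)))
          ≈⟨ exp-cong (solve 5 (λ √k w t x y → :- (√k :* (t :* x :+ (:1 :- t) :* y :- w))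
                := t :* :- (√k :* (x :- w)) :+ (:1 :- t) :* :- (√k :* (y :- w))) refl √k w t x y) ⟩
        exp (t * - (√k * (x - w)) + (1# - t) * - (√k * (y - w)))
          ≤⟨ exp-convex 0≤t t≤1 ⟩
        t * E x + (1# - t) * E y
          ≤⟨ +-mono-≤ (*-monoˡ-≤ 0≤t (E≤P 1≤x)) (*-monoˡ-≤ (diff t≤1) (E≤P 1≤y)) ⟩
        t * P k x + (1# - t) * P k y ∎
      cases (no 1≮v) = begin
        P k v
          ≈⟨ P≈1 1≮v ⟩
        1#
          ≈⟨ 1≈ ⟩
        t * 1# + (1# - t) * 1#
          ≤⟨ +-mono-≤ (weight≤ 0≤t (≤-trans (by-diff (*-nonNeg (diff t≤1) (diff 1≤y))
              (solve 3 (λ x y t → (:1 :- t) :* (y :- :1)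
                := t :* x :+ (:1 :- t) :* y :- (:1 :+ t :* (x :- :1))) refl x y t)) v≤1) 1≤x)
                      (weight≤ (diff t≤1) (≤-trans (by-diff (*-nonNeg 0≤t (diff 1≤x))
                          (solve 3 (λ x y t → t :* (x :- :1)
                            := t :* x :+ (:1 :- t) :* y :- (:1 :+ (:1 :- t) :* (y :- :1)))
                            refl x y t)) v≤1) 1≤y) ⟩
        t * P k x + (1# - t) * P k y ∎
        where
        v≤1 : v ≤ 1#
        v≤1 = ≮⇒≥ 1≮v

  -- Sums of independent Bernoulli variables

  -- At r = 0 the Poisson factor is the point mass at 0, so all mass lies at or below the number of
  -- parameters. The surplus `m` is there for the induction, which evaluates the shorter list at two
  -- consecutive arguments.
  cdf-total : ∀ ps m → cdf 0# ps (suc (length ps ℕ.+ m)) ≈ 1#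
  cdf-total []       m = expSum-0 m
  cdf-total (p ∷ ps) m = begin-equality
    cdf 0# (p ∷ ps) (suc (suc N))
      ≈⟨ psum-bernoulli p (pmf 0# ps) (suc (suc N)) ⟩
    (1# - p) * cdf 0# ps (suc (suc N)) + p * cdf 0# ps (suc N)
      ≡⟨ ≡.cong (λ i → (1# - p) * cdf 0# ps (suc i) + p * cdf 0# ps (suc N)) (ℕ.+-suc (length ps) m) ⟨
    (1# - p) * cdf 0# ps (suc (length ps ℕ.+ suc m)) + p * cdf 0# ps (suc N)
      ≈⟨ +-cong (*-congˡ (cdf-total ps (suc m))) (*-congˡ (cdf-total ps m)) ⟩
    (1# - p) * 1# + p * 1#
      ≈⟨ solve 1 (λ p → (:1 :- p) :* :1 :+ p :* :1 := :1) refl _ ⟩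
    1# ∎
    where
    N = length ps ℕ.+ m

  moment : (ℕ → Carrier) → ℕ → Carrier
  moment f = psum (λ i → fromℕ i * f i)

  moment-bernoulli : ∀ p f k →
    moment (bernoulli p f) (suc k) ≈ (1# - p) * moment f (suc k) + p * (psum f k + moment f k)
  moment-bernoulli p f k = begin-equality
    moment (bernoulli p f) (suc k)
      ≈⟨ psum-cong (λ i → solve 4 (λ i u v p → i :* ((:1 :- p) :* u :+ p :* v)
            := (:1 :- p) :* (i :* u) :+ p :* (i :* v)) refl (fromℕ i) (f i) (shift f i) p) (suc k) ⟩
    psum (λ i → (1# - p) * (fromℕ i * f i) + p * (fromℕ i * shift f i)) (suc k)
      ≈⟨ psum-+ (λ i → (1# - p) * (fromℕ i * f i)) (λ i → p * (fromℕ i * shift f i)) (suc k) ⟩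
    psum (λ i → (1# - p) * (fromℕ i * f i)) (suc k) + psum (λ i → p * (fromℕ i * shift f i)) (suc k)
      ≈⟨ +-cong (psum-* (1# - p) (λ i → fromℕ i * f i) (suc k)) (psum-* p (λ i → fromℕ i * shift f i) (suc k)) ⟩
    (1# - p) * moment f (suc k) + p * (0# * 0# + psum (λ i → (1# + fromℕ i) * f i) k)
      ≈⟨ +-congˡ (*-congˡ (trans (solve 1 (λ u → :0 :* :0 :+ u
            := u) refl (psum (λ i → (1# + fromℕ i) * f i) k))
           (trans (psum-cong (λ i → solve 2 (λ i u → (:1 :+ i) :* u
                 := u :+ i :* u) refl (fromℕ i) (f i)) k) (psum-+ f (λ i → fromℕ i * f i) k)))) ⟩
    (1# - p) * moment f (suc k) + p * (psum f k + moment f k) ∎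

  moment-pmf : ∀ ps m → moment (pmf 0# ps) (suc (length ps ℕ.+ m)) ≈ mean 0# ps
  moment-pmf [] m = begin-equality
    0# * expTerm 0# 0 + psum (derivative (expTerm 0#)) m
      ≈⟨ +-congˡ (trans (psum-cong (derivative-expTerm 0#) m) (psum-* 0# (expTerm 0#) m)) ⟩
    0# * expTerm 0# 0 + 0# * expSum 0# m
      ≈⟨ solve 2 (λ u v → :0 :* u :+ :0 :* v := :0) refl (expTerm 0# 0) (expSum 0# m) ⟩
    0# ∎
  moment-pmf (p ∷ ps) m = begin-equality
    moment (bernoulli p (pmf 0# ps)) (suc (suc N))
      ≈⟨ moment-bernoulli p (pmf 0# ps) (suc N) ⟩
    (1# - p) * moment (pmf 0# ps) (suc (suc N)) + p * (cdf 0# ps (suc N) + moment (pmf 0# ps) (suc N))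
      ≡⟨ ≡.cong (λ i → (1# - p) * moment (pmf 0# ps) (suc i) + p * (cdf 0# ps (suc N) + moment (pmf 0# ps) (suc N)))
           (ℕ.+-suc (length ps) m) ⟨
    (1# - p) * moment (pmf 0# ps) (suc (length ps ℕ.+ suc m)) + p * (cdf 0# ps (suc N) + moment (pmf 0# ps) (suc N))
      ≈⟨ +-cong (*-congˡ (moment-pmf ps (suc m))) (*-congˡ (+-cong (cdf-total ps m) (moment-pmf ps m))) ⟩
    (1# - p) * mean 0# ps + p * (1# + mean 0# ps)
      ≈⟨ solve 2 (λ u p → (:1 :- p) :* u :+ p :* (:1 :+ u) := p :+ u) refl (mean 0# ps) p ⟩
    p + mean 0# ps ∎
    where
    N = length ps ℕ.+ m

  product-cong : ∀ {n} {f g : Fin n → Carrier} → (∀ i → f i ≈ g i) → product f ≈ product g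
  product-cong {zero}  f≈g = refl
  product-cong {suc n} f≈g = *-cong (f≈g Fin.zero) (product-cong (λ i → f≈g (Fin.suc i)))

  product-1 : ∀ n → product {n} (λ _ → 1#) ≈ 1#
  product-1 zero    = refl
  product-1 (suc n) = trans (*-congˡ (product-1 n)) (solve 0 (:1 :* :1 := :1) refl)

  module _ (𝓟 : ProbabilitySpace) where
    open ProbabilitySpace 𝓟

    private
      variable
        A B C : Pred Ω 0ℓ

    -- Measurability and finite additivity

    measurable-∅ : Measurable ∅
    measurable-∅ = measurable-resp-≐ ((λ ¬⊤ → ¬⊤ _) , λ ()) (measurable-∁ measurable-U)

    measurable-∪ : Measurable A → Measurable B → Measurable (A ∪ B)
    measurable-∪ {A} {B} mA mB = measurable-resp-≐ (to , from) (measurable-⋃ F mF)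
      where
      F : ℕ → Pred Ω 0ℓ
      F zero    = A
      F (suc _) = B
      mF : ∀ i → Measurable (F i)
      mF zero    = mA
      mF (suc _) = mB
      to : ⋃ ℕ F ⊆ A ∪ B
      to (zero  , ω∈A) = inj₁ ω∈A
      to (suc _ , ω∈B) = inj₂ ω∈B
      from : A ∪ B ⊆ ⋃ ℕ F
      from (inj₁ ω∈A) = 0 , ω∈A
      from (inj₂ ω∈B) = 1 , ω∈B

    measurable-∩ : Measurable A → Measurable B → Measurable (A ∩ B)
    measurable-∩ {A} {B} mA mB = measurable-resp-≐ (to , from)
      (measurable-∁ (measurable-∪ (measurable-∁ mA) (measurable-∁ mB)))
      where
      to : ∁ (∁ A ∪ ∁ B) ⊆ A ∩ B
      to {ω} ω∉ with em {A ω} | em {B ω}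
      ... | yes ω∈A | yes ω∈B = ω∈A , ω∈B
      ... | no ω∉A  | _       = ⊥-elim (ω∉ (inj₁ ω∉A))
      ... | yes _   | no ω∉B  = ⊥-elim (ω∉ (inj₂ ω∉B))
      from : A ∩ B ⊆ ∁ (∁ A ∪ ∁ B)
      from (ω∈A , ω∈B) = [ (λ ω∉A → ω∉A ω∈A) , (λ ω∉B → ω∉B ω∈B) ]′

    measurable-∀ : ∀ n {F : Fin n → Pred Ω 0ℓ} → (∀ i → Measurable (F i)) →
                   Measurable (λ ω → ∀ i → F i ω)
    measurable-∀ zero    mF = measurable-resp-≐ ((λ _ ()) , _) measurable-U
    measurable-∀ (suc n) mF = measurable-resp-≐
      ((λ { (ω∈F₀ , ω∈F) Fin.zero → ω∈F₀ ; (ω∈F₀ , ω∈F) (Fin.suc i) → ω∈F i }) ,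
       (λ ω∈F → ω∈F Fin.zero , λ i → ω∈F (Fin.suc i)))
      (measurable-∩ (mF Fin.zero) (measurable-∀ n (λ i → mF (Fin.suc i))))

    -- By σ-additivity for the constant sequence of empty sets, the series with constant term z = Pr
    -- ∅ has some sum l; prefixing one more term gives z + l = l.
    Pr-∅ : Pr ∅ ≈ 0#
    Pr-∅ = constant-summable (σ-additive (λ _ → ∅) (λ _ → measurable-∅) (λ _ ()))
      where
      constant-summable : ∀ {z l} → HasSum (λ _ → z) l → z ≈ 0#
      constant-summable {z} {l} Σz→l = begin-equality
        z          ≈⟨ solve 2 (λ z l → z := z :+ l :- l) refl _ _ ⟩
        z + l - l  ≈⟨ +-congʳ (lim-unique (lim-+ (lim-const z) Σz→l) (lim-suc Σz→l)) ⟩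
        l - l      ≈⟨ solve 1 (λ l → l :- l := :0) refl _ ⟩
        0#         ∎
        where
        lim-suc : s ⟶ l → (s ∘ suc) ⟶ l
        lim-suc s→l ε 0<ε with s→l ε 0<ε
        ... | N , close = N , λ n N≤n → close (suc n) (ℕ.m≤n⇒m≤1+n N≤n)

    Pr-⊎ : Measurable A → Measurable B → A ⊥ B → C ≐ A ∪ B → Pr C ≈ Pr A + Pr B
    Pr-⊎ {A} {B} {C} mA mB A⊥B (C⊆A∪B , A∪B⊆C) = begin-equality
      Pr C          ≈⟨ Pr-cong (measurable-⋃ F mF) (to , from) ⟨
      Pr (⋃ ℕ F)    ≈⟨ lim-unique (σ-additive F mF disjoint) (eventually-constant 2 λ { (suc (suc n)) (s≤s (s≤s _)) → sum-F n }) ⟩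
      Pr A + Pr B   ∎
      where
      F : ℕ → Pred Ω 0ℓ
      F zero          = A
      F (suc zero)    = B
      F (suc (suc _)) = ∅
      mF : ∀ i → Measurable (F i)
      mF zero          = mA
      mF (suc zero)    = mB
      mF (suc (suc _)) = measurable-∅
      disjoint : ∀ {i j} → i ≢ j → F i ⊥ F j
      disjoint {zero}        {zero}        i≢j _           = i≢j ≡.refl
      disjoint {zero}        {suc zero}    _   both        = A⊥B both
      disjoint {suc zero}    {zero}        _   (ω∈B , ω∈A) = A⊥B (ω∈A , ω∈B)
      disjoint {suc zero}    {suc zero}    i≢j _           = i≢j ≡.refl
      disjoint {suc (suc _)} {_}           _   (() , _)
      disjoint {zero}        {suc (suc _)} _   (_ , ())
      disjoint {suc zero}    {suc (suc _)} _   (_ , ())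
      to : ⋃ ℕ F ⊆ C
      to (zero     , ω∈A) = A∪B⊆C (inj₁ ω∈A)
      to (suc zero , ω∈B) = A∪B⊆C (inj₂ ω∈B)
      from : C ⊆ ⋃ ℕ F
      from ω∈C with C⊆A∪B ω∈C
      ... | inj₁ ω∈A = 0 , ω∈A
      ... | inj₂ ω∈B = 1 , ω∈B
      sum-F : ∀ n → psum (λ i → Pr (F i)) (suc (suc n)) ≈ Pr A + Pr B
      sum-F n = +-congˡ (trans (+-congˡ (trans (psum-cong (λ _ → Pr-∅) n) (psum-0 n))) (+-identityʳ _))

    Pr-∁ : Measurable A → Pr A + Pr (∁ A) ≈ 1#
    Pr-∁ {A} mA = trans (sym (Pr-⊎ mA (measurable-∁ mA) (λ (ω∈A , ω∉A) → ω∉A ω∈A) ((λ _ → excluded-middle) , _))) Pr-U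
      where
      excluded-middle : ∀ {ω} → (A ∪ ∁ A) ω
      excluded-middle {ω} with em {A ω}
      ... | yes ω∈A = inj₁ ω∈A
      ... | no ω∉A  = inj₂ ω∉A

    Pr≤1 : Measurable A → Pr A ≤ 1#
    Pr≤1 {A} mA = by-diff (Pr-nonNeg (measurable-∁ mA)) (begin-equality
      Pr (∁ A)                   ≈⟨ solve 2 (λ u v → v := u :+ v :- u) refl (Pr A) (Pr (∁ A)) ⟩
      Pr A + Pr (∁ A) - Pr A     ≈⟨ +-congʳ (Pr-∁ mA) ⟩
      1# - Pr A                  ∎)

    -- The law of the sum by fixing one variable at a time

    0F 1F : Fin 2
    0F = Fin.zero
    1F = Fin.suc Fin.zero

    parameter : (Ω → Fin 2) → Carrier
    parameter X = Pr (λ ω → X ω ≡ 1F)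

    parameters : ∀ {n} → (Fin n → Ω → Fin 2) → List Carrier
    parameters X = List.tabulate (λ i → parameter (X i))

    private
      bit : (b : Fin 2) → b ≡ 0F ⊎ b ≡ 1F
      bit Fin.zero           = inj₁ ≡.refl
      bit (Fin.suc Fin.zero) = inj₂ ≡.refl

    Pr-X≡0 : ∀ {X} → IsBernoulli X → Pr (λ ω → X ω ≡ 0F) ≈ 1# - parameter X
    Pr-X≡0 {X} bernoulliX = begin-equality
      Pr (λ ω → X ω ≡ 0F)
        ≈⟨ solve 2 (λ u v → u := u :+ v :- v) refl (Pr (λ ω → X ω ≡ 0F)) (parameter X) ⟩
      Pr (λ ω → X ω ≡ 0F) + parameter X - parameter X
        ≈⟨ +-congʳ (Pr-⊎ (bernoulliX (_≡ 0F)) (bernoulliX (_≡ 1F)) exclusive ((λ {ω} _ → bit (X ω)) , _)) ⟨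
      Pr U - parameter X
        ≈⟨ +-congʳ Pr-U ⟩
      1# - parameter X ∎
      where
      exclusive : (λ ω → X ω ≡ 0F) ⊥ (λ ω → X ω ≡ 1F)
      exclusive (≡0 , ≡1) = Fin.0≢1+n (≡.trans (≡.sym ≡0) ≡1)

    parameters-probabilities : ∀ n (X : Fin n → Ω → Fin 2) → (∀ i → IsBernoulli (X i)) →
                               All IsProbability (parameters X)
    parameters-probabilities n X bernoulliX = All.tabulate⁺ λ i →
      Pr-nonNeg (bernoulliX i (_≡ 1F)) , Pr≤1 (bernoulliX i (_≡ 1F))

    -- The event `E` records the variables already fixed. Multiplying by Pr E instead of dividing
    -- keeps the notion meaningful for events of probability 0.
    IndependentGiven : Pred Ω 0ℓ → ∀ {n} → (Fin n → Ω → Fin 2) → Set₁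
    IndependentGiven E {n} X = (F : Fin n → Pred (Fin 2) 0ℓ) →
      Pr (λ ω → E ω × (∀ i → X i ω ∈ F i)) ≈ Pr E * product (λ i → Pr (λ ω → X i ω ∈ F i))

    module _ {n} {X : Fin (suc n) → Ω → Fin 2} {E : Pred Ω 0ℓ} (mE : Measurable E)
             (bernoulliX : ∀ i → IsBernoulli (X i)) (indep : IndependentGiven E X) (b : Fin 2) where
      private
        E∩ : Pred Ω 0ℓ
        E∩ ω = E ω × (X Fin.zero ω ≡ b)

        fix : (Fin n → Pred (Fin 2) 0ℓ) → Fin (suc n) → Pred (Fin 2) 0ℓ
        fix F Fin.zero    = _≡ b
        fix F (Fin.suc i) = F i

        Pr-fix : ∀ F → Pr (λ ω → E∩ ω × (∀ i → X (Fin.suc i) ω ∈ F i)) ≈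
                 Pr E * (Pr (λ ω → X Fin.zero ω ≡ b) * product (λ i → Pr (λ ω → X (Fin.suc i) ω ∈ F i)))
        Pr-fix F = trans (sym (Pr-cong
          (measurable-∩ mE (measurable-∀ (suc n) (λ i → bernoulliX i (fix F i))))
          ((λ (ω∈E , X∈F) → (ω∈E , X∈F Fin.zero) , λ i → X∈F (Fin.suc i)) ,
           (λ ((ω∈E , X₀≡b) , X∈F) → ω∈E , λ { Fin.zero → X₀≡b ; (Fin.suc i) → X∈F i }))))
          (indep (fix F))

      measurable-given : Measurable E∩
      measurable-given = measurable-∩ mE (bernoulliX Fin.zero (_≡ b))

      -- The full set for each remaining coordinate contributes a factor 1 and leaves the marginal.
      Pr-given : Pr E∩ ≈ Pr E * Pr (λ ω → X Fin.zero ω ≡ b)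
      Pr-given = begin-equality
        Pr E∩
          ≈⟨ Pr-cong measurable-given ((λ ω∈ → ω∈ , _) , proj₁) ⟩
        Pr (λ ω → E∩ ω × (∀ i → X (Fin.suc i) ω ∈ U))
          ≈⟨ Pr-fix (λ _ → U) ⟩
        Pr E * (Pr (λ ω → X Fin.zero ω ≡ b) * product {n} (λ _ → Pr U))
          ≈⟨ *-congˡ (*-congˡ (trans (product-cong {n} (λ _ → Pr-U)) (product-1 n))) ⟩
        Pr E * (Pr (λ ω → X Fin.zero ω ≡ b) * 1#)
          ≈⟨ solve 2 (λ u v → u :* (v :* :1) := u :* v) refl (Pr E) (Pr (λ ω → X Fin.zero ω ≡ b)) ⟩
        Pr E * Pr (λ ω → X Fin.zero ω ≡ b) ∎
      independent-given : IndependentGiven E∩ (λ i → X (Fin.suc i))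
      independent-given F = trans (Pr-fix F) (trans
        (solve 3 (λ u v w → u :* (v :* w)
              := u :* v :* w)
              refl (Pr E) (Pr (λ ω → X Fin.zero ω ≡ b)) (product (λ i → Pr (λ ω → X (Fin.suc i) ω ∈ F i))))
        (*-congʳ (sym Pr-given)))
    -- Splitting on the first variable reproduces the recursion `psum-bernoulli`, with `E` shrinking
    -- to the event that this variable has the chosen value. Measurability is proved alongside
    -- because additivity of the two halves depends on it.
    law-given : ∀ n (X : Fin n → Ω → Fin 2) E → Measurable E → (∀ i → IsBernoulli (X i)) →
      IndependentGiven E X → ∀ k →
      Measurable (λ ω → E ω × sumRV X ω ℕ.< k) ×
      (Pr (λ ω → E ω × sumRV X ω ℕ.< k) ≈ Pr E * cdf 0# (parameters X) k)
    law-given zero X E mE bernoulliX indep zero =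
      measurable-resp-≐ ∅≐ measurable-∅ ,
      trans (sym (Pr-cong measurable-∅ ∅≐)) (trans Pr-∅ (solve 1 (λ u → :0 := u :* :0) refl (Pr E)))
      where
      ∅≐ : ∅ ≐ (λ ω → E ω × (0 ℕ.< 0))
      ∅≐ = (λ ()) , λ ()
    law-given zero X E mE bernoulliX indep (suc k) =
      measurable-resp-≐ E≐ mE ,
      trans (sym (Pr-cong mE E≐)) (trans
          (solve 1 (λ u → u := u :* :1) refl (Pr E)) (*-congˡ (sym (expSum-0 k))))
      where
      E≐ : E ≐ (λ ω → E ω × (0 ℕ.< suc k))
      E≐ = (λ ω∈E → ω∈E , s≤s z≤n) , proj₁
    law-given (suc n) X E mE bernoulliX indep k =
      measurable-resp-≐ (proj₂ split , proj₁ split) (measurable-∪ (proj₁ law₀) (proj₁ law₁)) ,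
      (begin-equality
        Pr (λ ω → E ω × sumRV X ω ℕ.< k)
          ≈⟨ Pr-⊎ (proj₁ law₀) (proj₁ law₁) exclusive split ⟩
        Pr (λ ω → E₀ ω × sumRV X′ ω ℕ.< k) + Pr (λ ω → E₁ ω × sumRV X′ ω ℕ.< k ∸ 1)
          ≈⟨ +-cong (proj₂ law₀) (proj₂ law₁) ⟩
        Pr E₀ * cdf 0# qs k + Pr E₁ * cdf 0# qs (k ∸ 1)
          ≈⟨ +-cong (*-congʳ (trans (Pr-given mE bernoulliX indep 0F) (*-congˡ (Pr-X≡0 (bernoulliX Fin.zero)))))
                    (*-congʳ (Pr-given mE bernoulliX indep 1F)) ⟩
        Pr E * (1# - p₀) * cdf 0# qs k + Pr E * p₀ * cdf 0# qs (k ∸ 1)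
          ≈⟨ solve 4 (λ e p₀ u v → e :* (:1 :- p₀) :* u :+ e :* p₀ :* v
                := e :* ((:1 :- p₀) :* u :+ p₀ :* v)) refl (Pr E) p₀ (cdf 0# qs k) (cdf 0# qs (k ∸ 1)) ⟩
        Pr E * ((1# - p₀) * cdf 0# qs k + p₀ * cdf 0# qs (k ∸ 1))
          ≈⟨ *-congˡ (psum-bernoulli p₀ (pmf 0# qs) k) ⟨
        Pr E * cdf 0# (parameters X) k ∎)
      where
      X′ : Fin n → Ω → Fin 2
      X′ i = X (Fin.suc i)
      p₀ : Carrier
      p₀ = parameter (X Fin.zero)
      qs : List Carrier
      qs = parameters X′
      E₀ E₁ : Pred Ω 0ℓ
      E₀ ω = E ω × (X Fin.zero ω ≡ 0F)
      E₁ ω = E ω × (X Fin.zero ω ≡ 1F)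
      law₀ = law-given n X′ E₀ (measurable-given mE bernoulliX indep 0F) (λ i → bernoulliX (Fin.suc i))
               (independent-given mE bernoulliX indep 0F) k
      law₁ = law-given n X′ E₁ (measurable-given mE bernoulliX indep 1F) (λ i → bernoulliX (Fin.suc i))
               (independent-given mE bernoulliX indep 1F) (k ∸ 1)
      exclusive : (λ ω → E₀ ω × sumRV X′ ω ℕ.< k) ⊥ (λ ω → E₁ ω × sumRV X′ ω ℕ.< k ∸ 1)
      exclusive (((_ , ≡0) , _) , ((_ , ≡1) , _)) = Fin.0≢1+n (≡.trans (≡.sym ≡0) ≡1)
      -- At k = 0 the truncated k ∸ 1 does no harm, as both inequalities are impossible there.
      pred-< : ∀ {m} k → suc m ℕ.< k → m ℕ.< k ∸ 1
      pred-< (suc k) (s≤s m<k) = m<k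
      suc-< : ∀ {m} k → m ℕ.< k ∸ 1 → suc m ℕ.< k
      suc-< (suc k) m<k = s≤s m<k
      split : (λ ω → E ω × sumRV X ω ℕ.< k) ≐
              (λ ω → E₀ ω × sumRV X′ ω ℕ.< k) ∪ (λ ω → E₁ ω × sumRV X′ ω ℕ.< k ∸ 1)
      split = to , from
        where
        to : (λ ω → E ω × sumRV X ω ℕ.< k) ⊆
             (λ ω → E₀ ω × sumRV X′ ω ℕ.< k) ∪ (λ ω → E₁ ω × sumRV X′ ω ℕ.< k ∸ 1)
        to {ω} (ω∈E , S<k) with bit (X Fin.zero ω)
        ... | inj₁ ≡0 = inj₁ ((ω∈E , ≡0) , ≡.subst (λ b → Fin.toℕ b ℕ.+ sumRV X′ ω ℕ.< k) ≡0 S<k)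
        ... | inj₂ ≡1 = inj₂ ((ω∈E , ≡1) , pred-< k (≡.subst (λ b → Fin.toℕ b ℕ.+ sumRV X′ ω ℕ.< k) ≡1 S<k))
        from : (λ ω → E₀ ω × sumRV X′ ω ℕ.< k) ∪ (λ ω → E₁ ω × sumRV X′ ω ℕ.< k ∸ 1) ⊆
               (λ ω → E ω × sumRV X ω ℕ.< k)
        from {ω} (inj₁ ((ω∈E , ≡0) , S′<k)) =
          ω∈E , ≡.subst (λ b → Fin.toℕ b ℕ.+ sumRV X′ ω ℕ.< k) (≡.sym ≡0) S′<k
        from {ω} (inj₂ ((ω∈E , ≡1) , S′<k-1)) =
          ω∈E , ≡.subst (λ b → Fin.toℕ b ℕ.+ sumRV X′ ω ℕ.< k) (≡.sym ≡1) (suc-< k S′<k-1)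
    module _ {n} (X : Fin n → Ω → Fin 2) (bernoulliX : ∀ i → IsBernoulli (X i))
             (independent : Independent X) where
      private
        ps′ : List Carrier
        ps′ = parameters X

        S : Ω → ℕ
        S = sumRV X

        law : ∀ k → Measurable (λ ω → U ω × S ω ℕ.< k) × (Pr (λ ω → U ω × S ω ℕ.< k) ≈ Pr U * cdf 0# ps′ k)
        law = law-given n X U measurable-U bernoulliX λ F → begin-equality
          Pr (λ ω → U ω × (∀ i → X i ω ∈ F i))
            ≈⟨ Pr-cong (measurable-∀ n (λ i → bernoulliX i (F i))) ((λ X∈F → _ , X∈F) , proj₂) ⟨
          Pr (λ ω → ∀ i → X i ω ∈ F i)
            ≈⟨ independent F ⟩
          product (λ i → Pr (λ ω → X i ω ∈ F i))
            ≈⟨ solve 1 (λ u → u := :1 :* u) refl (product (λ i → Pr (λ ω → X i ω ∈ F i))) ⟩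
          1# * product (λ i → Pr (λ ω → X i ω ∈ F i))
            ≈⟨ *-congʳ Pr-U ⟨
          Pr U * product (λ i → Pr (λ ω → X i ω ∈ F i)) ∎
      measurable-S< : ∀ k → Measurable (λ ω → S ω ℕ.< k)
      measurable-S< k = measurable-resp-≐ (proj₂ , λ S<k → _ , S<k) (proj₁ (law k))

      Pr-S< : ∀ k → Pr (λ ω → S ω ℕ.< k) ≈ cdf 0# ps′ k
      Pr-S< k = begin-equality
        Pr (λ ω → S ω ℕ.< k)           ≈⟨ Pr-cong (measurable-S< k) ((λ S<k → _ , S<k) , proj₂) ⟩
        Pr (λ ω → U ω × S ω ℕ.< k)     ≈⟨ proj₂ (law k) ⟩
        Pr U * cdf 0# ps′ k             ≈⟨ *-congʳ Pr-U ⟩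
        1# * cdf 0# ps′ k               ≈⟨ solve 1 (λ u → :1 :* u := u) refl (cdf 0# ps′ k) ⟩
        cdf 0# ps′ k                    ∎
      -- `𝔼` is defined through point probabilities, which are recovered as differences of
      -- consecutive values of the distribution function.
      Pr-S≡ : ∀ k → Pr (λ ω → S ω ≡ k) ≈ pmf 0# ps′ k
      Pr-S≡ k = begin-equality
        Pr (λ ω → S ω ≡ k)
          ≈⟨ isolate (Pr (λ ω → S ω ℕ.< k)) (Pr (λ ω → S ω ≡ k)) ⟩
        Pr (λ ω → S ω ℕ.< k) + Pr (λ ω → S ω ≡ k) - Pr (λ ω → S ω ℕ.< k)
          ≈⟨ +-congʳ (Pr-⊎ (measurable-S< k) measurable-S≡ (λ (S<k , S≡k) → ℕ.<-irrefl S≡k S<k) split) ⟨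
        Pr (λ ω → S ω ℕ.< suc k) - Pr (λ ω → S ω ℕ.< k)
          ≈⟨ +-cong (trans (Pr-S< (suc k)) (psum-suc (pmf 0# ps′) k)) (-‿cong (Pr-S< k)) ⟩
        cdf 0# ps′ k + pmf 0# ps′ k - cdf 0# ps′ k
          ≈⟨ isolate (cdf 0# ps′ k) (pmf 0# ps′ k) ⟨
        pmf 0# ps′ k ∎
        where
        isolate : ∀ u v → v ≈ u + v - u
        isolate = solve 2 (λ u v → v := u :+ v :- u) refl
        measurable-S≡ : Measurable (λ ω → S ω ≡ k)
        measurable-S≡ = measurable-resp-≐
          ((λ { (s≤s S≤k , S≮k) → ℕ.≤-antisym S≤k (ℕ.≮⇒≥ S≮k) }) ,
           (λ S≡k → s≤s (ℕ.≤-reflexive S≡k) , ℕ.<-irrefl S≡k))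
          (measurable-∩ (measurable-S< (suc k)) (measurable-∁ (measurable-S< k)))
        split : (λ ω → S ω ℕ.< suc k) ≐ (λ ω → S ω ℕ.< k) ∪ (λ ω → S ω ≡ k)
        split = (λ { (s≤s S≤k) → ℕ.m≤n⇒m<n∨m≡n S≤k }) ,
                [ (λ S<k → ℕ.m≤n⇒m≤1+n S<k) , (λ S≡k → s≤s (ℕ.≤-reflexive S≡k)) ]′

      𝔼-S : 𝔼 S ≈ mean 0# ps′
      𝔼-S = ∑∞-unique {f = λ j → fromℕ j * Pr (λ ω → S ω ≡ j)}
        (eventually-constant (suc (length ps′)) λ i |ps′|<i → trans
          (psum-cong (λ j → *-congˡ {fromℕ j} (Pr-S≡ j)) i)
          (trans (reflexive (≡.cong (moment (pmf 0# ps′)) (≡.sym (ℕ.m+[n∸m]≡n |ps′|<i))))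
            (moment-pmf ps′ (i ∸ suc (length ps′)))))

      tail-bound : ∀ j x → 0# ≤ x → 𝔼 S ≈ fromℕ (suc j) * x →
                   Pr (λ ω → S ω ℕ.≤ j) ≤ P (suc j) x
      tail-bound j x 0≤x 𝔼S≈Kx = begin
        Pr (λ ω → S ω ℕ.≤ j)        ≈⟨ Pr-cong (measurable-S< (suc j)) ((λ { (s≤s S≤j) → S≤j }) , s≤s) ⟨
        Pr (λ ω → S ω ℕ.< suc j)    ≤⟨ cases em ⟩
        P (suc j) x                 ∎
        where
        K μ : Carrier
        K = fromℕ (suc j)
        μ = mean 0# ps′
        μ≈Kx : μ ≈ K * x
        μ≈Kx = trans (sym 𝔼-S) 𝔼S≈Kx
        E : Carrier
        E = sqrt K * (x - (K - 1#) / K)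
        -- exp μ stays on both sides because `Poisson-domination` is unnormalised; it is cancelled
        -- afterwards, being positive.
        large : 1# < x → exp μ * cdf 0# ps′ (suc j) ≤ exp μ * exp (- E)
        large 1<x = begin
          exp μ * cdf 0# ps′ (suc j)
            ≤⟨ Poisson-domination {k = j} ≤-refl (parameters-probabilities n X bernoulliX) K≤μ ⟩
          expSum μ (suc j)
            ≈⟨ psum-cong (expTerm-cong μ≈Kx) (suc j) ⟩
          expSum (K * x) (suc j)
            ≤⟨ Poisson-tail j (sqrt K) x (proj₁ √K) (proj₂ √K) (proj₁ 1<x) ⟩
          exp (K * x - E)
            ≈⟨ exp-+ (K * x) (- E) ⟩
          exp (K * x) * exp (- E)
            ≈⟨ *-congʳ (exp-cong μ≈Kx) ⟨
          exp μ * exp (- E) ∎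
          where
          √K : (0# ≤ sqrt K) × (sqrt K * sqrt K ≈ K)
          √K = sqrt-spec (fromℕ-nonNeg (suc j))
          K≤μ : K ≤ μ
          K≤μ = begin
            K         ≈⟨ solve 1 (λ u → u := u :* :1) refl K ⟩
            K * 1#    ≤⟨ *-monoˡ-≤ (fromℕ-nonNeg (suc j)) (proj₁ 1<x) ⟩
            K * x     ≈⟨ μ≈Kx ⟨
            μ         ∎
        cases : Dec (1# < x) → Pr (λ ω → S ω ℕ.< suc j) ≤ P (suc j) x
        cases (no 1≮x)  = ≤-trans (Pr≤1 (measurable-S< (suc j))) (≤-reflexive (reflexive (≡.sym (P-small (suc j) 1≮x))))
        cases (yes 1<x) = begin
          Pr (λ ω → S ω ℕ.< suc j)    ≈⟨ Pr-S< (suc j) ⟩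
          cdf 0# ps′ (suc j)           ≤⟨ *-cancelˡ-≤ (exp-positive μ) (large 1<x) ⟩
          exp (- E)                   ≡⟨ P-large (suc j) 1<x ⟨
          P (suc j) x                 ∎

theorem2p2 :
  (em : ExcludedMiddle 0ℓ) (ℝ : CompleteOrderedField) →
  let open CompleteOrderedField ℝ
      open Analysis em ℝ in
  (k : ℕ) → 1 ℕ.≤ k →
  NonIncreasingOn (λ x → 0# ≤ x) (P k) ×
  ConvexOn (λ x → 1# ≤ x) (P k) ×
  ((𝓟 : ProbabilitySpace) →
   let open ProbabilitySpace 𝓟 in
   (n : ℕ) (X : Fin n → Ω → Fin 2) →
   (∀ i → IsBernoulli (X i)) → Independent X →
   (x : Carrier) → 0# ≤ x → 𝔼 (sumRV X) ≈ fromℕ k * x →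
   Pr (λ ω → sumRV X ω ℕ.≤ k ∸ 1) ≤ P k x)
-- The hypothesis 1 ≤ k leaves only successors, for which k ∸ 1 reduces to `j`.
theorem2p2 em ℝ (suc j) 1≤k =
  P-nonIncreasing (suc j) 1≤k ,
  P-convex (suc j) 1≤k ,
  λ 𝓟 n X bernoulliX independent → tail-bound 𝓟 X bernoulliX independent j
  where open Development em ℝ
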